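{- There exists a constant $C>0$ such that $s_r(K_3)\le C r^2\log r$ for all integers $r\ge 2$.
   Context: For graphs $G,H$ and an integer $r\ge 2$, $G$ is $r$-Ramsey for $H$ (written $G\to(H)_r$) if every colouring of the edges of $G$ with $r$ colours contains a monochromatic copy of $H$. $G$ is $r$-Ramsey minimal for $H$ if $G\to(H)_r$ but $G'\not\to(H)_r$ for every proper subgraph $G'\subsetneq G$. Let $\mathcal M_r(H)$ be the class of graphs that are $r$-Ramsey minimal for $H$, and $s_r(H):=\min_{G\in\mathcal M_r(H)}\delta(G)$, where $\delta(G)$ is the minimum degree of $G$. $K_3$ is the triangle. -}

module Defs where

open import Data.Nat using (ℕ; _+_; _*_; _≤_)
open import Data.Nat.Logarithm using (⌊log₂_⌋)
open import Data.Fin using (Fin)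
open import Data.Bool using (Bool; true; false; if_then_else_)
open import Data.List using (List; map; allFin)
open import Data.Nat.ListAction using (sum)
open import Data.Product using (Σ; ∃; ∃-syntax; _×_; _,_)
open import Data.Sum using (_⊎_)
open import Relation.Binary.PropositionalEquality using (_≡_)
open import Relation.Nullary using (¬_)

record Graph : Set where
  field
    n     : ℕ
    adj   : Fin n → Fin n → Bool
    sym   : ∀ u v → adj u v ≡ adj v u
    irref : ∀ v → adj v v ≡ false
open Graph public

-- An r-colouring of the edges of a graph on Fin n: a symmetric assignment of
-- a colour in Fin r to each (unordered) pair; only values on edges matter.
record Colouring (r n : ℕ) : Set where
  field
    col    : Fin n → Fin n → Fin r
    colSym : ∀ u v → col u v ≡ col v u
open Colouring public

MonoTriangle : ∀ {r n} → (Fin n → Fin n → Bool) → Colouring r n → Set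
MonoTriangle {r} {n} E c =
  ∃[ a ] ∃[ b ] ∃[ d ]
    ( (E a b ≡ true) × (E b d ≡ true) × (E a d ≡ true)
    × (col c a b ≡ col c b d) × (col c a b ≡ col c a d) )

RamseyK3 : (r n : ℕ) → (Fin n → Fin n → Bool) → Set
RamseyK3 r n E = (c : Colouring r n) → MonoTriangle E c

RamseyFor : ℕ → Graph → Set
RamseyFor r G = RamseyK3 r (n G) (adj G)

record Subgraph (G : Graph) : Set where
  field
    V'     : Fin (n G) → Bool
    E'     : Fin (n G) → Fin (n G) → Bool
    E'sym  : ∀ u v → E' u v ≡ E' v u
    E'⊆E   : ∀ u v → E' u v ≡ true → adj G u v ≡ true
    E'ends : ∀ u v → E' u v ≡ true → (V' u ≡ true) × (V' v ≡ true)
open Subgraph public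

Proper : {G : Graph} → Subgraph G → Set
Proper {G} H =
  (∃[ v ] (V' H v ≡ false))
  ⊎ (∃[ u ] ∃[ v ] ((adj G u v ≡ true) × (E' H u v ≡ false)))

-- Monochromatic triangles only use edges, so the Ramsey property of the
-- subgraph (V', E') is the Ramsey property of its edge set E'.
SubRamseyFor : (r : ℕ) → {G : Graph} → Subgraph G → Set
SubRamseyFor r {G} H = RamseyK3 r (n G) (E' H)

RamseyMinimal : ℕ → Graph → Set
RamseyMinimal r G =
  RamseyFor r G × ((H : Subgraph G) → Proper H → ¬ SubRamseyFor r H)

deg : (G : Graph) → Fin (n G) → ℕ
deg G v = sum (map (λ u → if adj G v u then 1 else 0) (allFin (n G)))

MinDegreeAtMost : Graph → ℕ → Set
MinDegreeAtMost G X = ∃[ v ] (deg G v ≤ X)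

-- s_r(K₃) ≤ X  (the minimum over 𝓜_r(K₃) is at most X iff some member has
-- minimum degree at most X)
s-K3-AtMost : ℕ → ℕ → Set
s-K3-AtMost r X = ∃[ G ] (RamseyMinimal r G × MinDegreeAtMost G X)

-- Call a colouring of some of the pairs of [n] with r colours a packing if no colour contains a triangle and every
-- map f : [n] → [r] has a pair u, v of colour f u = f v.
--
-- A packing gives s_r(K₃) ≤ n.  Let P be a graph with a triangle-free r-colouring such that every such colouring
-- contains a copy of the packing, up to renaming the colours.  Join a new vertex to every n-tuple of vertices of P:
-- the colours of the new edges at a copy of the packing form a map f, so a monochromatic triangle appears.  A
-- minimal Ramsey subgraph must use a new vertex, and these have degree at most n.  To find P, start with a coloured
-- graph T containing the packing such that any colouring of T whose monochromatic triangles are among the given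
-- ones agrees with the given one on the packing, up to renaming; copies of a colouring of K_N with as few
-- monochromatic triangles as possible, glued along monochromatic triangles, force equal colours.  The given
-- monochromatic triangles are then destroyed one at a time: replace T by T × [M] and prescribe the order of the
-- second coordinates along edges so that this triangle cannot occur, while Ramsey's theorem still yields three
-- levels on which a colouring looks like a colouring of T.
--
-- A packing with n = O(r² log r).  Give the vertices random coordinates α, β among a = r² points, and colour the
-- pairs of points twice at random (matrices A and B), each of the r colours having probability 2⁻²⁴/r.  A pair
-- u, v gets colour i if A gives it to α u, α v, while B leaves β u, β v blank and joins them by no path of length
-- two of colour i (and neither does A below both ends), or the same with A and B exchanged.  As Θ(log r) vertices
-- share a coordinate, a degree of order r log r costs only a small fraction of the pairs being closed by paths.  A
-- set of n/r vertices has Ω(r log r) different coordinates α or β, and the chance that no pair of it survives in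
-- colour i is small enough for a union bound over all such sets.

module Submission where

open import Defs hiding (sym; n; irref; deg; adj)
open import Data.Bool using (Bool; true; false; if_then_else_; _∧_; _∨_; not; T; T?)
import Data.Bool.Properties as Bool
open import Data.Empty using (⊥; ⊥-elim)
open import Data.Fin using (Fin; zero; suc; toℕ; fromℕ; fromℕ<; inject₁; inject≤; finToFun; funToFin; combine; remQuot; splitAt; join; punchIn; punchOut; _↑ˡ_; _↑ʳ_)
open import Data.Fin.Properties using (_≟_; any?; all?; toℕ-injective; toℕ<n; toℕ-fromℕ; toℕ-fromℕ<; toℕ-inject₁; toℕ-inject≤; inject≤-injective; finToFun-funToFin; remQuot-combine; splitAt-join; splitAt-↑ˡ; splitAt-↑ʳ; splitAt⁻¹-↑ˡ; punchIn-punchOut; punchIn-injective; punchInᵢ≢i; punchOut-injective; pigeonhole)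
open import Data.List using (List; []; _∷_; map; _++_; length; concatMap; allFin; replicate; filterᵇ; take; drop)
open import Data.List.Properties using (length-map; map-tabulate; length-++; length-tabulate; length-take; length-drop; length-replicate; take++drop≡id)
open import Data.List.Membership.Propositional using (_∈_)
open import Data.List.Membership.Propositional.Properties using (∈-++⁺ˡ; ∈-++⁺ʳ; ∈-map⁺; ∈-allFin; ∈-filter⁻)
open import Data.List.Relation.Unary.All as All using (All; []; _∷_)
open import Data.List.Relation.Unary.All.Properties using (++⁺)
open import Data.List.Relation.Unary.AllPairs using (AllPairs; []; _∷_)
import Data.List.Relation.Unary.AllPairs.Properties as AllPairs
open import Data.List.Relation.Unary.Any using (here; there)
open import Data.Maybe using (Maybe; just; nothing; is-just; is-nothing; fromMaybe)
open import Data.Maybe.Properties using (just-injective)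
open import Data.Nat hiding (_≟_)
open import Data.Nat.DivMod using (_/_; _%_; m≡m%n+[m/n]*n; m%n<n; m/n≤m; m/n*n≤m)
open import Data.Nat.Induction using (<-rec)
open import Data.Nat.ListAction using (sum)
open import Data.Nat.Logarithm using (⌊log₂_⌋; ⌊log₂⌋-mono-≤; ⌊log₂[2^n]⌋≡n; ⌊log₂⌊n/2⌋⌋≡⌊log₂n⌋∸1)
open import Data.Nat.Properties hiding (_≟_)
open import Data.Nat.Tactic.RingSolver using (solve-∀)
open import Data.Product using (Σ; ∃-syntax; _×_; _,_; proj₁; proj₂)
import Data.Product.Properties as Product
open import Data.Sum using (_⊎_; inj₁; inj₂)
import Data.Sum.Properties as Sum
open import Data.Vec as Vec using (Vec; []; _∷_; lookup; _[_]≔_; zipWith)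
open import Data.Vec.Properties using (lookup∘tabulate; lookup∘update; lookup∘update′; lookup-zipWith; length-toList)
open import Function using (_∘_; id; _|>_)
open import Relation.Binary using (DecidableEquality; tri<; tri≈; tri>)
open import Relation.Binary.PropositionalEquality hiding (J)
open import Relation.Nullary using (¬_; Dec; yes; no; does; contradiction)
open import Relation.Nullary.Decidable using (dec-true; dec-false; _×-dec_; map′)

-- The obstacle is density. If the pairs of n ≈ r² log r vertices were coloured at random, with
-- probability of order 1/r per colour, two vertices would have of order log r common neighbours in
-- each colour; most pairs would be closed by a path of length two and discarding these would leave
-- hardly anything. Among a = r² points, with q = 2²⁴ r, the expected number is a/q² = 2⁻⁴⁸, and few
-- pairs are closed. The price is that vertices with the same coordinate get no edge from that
-- matrix, and a class of n/r vertices may have only of order r values of α, too few for a union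
-- bound over classes. The second coordinate repairs this: a class poor in both directions would
-- crowd into a small rectangle. In the second half, rigidity comes from minimality: if no colouring
-- has fewer monochromatic triangles, none can lose one without creating another. So every equality
-- of colours has to be forced through a triangle that stays monochromatic, and these triangles can
-- be destroyed only afterwards, in a way that keeps what they force. Probability is counting over
-- explicit finite lists throughout.

private variable
  A B V : Set
  ℓ ν : ℕ

-- Finite sums and averages

𝟙 : Bool → ℕ
𝟙 true  = 1
𝟙 false = 0

𝟙≤1 : ∀ b → 𝟙 b ≤ 1
𝟙≤1 true  = ≤-refl
𝟙≤1 false = z≤n

∑ : List A → (A → ℕ) → ℕ
∑ []       f = 0
∑ (x ∷ xs) f = f x + ∑ xs f

∑-cong : ∀ (xs : List A) {f g} → (∀ x → f x ≡ g x) → ∑ xs f ≡ ∑ xs g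
∑-cong []       e = refl
∑-cong (x ∷ xs) e = cong₂ _+_ (e x) (∑-cong xs e)

∑-mono-∈ : ∀ (xs : List A) {f g} → (∀ x → x ∈ xs → f x ≤ g x) → ∑ xs f ≤ ∑ xs g
∑-mono-∈ []       e = z≤n
∑-mono-∈ (x ∷ xs) e = +-mono-≤ (e x (here refl)) (∑-mono-∈ xs (λ y → e y ∘ there))

∑-mono : ∀ (xs : List A) {f g} → (∀ x → f x ≤ g x) → ∑ xs f ≤ ∑ xs g
∑-mono xs e = ∑-mono-∈ xs (λ x _ → e x)

∑-+ : ∀ (xs : List A) f g → ∑ xs (λ x → f x + g x) ≡ ∑ xs f + ∑ xs g
∑-+ []       f g = refl
∑-+ (x ∷ xs) f g = trans (cong (f x + g x +_) (∑-+ xs f g)) (shuffle (f x) (g x) (∑ xs f) (∑ xs g))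
  where
  shuffle : ∀ a b c d → a + b + (c + d) ≡ a + c + (b + d)
  shuffle = solve-∀

∑-*ˡ : ∀ (xs : List A) c f → ∑ xs (λ x → c * f x) ≡ c * ∑ xs f
∑-*ˡ []       c f = sym (*-zeroʳ c)
∑-*ˡ (x ∷ xs) c f = trans (cong (c * f x +_) (∑-*ˡ xs c f)) (sym (*-distribˡ-+ c (f x) (∑ xs f)))

∑-*ʳ : ∀ (xs : List A) c f → ∑ xs (λ x → f x * c) ≡ ∑ xs f * c
∑-*ʳ []       c f = refl
∑-*ʳ (x ∷ xs) c f = trans (cong (f x * c +_) (∑-*ʳ xs c f)) (sym (*-distribʳ-+ c (f x) (∑ xs f)))

∑-const : ∀ (xs : List A) c → ∑ xs (λ _ → c) ≡ length xs * c
∑-const []       c = refl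
∑-const (x ∷ xs) c = cong (c +_) (∑-const xs c)

∑-zero : ∀ (xs : List A) → ∑ xs (λ _ → 0) ≡ 0
∑-zero xs = trans (∑-const xs 0) (*-zeroʳ (length xs))

∑-bound : ∀ (xs : List A) {f} c → (∀ x → f x ≤ c) → ∑ xs f ≤ length xs * c
∑-bound xs c h = ≤-trans (∑-mono xs h) (≤-reflexive (∑-const xs c))

∑-swap : ∀ (xs : List A) (ys : List B) (f : A → B → ℕ) →
         ∑ xs (λ x → ∑ ys (f x)) ≡ ∑ ys (λ y → ∑ xs (λ x → f x y))
∑-swap []       ys f = sym (∑-zero ys)
∑-swap (x ∷ xs) ys f = trans (cong (∑ ys (f x) +_) (∑-swap xs ys f))
                             (sym (∑-+ ys (f x) (λ y → ∑ xs (λ x → f x y))))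

∑-++ : ∀ (xs ys : List A) f → ∑ (xs ++ ys) f ≡ ∑ xs f + ∑ ys f
∑-++ []       ys f = refl
∑-++ (x ∷ xs) ys f = trans (cong (f x +_) (∑-++ xs ys f)) (sym (+-assoc (f x) _ _))

∑-map : ∀ (h : A → B) (xs : List A) f → ∑ (map h xs) f ≡ ∑ xs (f ∘ h)
∑-map h []       f = refl
∑-map h (x ∷ xs) f = cong (f (h x) +_) (∑-map h xs f)

∑-concatMap : ∀ (h : A → List B) (xs : List A) f → ∑ (concatMap h xs) f ≡ ∑ xs (λ x → ∑ (h x) f)
∑-concatMap h []       f = refl
∑-concatMap h (x ∷ xs) f = trans (∑-++ (h x) (concatMap h xs) f) (cong (∑ (h x) f +_) (∑-concatMap h xs f))

∑-∈ : ∀ {xs : List A} {x} → x ∈ xs → ∀ f → f x ≤ ∑ xs f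
∑-∈ (here refl) f = m≤m+n _ _
∑-∈ (there p)   f = ≤-trans (∑-∈ p f) (m≤n+m _ _)

∑-zero-∈ : ∀ {xs : List A} {x} {f : A → ℕ} → ∑ xs f ≡ 0 → x ∈ xs → f x ≡ 0
∑-zero-∈ {f = f} e p = n≤0⇒n≡0 (≤-trans (∑-∈ p f) (≤-reflexive e))

-- The first moment method: this is how a bound on the total number of defects yields an outcome
-- without defects.
∑<length⇒zero : ∀ (xs : List A) f → ∑ xs f < length xs → ∃[ x ] f x ≡ 0
∑<length⇒zero (x ∷ xs) f lt with f x in eq
... | zero  = x , eq
... | suc k = ∑<length⇒zero xs f (≤-trans (s≤s (m≤n+m _ k)) (s≤s⁻¹ lt))

length-as-∑ : ∀ (xs : List A) → ∑ xs (λ _ → 1) ≡ length xs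
length-as-∑ xs = trans (∑-const xs 1) (*-identityʳ _)

∑-square : ∀ (xs : List A) f → ∑ xs (λ x → ∑ xs (λ y → f x * f y)) ≡ ∑ xs f * ∑ xs f
∑-square xs f = trans (∑-cong xs (λ x → ∑-*ˡ xs (f x) f)) (∑-*ʳ xs (∑ xs f) f)

∑-fins : ∀ n (f : Fin (suc n) → ℕ) → ∑ (allFin (suc n)) f ≡ f zero + ∑ (allFin n) (f ∘ suc)
∑-fins n f = cong (f zero +_) (trans (cong (λ l → ∑ l f) (sym (map-tabulate id suc))) (∑-map suc (allFin n) f))

length-allFin : ∀ n → length (allFin n) ≡ n
length-allFin n = length-tabulate id

∏ : ∀ n → (Fin n → ℕ) → ℕ
∏ zero    f = 1
∏ (suc n) f = f zero * ∏ n (f ∘ suc)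

∏-cong : ∀ n {f g : Fin n → ℕ} → (∀ i → f i ≡ g i) → ∏ n f ≡ ∏ n g
∏-cong zero    e = refl
∏-cong (suc n) e = cong₂ _*_ (e zero) (∏-cong n (e ∘ suc))

∏-const : ∀ n c → ∏ n (λ _ → c) ≡ c ^ n
∏-const zero    c = refl
∏-const (suc n) c = cong (c *_) (∏-const n c)

∏-^ : ∀ n x (f : Fin n → ℕ) → ∏ n (λ i → x ^ f i) ≡ x ^ ∑ (allFin n) f
∏-^ zero    x f = refl
∏-^ (suc n) x f = trans (cong (x ^ f zero *_) (∏-^ n x (f ∘ suc)))
  (trans (sym (^-distribˡ-+-* x (f zero) _)) (cong (x ^_) (sym (∑-fins n f))))

∏-* : ∀ n (f g : Fin n → ℕ) → ∏ n (λ i → f i * g i) ≡ ∏ n f * ∏ n g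
∏-* zero    f g = refl
∏-* (suc n) f g = trans (cong (f zero * g zero *_) (∏-* n (f ∘ suc) (g ∘ suc)))
                        (shuffle (f zero) (g zero) (∏ n (f ∘ suc)) (∏ n (g ∘ suc)))
  where
  shuffle : ∀ a b c d → a * b * (c * d) ≡ a * c * (b * d)
  shuffle = solve-∀

vecs : List A → ∀ n → List (Vec A n)
vecs xs zero    = [] ∷ []
vecs xs (suc n) = concatMap (λ x → map (x ∷_) (vecs xs n)) xs

∑-vecs : ∀ (xs : List A) n (f : Vec A (suc n) → ℕ) →
         ∑ (vecs xs (suc n)) f ≡ ∑ xs (λ x → ∑ (vecs xs n) (λ v → f (x ∷ v)))
∑-vecs xs n f = trans (∑-concatMap (λ x → map (x ∷_) (vecs xs n)) xs f)
                      (∑-cong xs (λ x → ∑-map (x ∷_) (vecs xs n) f))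

length-vecs : ∀ (xs : List A) n → length (vecs xs n) ≡ length xs ^ n
length-vecs xs zero    = refl
length-vecs xs (suc n) = begin
  length (vecs xs (suc n)) ≡⟨ length-as-∑ (vecs xs (suc n)) ⟨
  ∑ (vecs xs (suc n)) (λ _ → 1) ≡⟨ ∑-vecs xs n (λ _ → 1) ⟩
  ∑ xs (λ _ → ∑ (vecs xs n) (λ _ → 1)) ≡⟨ ∑-const xs _ ⟩
  length xs * ∑ (vecs xs n) (λ _ → 1) ≡⟨ cong (length xs *_) (trans (length-as-∑ (vecs xs n)) (length-vecs xs n)) ⟩
  length xs * length xs ^ n                      ∎
  where open ≡-Reasoning

∈-concatMap⁺ : ∀ (h : A → List B) {xs x y} → x ∈ xs → y ∈ h x → y ∈ concatMap h xs
∈-concatMap⁺ h (here refl) q = ∈-++⁺ˡ q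
∈-concatMap⁺ h {z ∷ xs} (there p) q = ∈-++⁺ʳ (h z) (∈-concatMap⁺ h p q)

∈-vecs : ∀ (xs : List A) {n} (v : Vec A n) → (∀ i → lookup v i ∈ xs) → v ∈ vecs xs n
∈-vecs xs []      h = here refl
∈-vecs xs (x ∷ v) h = ∈-concatMap⁺ (λ x → map (x ∷_) (vecs xs _)) (h zero) (∈-map⁺ (x ∷_) (∈-vecs xs v (h ∘ suc)))

-- A product whose j-th factor only looks at the entries up to j: averaging the entries one after the other,
-- the j-th factor costs at most K j whatever the earlier entries are.
sequential-product : ∀ (xs : List A) → A → ∀ n (g : Fin n → Vec A n → ℕ) (K : Fin n → ℕ) →
  (∀ j v v′ → (∀ t → toℕ t ≤ toℕ j → lookup v t ≡ lookup v′ t) → g j v ≡ g j v′) →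
  (∀ j v → ∑ xs (λ x → g j (v [ j ]≔ x)) ≤ K j) →
  ∑ (vecs xs n) (λ v → ∏ n (λ j → g j v)) ≤ ∏ n K
sequential-product xs x₀ zero    g K dep bd = ≤-refl
sequential-product xs x₀ (suc n) g K dep bd = begin
  ∑ (vecs xs (suc n)) (λ v → ∏ (suc n) (λ j → g j v))
    ≡⟨ ∑-vecs xs n _ ⟩
  ∑ xs (λ x → ∑ (vecs xs n) (λ v → g zero (x ∷ v) * ∏ n (λ j → g (suc j) (x ∷ v))))
    ≡⟨ ∑-cong xs (λ x → trans (∑-cong (vecs xs n) (λ v → cong (_* ∏ n (λ j → g (suc j) (x ∷ v))) (head-only x v)))
                              (∑-*ˡ (vecs xs n) (g zero (x ∷ v₀)) _)) ⟩
  ∑ xs (λ x → g zero (x ∷ v₀) * ∑ (vecs xs n) (λ v → ∏ n (λ j → g (suc j) (x ∷ v))))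
    ≤⟨ ∑-mono xs (λ x → *-monoʳ-≤ (g zero (x ∷ v₀)) (tail-bound x)) ⟩
  ∑ xs (λ x → g zero (x ∷ v₀) * ∏ n (K ∘ suc))
    ≡⟨ ∑-*ʳ xs (∏ n (K ∘ suc)) _ ⟩
  ∑ xs (λ x → g zero (x ∷ v₀)) * ∏ n (K ∘ suc)
    ≤⟨ *-monoˡ-≤ (∏ n (K ∘ suc)) (bd zero (x₀ ∷ v₀)) ⟩
  ∏ (suc n) K ∎
  where
  open ≤-Reasoning
  v₀ = Vec.replicate n x₀
  head-only : ∀ x v → g zero (x ∷ v) ≡ g zero (x ∷ v₀)
  head-only x v = dep zero (x ∷ v) (x ∷ v₀) λ { zero _ → refl ; (suc t) () }
  tail-bound : ∀ x → ∑ (vecs xs n) (λ v → ∏ n (λ j → g (suc j) (x ∷ v))) ≤ ∏ n (K ∘ suc)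
  tail-bound x = sequential-product xs x₀ n (λ j v → g (suc j) (x ∷ v)) (K ∘ suc)
    (λ j v v′ e → dep (suc j) (x ∷ v) (x ∷ v′) λ { zero _ → refl ; (suc t) (s≤s p) → e t p })
    (λ j v → bd (suc j) (x ∷ v))

independent-product : ∀ (xs : List A) → A → ∀ n (f : Fin n → A → ℕ) →
  ∑ (vecs xs n) (λ v → ∏ n (λ j → f j (lookup v j))) ≤ ∏ n (λ j → ∑ xs (f j))
independent-product xs x₀ n f = sequential-product xs x₀ n (λ j v → f j (lookup v j)) (λ j → ∑ xs (f j))
  (λ j v v′ e → cong (f j) (e j ≤-refl))
  (λ j v → ≤-reflexive (∑-cong xs (λ x → cong (f j) (lookup∘update j v x))))

-- Exponential estimates

^-distribʳ-* : ∀ a b n → (a * b) ^ n ≡ a ^ n * b ^ n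
^-distribʳ-* a b zero    = refl
^-distribʳ-* a b (suc n) = trans (cong (a * b *_) (^-distribʳ-* a b n)) (shuffle a b (a ^ n) (b ^ n))
  where
  shuffle : ∀ a b c d → a * b * (c * d) ≡ a * c * (b * d)
  shuffle = solve-∀

^-pos : ∀ a n → 1 ≤ a → 1 ≤ a ^ n
^-pos a n h = ≤-trans (≤-reflexive (sym (^-zeroˡ n))) (^-monoˡ-≤ n h)

n<2^n : ∀ n → n < 2 ^ n
n<2^n zero    = s≤s z≤n
n<2^n (suc n) = ≤-trans (+-mono-≤ (^-pos 2 n (s≤s z≤n)) (n<2^n n)) (≤-reflexive (cong (2 ^ n +_) (sym (+-identityʳ _))))

≤-cancelʳ-* : ∀ c {a b} → 1 ≤ c → a * c ≤ b * c → a ≤ b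
≤-cancelʳ-* (suc c) h p = *-cancelʳ-≤ _ _ (suc c) p

bernoulli : ∀ N x → N ^ x * (N + x) ≤ N * suc N ^ x
bernoulli N zero    = ≤-reflexive (base N)
  where
  base : ∀ N → 1 * (N + 0) ≡ N * 1
  base = solve-∀
bernoulli N (suc x) = begin
  N * N ^ x * (N + suc x) ≤⟨ m≤m+n _ (N ^ x * x) ⟩
  N * N ^ x * (N + suc x) + N ^ x * x ≡⟨ step N x (N ^ x) ⟩
  suc N * (N ^ x * (N + x)) ≤⟨ *-monoʳ-≤ (suc N) (bernoulli N x) ⟩
  suc N * (N * suc N ^ x) ≡⟨ comm N (suc N ^ x) ⟩
  N * (suc N * suc N ^ x)                ∎
  where
  open ≤-Reasoning
  step : ∀ N x p → N * p * (N + suc x) + p * x ≡ suc N * (p * (N + x))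
  step = solve-∀
  comm : ∀ N p → suc N * (N * p) ≡ N * (suc N * p)
  comm = solve-∀

2*N^N≤sN^N : ∀ N → 1 ≤ N → 2 * N ^ N ≤ suc N ^ N
2*N^N≤sN^N N@(suc _) h = *-cancelˡ-≤ N (≤-trans (≤-reflexive (eq N (N ^ N))) (bernoulli N N))
  where
  eq : ∀ N p → N * (2 * p) ≡ p * (N + N)
  eq = solve-∀

2^s-gain : ∀ N s → 1 ≤ N → 2 ^ s * N ^ (N * s) ≤ suc N ^ (N * s)
2^s-gain N s h = begin
  2 ^ s * N ^ (N * s) ≡⟨ cong (2 ^ s *_) (^-*-assoc N N s) ⟨
  2 ^ s * (N ^ N) ^ s ≡⟨ ^-distribʳ-* 2 (N ^ N) s ⟨
  (2 * N ^ N) ^ s ≤⟨ ^-monoˡ-≤ s (2*N^N≤sN^N N h) ⟩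
  (suc N ^ N) ^ s ≡⟨ ^-*-assoc (suc N) N s ⟩
  suc N ^ (N * s)         ∎
  where open ≤-Reasoning

-- The upper counterpart of `bernoulli`, with doubled slope. The `+ 2` in the hypothesis makes the
-- case `suc x` supply `2 * x ≤ N`, which absorbs the quadratic term of the induction step.
reverse-bernoulli : ∀ N x → 2 * x ≤ N + 2 → N * suc N ^ x ≤ (N + 2 * x) * N ^ x
reverse-bernoulli N zero    h = ≤-reflexive (base N)
  where
  base : ∀ N → N * 1 ≡ (N + 2 * 0) * 1
  base = solve-∀
reverse-bernoulli N (suc x) h = begin
  N * (suc N * suc N ^ x) ≡⟨ comm N (suc N ^ x) ⟩
  suc N * (N * suc N ^ x) ≤⟨ *-monoʳ-≤ (suc N) (reverse-bernoulli N x (≤-trans 2x≤N (m≤m+n N 2))) ⟩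
  suc N * ((N + 2 * x) * N ^ x) ≡⟨ step₁ N x (N ^ x) ⟩
  (N * N + 2 * x * N + N) * N ^ x + 2 * x * N ^ x ≤⟨ +-monoʳ-≤ _ (*-monoˡ-≤ (N ^ x) 2x≤N) ⟩
  (N * N + 2 * x * N + N) * N ^ x + N * N ^ x ≡⟨ step₂ N x (N ^ x) ⟩
  (N + 2 * suc x) * (N * N ^ x)                    ∎
  where
  open ≤-Reasoning
  2x≤N : 2 * x ≤ N
  2x≤N = +-cancelʳ-≤ 2 (2 * x) N (≤-trans (≤-reflexive (eq x)) h)
    where
    eq : ∀ x → 2 * x + 2 ≡ 2 * suc x
    eq = solve-∀
  comm : ∀ N p → N * (suc N * p) ≡ suc N * (N * p)
  comm = solve-∀
  step₁ : ∀ N x p → suc N * ((N + 2 * x) * p) ≡ (N * N + 2 * x * N + N) * p + 2 * x * p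
  step₁ = solve-∀
  step₂ : ∀ N x p → (N * N + 2 * x * N + N) * p + N * p ≡ (N + 2 * suc x) * (N * p)
  step₂ = solve-∀

half-power : ∀ N x → 1 ≤ N → 2 * x ≤ N → suc N ^ x ≤ 2 * N ^ x
half-power N@(suc _) x h p = *-cancelˡ-≤ N (begin
  N * suc N ^ x ≤⟨ reverse-bernoulli N x (≤-trans p (m≤m+n N 2)) ⟩
  (N + 2 * x) * N ^ x ≤⟨ *-monoˡ-≤ (N ^ x) (+-monoʳ-≤ N p) ⟩
  (N + N) * N ^ x ≡⟨ eq N (N ^ x) ⟩
  N * (2 * N ^ x)      ∎)
  where
  open ≤-Reasoning
  eq : ∀ N p → (N + N) * p ≡ N * (2 * p)
  eq = solve-∀

-- (1 + 1/N)^N < e < 8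
suc-power≤8 : ∀ N n → 1 ≤ N → n ≤ N → suc N ^ n ≤ 8 * N ^ n
suc-power≤8 N n h n≤N = ≤-cancelʳ-* (N ^ d) (^-pos N d h) (begin
  suc N ^ n * N ^ d ≤⟨ *-monoʳ-≤ (suc N ^ n) (^-monoˡ-≤ d (n≤1+n N)) ⟩
  suc N ^ n * suc N ^ d ≡⟨ ^-distribˡ-+-* (suc N) n d ⟨
  suc N ^ (n + d) ≡⟨ cong (suc N ^_) (m+[n∸m]≡n n≤) ⟩
  suc N ^ (1 + (x + x)) ≡⟨ split (suc N) ⟩
  suc N * (suc N ^ x * suc N ^ x) ≤⟨ *-monoʳ-≤ (suc N) (*-mono-≤ (half-power N x h 2x≤N) (half-power N x h 2x≤N)) ⟩
  suc N * (2 * N ^ x * (2 * N ^ x)) ≤⟨ *-monoˡ-≤ (2 * N ^ x * (2 * N ^ x)) (+-monoˡ-≤ N h) ⟩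
  (N + N) * (2 * N ^ x * (2 * N ^ x)) ≡⟨ eq N (N ^ x) ⟩
  8 * (N * (N ^ x * N ^ x)) ≡⟨ cong (8 *_) (sym (split N)) ⟩
  8 * N ^ (1 + (x + x)) ≡⟨ cong (λ e → 8 * N ^ e) (m+[n∸m]≡n n≤) ⟨
  8 * N ^ (n + d) ≡⟨ cong (8 *_) (^-distribˡ-+-* N n d) ⟩
  8 * (N ^ n * N ^ d) ≡⟨ *-assoc 8 (N ^ n) (N ^ d) ⟨
  8 * N ^ n * N ^ d                  ∎)
  where
  open ≤-Reasoning
  x = ⌊ N /2⌋
  d = (1 + (x + x)) ∸ n
  2x≤N : 2 * x ≤ N
  2x≤N = ≤-trans (≤-reflexive (cong (x +_) (+-identityʳ x))) (≤-trans (+-monoʳ-≤ x (⌊n/2⌋≤⌈n/2⌉ N)) (≤-reflexive (⌊n/2⌋+⌈n/2⌉≡n N)))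
  n≤ : n ≤ 1 + (x + x)
  n≤ = ≤-trans n≤N (≤-trans (≤-reflexive (sym (⌊n/2⌋+⌈n/2⌉≡n N)))
         (≤-trans (+-monoʳ-≤ x (⌊n/2⌋-mono (n≤1+n (suc N)))) (≤-reflexive (+-suc x x))))
  split : ∀ b → b ^ (1 + (x + x)) ≡ b * (b ^ x * b ^ x)
  split b = cong (b *_) (^-distribˡ-+-* b x x)
  eq : ∀ N p → (N + N) * (2 * p * (2 * p)) ≡ 8 * (N * (p * p))
  eq = solve-∀

-- Stands in for (1 + y/n)^n ≤ e^y: the base grows from n to n + y one unit at a time, and each unit
-- costs a factor of at most 8.
power≤8^ : ∀ n y e → 1 ≤ n → e ≤ n → (n + y) ^ e ≤ 8 ^ y * n ^ e
power≤8^ n zero    e h e≤n = ≤-reflexive (trans (cong (_^ e) (+-identityʳ n)) (sym (+-identityʳ _)))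
power≤8^ n (suc y) e h e≤n = begin
  (n + suc y) ^ e ≡⟨ cong (_^ e) (+-suc n y) ⟩
  suc (n + y) ^ e ≤⟨ suc-power≤8 (n + y) e (≤-trans h (m≤m+n n y)) (≤-trans e≤n (m≤m+n n y)) ⟩
  8 * (n + y) ^ e ≤⟨ *-monoʳ-≤ 8 (power≤8^ n y e h e≤n) ⟩
  8 * (8 ^ y * n ^ e) ≡⟨ *-assoc 8 (8 ^ y) (n ^ e) ⟨
  8 * 8 ^ y * n ^ e          ∎
  where open ≤-Reasoning

power≤8^* : ∀ n y e → 1 ≤ n → (n + y) ^ (n * e) ≤ 8 ^ (y * e) * n ^ (n * e)
power≤8^* n y e h = begin
  (n + y) ^ (n * e) ≡⟨ ^-*-assoc (n + y) n e ⟨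
  ((n + y) ^ n) ^ e ≤⟨ ^-monoˡ-≤ e (power≤8^ n y n h ≤-refl) ⟩
  (8 ^ y * n ^ n) ^ e ≡⟨ ^-distribʳ-* (8 ^ y) (n ^ n) e ⟩
  (8 ^ y) ^ e * (n ^ n) ^ e ≡⟨ cong₂ _*_ (^-*-assoc 8 y e) (^-*-assoc n n e) ⟩
  8 ^ (y * e) * n ^ (n * e)    ∎
  where open ≤-Reasoning

-- Exponential moments and tail bounds

≤ᵇ-dec : ∀ m n → (m ≤ᵇ n) ≡ true → m ≤ n
≤ᵇ-dec m n e = ≤ᵇ⇒≤ m n (subst T (sym e) _)

-- A probability under the uniform measure on `Ω`, multiplied by `length Ω`. All tail bounds are
-- cleared of denominators in this way, so that only natural numbers occur.
count≥ : (Ω : List A) → (A → ℕ) → ℕ → ℕ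
count≥ Ω X s = ∑ Ω (λ ω → 𝟙 (s ≤ᵇ X ω))

markov : ∀ (Ω : List A) (X g : A → ℕ) s c → (∀ ω → s ≤ X ω → c ≤ g ω) → count≥ Ω X s * c ≤ ∑ Ω g
markov Ω X g s c h = ≤-trans (≤-reflexive (sym (∑-*ʳ Ω c _))) (∑-mono Ω pointwise)
  where
  pointwise : ∀ ω → 𝟙 (s ≤ᵇ X ω) * c ≤ g ω
  pointwise ω with s ≤ᵇ X ω in e
  ... | true  = ≤-trans (≤-reflexive (+-identityʳ c)) (h ω (≤ᵇ-dec s (X ω) e))
  ... | false = z≤n

markov-^ : ∀ (Ω : List A) (X : A → ℕ) s x → 1 ≤ x → count≥ Ω X s * x ^ s ≤ ∑ Ω (λ ω → x ^ X ω)
markov-^ Ω X s x@(suc _) h = markov Ω X (λ ω → x ^ X ω) s (x ^ s) (λ ω → ^-monoʳ-≤ x)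

∑ᵥ : ∀ {n} → (A → ℕ) → Vec A n → ℕ
∑ᵥ {n = n} Y v = ∑ (allFin n) (λ j → Y (lookup v j))

∑-x^∑ᵥ : ∀ (xs : List A) → A → ∀ n x (Y : A → ℕ) →
         ∑ (vecs xs n) (λ v → x ^ ∑ᵥ Y v) ≤ (∑ xs (λ y → x ^ Y y)) ^ n
∑-x^∑ᵥ xs x₀ n x Y = begin
  ∑ (vecs xs n) (λ v → x ^ ∑ᵥ Y v) ≡⟨ ∑-cong (vecs xs n) (λ v → sym (∏-^ n x (λ j → Y (lookup v j)))) ⟩
  ∑ (vecs xs n) (λ v → ∏ n (λ j → x ^ Y (lookup v j))) ≤⟨ independent-product xs x₀ n (λ _ y → x ^ Y y) ⟩
  ∏ n (λ _ → ∑ xs (λ y → x ^ Y y)) ≡⟨ ∏-const n _ ⟩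
  (∑ xs (λ y → x ^ Y y)) ^ n                                ∎
  where open ≤-Reasoning

-- If one coordinate has exponential moment at most 1 + 1/n, then n independent ones have moment at
-- most (1 + 1/n)^n ≤ 8, however large x is. This suits statistics that are almost always 0 but
-- occasionally large.
count-∑ᵥ≥ : ∀ (xs : List A) → A → ∀ n x (Y : A → ℕ) s → 1 ≤ n → 1 ≤ x →
  n * ∑ xs (λ y → x ^ Y y) ≤ suc n * length xs →
  count≥ (vecs xs n) (∑ᵥ Y) s * x ^ s ≤ 8 * length xs ^ n
count-∑ᵥ≥ xs x₀ n x Y s 1≤n 1≤x h = ≤-cancelʳ-* (n ^ n) (^-pos n n 1≤n) (begin
  c * x ^ s * n ^ n ≤⟨ *-monoˡ-≤ (n ^ n) (≤-trans (markov-^ (vecs xs n) (∑ᵥ Y) s x 1≤x) (∑-x^∑ᵥ xs x₀ n x Y)) ⟩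
  F ^ n * n ^ n ≡⟨ trans (*-comm (F ^ n) (n ^ n)) (sym (^-distribʳ-* n F n)) ⟩
  (n * F) ^ n ≤⟨ ^-monoˡ-≤ n h ⟩
  (suc n * length xs) ^ n ≡⟨ ^-distribʳ-* (suc n) (length xs) n ⟩
  suc n ^ n * length xs ^ n ≤⟨ *-monoˡ-≤ (length xs ^ n) (suc-power≤8 n n 1≤n ≤-refl) ⟩
  8 * n ^ n * length xs ^ n ≡⟨ shuffle 8 (n ^ n) (length xs ^ n) ⟩
  8 * length xs ^ n * n ^ n                        ∎)
  where
  open ≤-Reasoning
  c = count≥ (vecs xs n) (∑ᵥ Y) s
  F = ∑ xs (λ y → x ^ Y y)
  shuffle : ∀ a b c → a * b * c ≡ a * c * b
  shuffle = solve-∀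

-- Chernoff: each Y is weighted by (1 + 1/N)^Y ≤ 1 + 2Y/N, and the 2a′ of the threshold absorbs the mean.
chernoff : ∀ (xs : List A) → A → ∀ N Y₀ a′ s (Y : A → ℕ) → 2 ≤ N → 1 ≤ Y₀ →
  (∀ y → 2 * Y y ≤ N) → 2 * Y₀ * ∑ xs Y ≤ length xs →
  count≥ (vecs xs (Y₀ * a′)) (∑ᵥ Y) (2 * a′ + N * s) * 2 ^ s ≤ length xs ^ (Y₀ * a′)
chernoff {A} xs x₀ N Y₀ a′ s Y 2≤N 1≤Y₀ Y≤ mean = result
  where
  open ≤-Reasoning
  R = length xs
  n = Y₀ * a′
  tt = N * s
  th = 2 * a′ + tt
  1≤N = ≤-trans (s≤s z≤n) 2≤N
  Y≤N : ∀ y → Y y ≤ N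
  Y≤N y = ≤-trans (m≤m+n (Y y) (Y y + 0)) (Y≤ y)
  -- N^N times (1 + 1/N)^(Y y), which is an integer because Y y ≤ N.
  g : A → ℕ
  g y = suc N ^ Y y * N ^ (N ∸ Y y)
  g-bound : ∀ y → N * g y ≤ N ^ N * (N + 2 * Y y)
  g-bound y = begin
    N * (suc N ^ Y y * N ^ (N ∸ Y y)) ≡⟨ *-assoc N _ _ ⟨
    N * suc N ^ Y y * N ^ (N ∸ Y y) ≤⟨ *-monoˡ-≤ _ (reverse-bernoulli N (Y y) (≤-trans (Y≤ y) (m≤m+n N 2))) ⟩
    (N + 2 * Y y) * N ^ Y y * N ^ (N ∸ Y y) ≡⟨ *-assoc (N + 2 * Y y) _ _ ⟩
    (N + 2 * Y y) * (N ^ Y y * N ^ (N ∸ Y y)) ≡⟨ cong ((N + 2 * Y y) *_) (sym (^-distribˡ-+-* N (Y y) (N ∸ Y y))) ⟩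
    (N + 2 * Y y) * N ^ (Y y + (N ∸ Y y)) ≡⟨ cong (λ e → (N + 2 * Y y) * N ^ e) (m+[n∸m]≡n (Y≤N y)) ⟩
    (N + 2 * Y y) * N ^ N ≡⟨ *-comm _ (N ^ N) ⟩
    N ^ N * (N + 2 * Y y)                        ∎
  G = ∑ xs g
  Z = N * Y₀
  G-bound : Z * G ≤ N ^ N * (R * suc Z)
  G-bound = begin
    N * Y₀ * G ≡⟨ sh₁ N Y₀ G ⟩
    Y₀ * (N * G) ≡⟨ cong (Y₀ *_) (sym (∑-*ˡ xs N g)) ⟩
    Y₀ * ∑ xs (λ y → N * g y) ≤⟨ *-monoʳ-≤ Y₀ (∑-mono xs g-bound) ⟩
    Y₀ * ∑ xs (λ y → N ^ N * (N + 2 * Y y)) ≡⟨ cong (Y₀ *_) (trans (∑-*ˡ xs (N ^ N) _) (cong (N ^ N *_)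
                                                          (trans (∑-+ xs (λ _ → N) (λ y → 2 * Y y)) (cong₂ _+_ (∑-const xs N) (∑-*ˡ xs 2 Y))))) ⟩
    Y₀ * (N ^ N * (R * N + 2 * ∑ xs Y)) ≡⟨ sh₂ Y₀ (N ^ N) R N (∑ xs Y) ⟩
    N ^ N * (R * (N * Y₀) + 2 * Y₀ * ∑ xs Y) ≤⟨ *-monoʳ-≤ (N ^ N) (+-monoʳ-≤ (R * (N * Y₀)) mean) ⟩
    N ^ N * (R * (N * Y₀) + R) ≡⟨ cong (N ^ N *_) (trans (+-comm (R * Z) R) (sym (*-suc R Z))) ⟩
    N ^ N * (R * suc Z)                              ∎
    where
    sh₁ : ∀ N Y₀ G → N * Y₀ * G ≡ Y₀ * (N * G)
    sh₁ = solve-∀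
    sh₂ : ∀ Y₀ p R N q → Y₀ * (p * (R * N + 2 * q)) ≡ p * (R * (N * Y₀) + 2 * Y₀ * q)
    sh₂ = solve-∀
  weight : Vec A n → ℕ
  weight v = N ^ th * ∏ n (λ j → g (lookup v j))
  weight-low : ∀ v → th ≤ ∑ᵥ Y v → suc N ^ th * N ^ (N * n) ≤ weight v
  weight-low v th≤ = begin
    suc N ^ th * N ^ (N * n) ≡⟨ cong (λ e → suc N ^ th * N ^ e) (sym total) ⟩
    suc N ^ th * N ^ (th + δ + U) ≡⟨ cong (suc N ^ th *_) (trans (^-distribˡ-+-* N (th + δ) U) (cong (_* N ^ U) (^-distribˡ-+-* N th δ))) ⟩
    suc N ^ th * (N ^ th * N ^ δ * N ^ U) ≤⟨ *-monoʳ-≤ (suc N ^ th) (*-monoˡ-≤ (N ^ U) (*-monoʳ-≤ (N ^ th) (^-monoˡ-≤ δ (n≤1+n N)))) ⟩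
    suc N ^ th * (N ^ th * suc N ^ δ * N ^ U) ≡⟨ sh (suc N ^ th) (N ^ th) (suc N ^ δ) (N ^ U) ⟩
    N ^ th * (suc N ^ th * suc N ^ δ * N ^ U) ≡⟨ cong (λ p → N ^ th * (p * N ^ U)) (sym (^-distribˡ-+-* (suc N) th δ)) ⟩
    N ^ th * (suc N ^ (th + δ) * N ^ U) ≡⟨ cong (λ e → N ^ th * (suc N ^ e * N ^ U)) (m+[n∸m]≡n th≤) ⟩
    N ^ th * (suc N ^ ∑ᵥ Y v * N ^ U) ≡⟨ cong (N ^ th *_) (sym (trans (∏-* n _ _) (cong₂ _*_ (∏-^ n (suc N) _) (∏-^ n N _)))) ⟩
    weight v                                               ∎
    where
    δ = ∑ᵥ Y v ∸ th
    U = ∑ (allFin n) (λ j → N ∸ Y (lookup v j))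
    total : th + δ + U ≡ N * n
    total = trans (cong (_+ U) (m+[n∸m]≡n th≤)) (trans (sym (∑-+ (allFin n) _ _))
              (trans (∑-cong (allFin n) (λ j → m+[n∸m]≡n (Y≤N (lookup v j))))
              (trans (∑-const (allFin n) N) (trans (cong (_* N) (length-allFin n)) (*-comm n N)))))
    sh : ∀ n b c d → n * (b * c * d) ≡ b * (n * c * d)
    sh = solve-∀
  cnt = count≥ (vecs xs n) (∑ᵥ Y) th
  step₁ : cnt * (suc N ^ th * N ^ (N * n)) ≤ N ^ th * G ^ n
  step₁ = ≤-trans (markov (vecs xs n) (∑ᵥ Y) weight th _ weight-low)
    (≤-trans (≤-reflexive (∑-*ˡ (vecs xs n) (N ^ th) _)) (*-monoʳ-≤ (N ^ th)
      (≤-trans (independent-product xs x₀ n (λ _ → g)) (≤-reflexive (∏-const n G)))))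
  1≤Z : 1 ≤ Z
  1≤Z = *-mono-≤ 1≤N 1≤Y₀
  step₂ : cnt * suc N ^ th * Z ^ n ≤ N ^ th * (R ^ n * suc Z ^ n)
  step₂ = ≤-cancelʳ-* (N ^ (N * n)) (^-pos N (N * n) 1≤N) (begin
    cnt * suc N ^ th * Z ^ n * N ^ (N * n) ≡⟨ sh₁ cnt (suc N ^ th) (Z ^ n) (N ^ (N * n)) ⟩
    cnt * (suc N ^ th * N ^ (N * n)) * Z ^ n ≤⟨ *-monoˡ-≤ (Z ^ n) step₁ ⟩
    N ^ th * G ^ n * Z ^ n ≡⟨ trans (*-assoc (N ^ th) _ _) (cong (N ^ th *_) (trans (*-comm (G ^ n) (Z ^ n)) (sym (^-distribʳ-* Z G n)))) ⟩
    N ^ th * (Z * G) ^ n ≤⟨ *-monoʳ-≤ (N ^ th) (^-monoˡ-≤ n G-bound) ⟩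
    N ^ th * (N ^ N * (R * suc Z)) ^ n ≡⟨ cong (N ^ th *_) (trans (^-distribʳ-* (N ^ N) (R * suc Z) n) (cong₂ _*_ (^-*-assoc N N n) (^-distribʳ-* R (suc Z) n))) ⟩
    N ^ th * (N ^ (N * n) * (R ^ n * suc Z ^ n)) ≡⟨ sh₂ (N ^ th) (N ^ (N * n)) (R ^ n * suc Z ^ n) ⟩
    N ^ th * (R ^ n * suc Z ^ n) * N ^ (N * n)          ∎)
    where
    sh₁ : ∀ n b c d → n * b * c * d ≡ n * (b * d) * c
    sh₁ = solve-∀
    sh₂ : ∀ n b c → n * (b * c) ≡ n * c * b
    sh₂ = solve-∀
  -- Y₀ coordinates cost as much as two units of the threshold: (1 + 1/(N Y₀))^Y₀ ≤ (1 + 1/N)². With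
  -- a′ groups of Y₀ coordinates this is the summand 2 a′.
  Z-one : N * N * suc Z ^ Y₀ ≤ suc N * suc N * Z ^ Y₀
  Z-one = ≤-cancelʳ-* Y₀ 1≤Y₀ (begin
    N * N * suc Z ^ Y₀ * Y₀ ≡⟨ sh₁ N (suc Z ^ Y₀) Y₀ ⟩
    N * (N * Y₀ * suc Z ^ Y₀) ≤⟨ *-monoʳ-≤ N (reverse-bernoulli Z Y₀ (≤-trans (*-monoˡ-≤ Y₀ 2≤N) (m≤m+n Z 2))) ⟩
    N * ((N * Y₀ + 2 * Y₀) * Z ^ Y₀) ≤⟨ m≤m+n _ (Z ^ Y₀ * Y₀) ⟩
    N * ((N * Y₀ + 2 * Y₀) * Z ^ Y₀) + Z ^ Y₀ * Y₀ ≡⟨ sh₂ N Y₀ (Z ^ Y₀) ⟩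
    suc N * suc N * Z ^ Y₀ * Y₀              ∎)
    where
    sh₁ : ∀ N p y → N * N * p * y ≡ N * (N * y * p)
    sh₁ = solve-∀
    sh₂ : ∀ N y p → N * ((N * y + 2 * y) * p) + p * y ≡ suc N * suc N * p * y
    sh₂ = solve-∀
  sq : ∀ b → (b * b) ^ a′ ≡ b ^ (2 * a′)
  sq b = trans (cong (_^ a′) (cong (b *_) (sym (*-identityʳ b)))) (^-*-assoc b 2 a′)
  Z-all : N ^ (2 * a′) * suc Z ^ n ≤ suc N ^ (2 * a′) * Z ^ n
  Z-all = begin
    N ^ (2 * a′) * suc Z ^ (Y₀ * a′) ≡⟨ cong₂ _*_ (sym (sq N)) (sym (^-*-assoc (suc Z) Y₀ a′)) ⟩
    (N * N) ^ a′ * (suc Z ^ Y₀) ^ a′ ≡⟨ ^-distribʳ-* (N * N) (suc Z ^ Y₀) a′ ⟨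
    (N * N * suc Z ^ Y₀) ^ a′ ≤⟨ ^-monoˡ-≤ a′ Z-one ⟩
    (suc N * suc N * Z ^ Y₀) ^ a′ ≡⟨ ^-distribʳ-* (suc N * suc N) (Z ^ Y₀) a′ ⟩
    (suc N * suc N) ^ a′ * (Z ^ Y₀) ^ a′ ≡⟨ cong₂ _*_ (sq (suc N)) (^-*-assoc Z Y₀ a′) ⟩
    suc N ^ (2 * a′) * Z ^ (Y₀ * a′)        ∎
  result : cnt * 2 ^ s ≤ R ^ n
  result = ≤-cancelʳ-* K 1≤K (begin
    cnt * 2 ^ s * (N ^ tt * suc N ^ (2 * a′) * Z ^ n * N ^ (2 * a′))
      ≡⟨ sh₁ cnt (2 ^ s) (N ^ tt) (suc N ^ (2 * a′)) (Z ^ n) (N ^ (2 * a′)) ⟩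
    cnt * (suc N ^ (2 * a′) * (2 ^ s * N ^ tt)) * Z ^ n * N ^ (2 * a′)
      ≤⟨ *-monoˡ-≤ (N ^ (2 * a′)) (*-monoˡ-≤ (Z ^ n) (*-monoʳ-≤ cnt (*-monoʳ-≤ (suc N ^ (2 * a′)) (2^s-gain N s 1≤N)))) ⟩
    cnt * (suc N ^ (2 * a′) * suc N ^ tt) * Z ^ n * N ^ (2 * a′)
      ≡⟨ cong (λ p → cnt * p * Z ^ n * N ^ (2 * a′)) (sym (^-distribˡ-+-* (suc N) (2 * a′) tt)) ⟩
    cnt * suc N ^ th * Z ^ n * N ^ (2 * a′)
      ≤⟨ *-monoˡ-≤ (N ^ (2 * a′)) step₂ ⟩
    N ^ th * (R ^ n * suc Z ^ n) * N ^ (2 * a′)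
      ≡⟨ sh₂ (N ^ th) (R ^ n) (suc Z ^ n) (N ^ (2 * a′)) ⟩
    N ^ th * R ^ n * (N ^ (2 * a′) * suc Z ^ n)
      ≤⟨ *-monoʳ-≤ (N ^ th * R ^ n) Z-all ⟩
    N ^ th * R ^ n * (suc N ^ (2 * a′) * Z ^ n)
      ≡⟨ cong (λ p → p * R ^ n * (suc N ^ (2 * a′) * Z ^ n)) (^-distribˡ-+-* N (2 * a′) tt) ⟩
    N ^ (2 * a′) * N ^ tt * R ^ n * (suc N ^ (2 * a′) * Z ^ n)
      ≡⟨ sh₃ (N ^ (2 * a′)) (N ^ tt) (R ^ n) (suc N ^ (2 * a′)) (Z ^ n) ⟩
    R ^ n * (N ^ tt * suc N ^ (2 * a′) * Z ^ n * N ^ (2 * a′)) ∎)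
    where
    K = N ^ tt * suc N ^ (2 * a′) * Z ^ n * N ^ (2 * a′)
    1≤K : 1 ≤ K
    1≤K = *-mono-≤ (*-mono-≤ (*-mono-≤ (^-pos N tt 1≤N) (^-pos (suc N) (2 * a′) (s≤s z≤n))) (^-pos Z n 1≤Z)) (^-pos N (2 * a′) 1≤N)
    sh₁ : ∀ c s n m z k → c * s * (n * m * z * k) ≡ c * (m * (s * n)) * z * k
    sh₁ = solve-∀
    sh₂ : ∀ n r z k → n * (r * z) * k ≡ n * r * (k * z)
    sh₂ = solve-∀
    sh₃ : ∀ k n r m z → k * n * r * (m * z) ≡ r * (n * m * z * k)
    sh₃ = solve-∀

-- Concentration in one row of a random matrix

cardinality : ∀ {n} → (Fin n → Bool) → ℕ
cardinality {n} mask = ∑ (allFin n) (λ l → 𝟙 (mask l))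

hits : ∀ {n} → (A → Bool) → (Fin n → Bool) → Vec A n → ℕ
hits {n = n} P mask v = ∑ (allFin n) (λ l → 𝟙 (mask l ∧ P (lookup v l)))

if-𝟙 : ∀ b c → (if b then 𝟙 c else 0) ≡ 𝟙 (b ∧ c)
if-𝟙 true  c = refl
if-𝟙 false c = refl

-- Since q ≤ Z, a mask with fewer than w points can be treated as if it had exactly w.
masked-∏ : ∀ n (mask : Fin n → Bool) w Z q → q ≤ Z → cardinality mask ≤ w →
           ∏ n (λ j → if mask j then Z else q) * q ^ w ≤ Z ^ w * q ^ n
masked-∏ zero    mask w Z q q≤Z h = ≤-trans (≤-reflexive (+-identityʳ _)) (≤-trans (^-monoˡ-≤ w q≤Z) (≤-reflexive (sym (*-identityʳ _))))
masked-∏ (suc n) mask w Z q q≤Z h with mask zero | ≤-trans (≤-reflexive (sym (∑-fins n (λ l → 𝟙 (mask l))))) h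
... | false | h′ = begin
  q * Π * q ^ w ≡⟨ *-assoc q Π (q ^ w) ⟩
  q * (Π * q ^ w) ≤⟨ *-monoʳ-≤ q (masked-∏ n (mask ∘ suc) w Z q q≤Z h′) ⟩
  q * (Z ^ w * q ^ n) ≡⟨ sh q (Z ^ w) (q ^ n) ⟩
  Z ^ w * (q * q ^ n)        ∎
  where
  open ≤-Reasoning
  Π = ∏ n (λ j → if mask (suc j) then Z else q)
  sh : ∀ a b c → a * (b * c) ≡ b * (a * c)
  sh = solve-∀
masked-∏ (suc n) mask (suc w) Z q q≤Z h | true | s≤s h′ = begin
  Z * Π * (q * q ^ w) ≡⟨ sh₁ Z Π q (q ^ w) ⟩
  Z * q * (Π * q ^ w) ≤⟨ *-monoʳ-≤ (Z * q) (masked-∏ n (mask ∘ suc) w Z q q≤Z h′) ⟩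
  Z * q * (Z ^ w * q ^ n) ≡⟨ sh₂ Z q (Z ^ w) (q ^ n) ⟩
  Z * Z ^ w * (q * q ^ n)    ∎
  where
  open ≤-Reasoning
  Π = ∏ n (λ j → if mask (suc j) then Z else q)
  sh₁ : ∀ a b c d → a * b * (c * d) ≡ a * c * (b * d)
  sh₁ = solve-∀
  sh₂ : ∀ a b c d → a * b * (c * d) ≡ a * c * (b * d)
  sh₂ = solve-∀

∑-x^𝟙 : ∀ (xs : List A) (P : A → Bool) y →
        ∑ xs (λ x → suc y ^ 𝟙 (P x)) ≡ length xs + ∑ xs (𝟙 ∘ P) * y
∑-x^𝟙 xs P y = trans (∑-cong xs pointwise) (trans (∑-+ xs (λ _ → 1) (λ x → 𝟙 (P x) * y))
                 (cong₂ _+_ (length-as-∑ xs) (∑-*ʳ xs y (𝟙 ∘ P))))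
  where
  pointwise : ∀ x → suc y ^ 𝟙 (P x) ≡ 1 + 𝟙 (P x) * y
  pointwise x with P x
  ... | true  = trans (*-identityʳ (suc y)) (cong suc (sym (+-identityʳ y)))
  ... | false = refl

∑-x^hits : ∀ (xs : List A) → A → ∀ {n} (P : A → Bool) (mask : Fin n → Bool) w y → cardinality mask ≤ w →
  ∑ (vecs xs n) (λ v → suc y ^ hits P mask v) * length xs ^ w ≤
  (length xs + ∑ xs (𝟙 ∘ P) * y) ^ w * length xs ^ n
∑-x^hits {A} xs x₀ {n} P mask w y h = begin
  ∑ (vecs xs n) (λ v → suc y ^ hits P mask v) * q ^ w
    ≡⟨ cong (_* q ^ w) (∑-cong (vecs xs n) (λ v → trans (sym (∏-^ n (suc y) _)) (∏-cong n (λ j → unmask (mask j) (P (lookup v j)))))) ⟩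
  ∑ (vecs xs n) (λ v → ∏ n (λ j → f j (lookup v j))) * q ^ w
    ≤⟨ *-monoˡ-≤ (q ^ w) (independent-product xs x₀ n f) ⟩
  ∏ n (λ j → ∑ xs (f j)) * q ^ w
    ≡⟨ cong (_* q ^ w) (∏-cong n factor) ⟩
  ∏ n (λ j → if mask j then Z else q) * q ^ w
    ≤⟨ masked-∏ n mask w Z q (m≤m+n q _) h ⟩
  Z ^ w * q ^ n ∎
  where
  open ≤-Reasoning
  q = length xs
  Z = q + ∑ xs (𝟙 ∘ P) * y
  f : Fin n → A → ℕ
  f j x = if mask j then suc y ^ 𝟙 (P x) else 1
  unmask : ∀ b c → suc y ^ 𝟙 (b ∧ c) ≡ (if b then suc y ^ 𝟙 c else 1)
  unmask true  c = refl
  unmask false c = refl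
  factor : ∀ j → ∑ xs (f j) ≡ (if mask j then Z else q)
  factor j with mask j
  ... | true  = ∑-x^𝟙 xs P y
  ... | false = length-as-∑ xs

-- Bounds the square by an exponential moment without a constant term, d² ≤ 3 (2^d - 1). For d a sum
-- of w trials of probability 1/q the mean of 2^d is at most 1 + 2w/q, hence that of d² at most
-- 6w/q.
d²+3≤3*2^d : ∀ d → d * d + 3 ≤ 3 * 2 ^ d
d²+3≤3*2^d zero    = ≤-refl
d²+3≤3*2^d (suc d) = begin
  suc d * suc d + 3 ≡⟨ sh d ⟩
  d * d + 3 + (d + suc d) ≤⟨ +-mono-≤ (d²+3≤3*2^d d) (+-mono-≤ (<⇒≤ (n<2^n d)) (n<2^n d)) ⟩
  3 * 2 ^ d + (2 ^ d + 2 ^ d) ≤⟨ m≤m+n _ (2 ^ d) ⟩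
  3 * 2 ^ d + (2 ^ d + 2 ^ d) + 2 ^ d ≡⟨ sh₂ (2 ^ d) ⟩
  3 * (2 * 2 ^ d)                          ∎
  where
  open ≤-Reasoning
  sh : ∀ d → suc d * suc d + 3 ≡ d * d + 3 + (d + suc d)
  sh = solve-∀
  sh₂ : ∀ p → 3 * p + (p + p) + p ≡ 3 * (2 * p)
  sh₂ = solve-∀

-- The square of a row count is truncated at J. Without this, N in `chernoff` would have to be of
-- the order of the largest possible square, and its threshold would exceed w². Counts from J on are
-- so rare that they can be weighted linearly by a large base; a degree bound turns the linear sum
-- into one of squares.
light-part : ℕ → ℕ → ℕ
light-part J d = if d <ᵇ J then d * d else 0

heavy-part : ℕ → ℕ → ℕ
heavy-part J d = if d <ᵇ J then 0 else d

light≤sq : ∀ J d → light-part J d ≤ d * d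
light≤sq J d with d <ᵇ J
... | true  = ≤-refl
... | false = z≤n

light-bounded : ∀ J d → light-part J d ≤ J * J
light-bounded J d with d <ᵇ J in e
... | true  = *-mono-≤ d≤J d≤J
  where d≤J = <⇒≤ (<ᵇ⇒< d J (subst T (sym e) _))
... | false = z≤n

sq≤light+heavy : ∀ J D d → d ≤ D → d * d ≤ light-part J d + D * heavy-part J d
sq≤light+heavy J D d d≤D with d <ᵇ J
... | true  = m≤m+n _ _
... | false = *-monoˡ-≤ d d≤D

-- A nonzero heavy part means J ≤ d, so 2^J is at most 2^d and merges with the base. Dividing by 2^J
-- shows that heavy rows add next to nothing to the moment.
heavy-weight : ∀ J d y → 2 ^ J * suc y ^ heavy-part J d ≤ 2 ^ J + suc (suc (2 * y)) ^ d
heavy-weight J d y with d <ᵇ J in e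
... | true  = ≤-trans (≤-reflexive (*-identityʳ (2 ^ J))) (m≤m+n _ _)
... | false = ≤-trans (≤-trans (*-monoˡ-≤ (suc y ^ d) (^-monoʳ-≤ 2 J≤d))
                (≤-reflexive (trans (sym (^-distribʳ-* 2 (suc y) d)) (cong (_^ d) (sh y))))) (m≤n+m _ (2 ^ J))
  where
  J≤d : J ≤ d
  J≤d = ≮⇒≥ (λ p → subst T e (<⇒<ᵇ p))
  sh : ∀ y → 2 * suc y ≡ suc (suc (2 * y))
  sh = solve-∀

module RowStatistics {A : Set} (xs : List A) (x₀ : A) (P : A → Bool) (single : ∑ xs (𝟙 ∘ P) ≡ 1) (a : ℕ) where
  q = length xs
  rows = vecs xs a
  R = q ^ a

  length-rows : length rows ≡ R
  length-rows = length-vecs xs a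

  module _ (1≤q : 1 ≤ q) where

    ∑-x^hits-row : ∀ (mask : Fin a → Bool) w y → cardinality mask ≤ w →
                   ∑ rows (λ v → suc y ^ hits P mask v) * q ^ w ≤ (q + y) ^ w * R
    ∑-x^hits-row mask w y h = ≤-trans (∑-x^hits xs x₀ P mask w y h)
      (≤-reflexive (cong (λ p → (q + p) ^ w * R) (trans (cong (_* y) single) (+-identityʳ y))))

    light-count : ∀ mask w J N Y₀ a′ s → cardinality mask ≤ w → 2 ≤ N → 1 ≤ Y₀ → 2 * (J * J) ≤ N →
      12 * w * Y₀ ≤ q → a ≡ Y₀ * a′ →
      count≥ (vecs rows a) (∑ᵥ (λ v → light-part J (hits P mask v))) (2 * a′ + N * s) * 2 ^ s ≤ R ^ a
    light-count mask w J N Y₀ a′ s h 2≤N 1≤Y₀ J≤ wY a≡ =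
      subst₂ (λ n ℓ → count≥ (vecs rows n) (∑ᵥ Y) (2 * a′ + N * s) * 2 ^ s ≤ ℓ ^ n) (sym a≡) length-rows
        (chernoff rows (Vec.replicate a x₀) N Y₀ a′ s Y 2≤N 1≤Y₀
          (λ v → ≤-trans (*-monoʳ-≤ 2 (light-bounded J _)) J≤) (≤-trans mean (≤-reflexive (sym length-rows))))
      where
      open ≤-Reasoning
      Y : Vec A a → ℕ
      Y v = light-part J (hits P mask v)
      E = ∑ rows (λ v → 2 ^ hits P mask v)
      2w≤q : 2 * w ≤ q + 2
      2w≤q = ≤-trans (*-monoˡ-≤ w (s≤s (s≤s (z≤n {10})))) (≤-trans (m≤m*n (12 * w) Y₀ {{>-nonZero 1≤Y₀}}) (≤-trans wY (m≤m+n q 2)))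
      qE : q * E ≤ (q + 2 * w) * R
      qE = ≤-cancelʳ-* (q ^ w) (^-pos q w 1≤q) (begin
        q * E * q ^ w ≡⟨ *-assoc q E (q ^ w) ⟩
        q * (E * q ^ w) ≤⟨ *-monoʳ-≤ q (∑-x^hits-row mask w 1 h) ⟩
        q * ((q + 1) ^ w * R) ≡⟨ cong (λ z → q * (z ^ w * R)) (+-comm q 1) ⟩
        q * (suc q ^ w * R) ≡⟨ *-assoc q _ R ⟨
        q * suc q ^ w * R ≤⟨ *-monoˡ-≤ R (reverse-bernoulli q w 2w≤q) ⟩
        (q + 2 * w) * q ^ w * R ≡⟨ sh (q + 2 * w) (q ^ w) R ⟩
        (q + 2 * w) * R * q ^ w         ∎)
        where
        sh : ∀ a b c → a * b * c ≡ a * c * b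
        sh = solve-∀
      Y+3≤ : ∑ rows Y + R * 3 ≤ 3 * E
      Y+3≤ = begin
        ∑ rows Y + R * 3 ≡⟨ cong (∑ rows Y +_) (trans (cong (_* 3) (sym length-rows)) (sym (∑-const rows 3))) ⟩
        ∑ rows Y + ∑ rows (λ _ → 3) ≡⟨ ∑-+ rows Y (λ _ → 3) ⟨
        ∑ rows (λ v → Y v + 3) ≤⟨ ∑-mono rows (λ v → ≤-trans (+-monoˡ-≤ 3 (light≤sq J _)) (d²+3≤3*2^d (hits P mask v))) ⟩
        ∑ rows (λ v → 3 * 2 ^ hits P mask v) ≡⟨ ∑-*ˡ rows 3 _ ⟩
        3 * E                                          ∎
      qY : q * ∑ rows Y ≤ 6 * w * R
      qY = +-cancelʳ-≤ (q * (R * 3)) _ _ (begin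
        q * ∑ rows Y + q * (R * 3) ≡⟨ *-distribˡ-+ q (∑ rows Y) (R * 3) ⟨
        q * (∑ rows Y + R * 3) ≤⟨ *-monoʳ-≤ q Y+3≤ ⟩
        q * (3 * E) ≡⟨ sh₁ q E ⟩
        3 * (q * E) ≤⟨ *-monoʳ-≤ 3 qE ⟩
        3 * ((q + 2 * w) * R) ≡⟨ sh₂ q w R ⟩
        6 * w * R + q * (R * 3)         ∎)
        where
        sh₁ : ∀ q E → q * (3 * E) ≡ 3 * (q * E)
        sh₁ = solve-∀
        sh₂ : ∀ q w R → 3 * ((q + 2 * w) * R) ≡ 6 * w * R + q * (R * 3)
        sh₂ = solve-∀
      mean : 2 * Y₀ * ∑ rows Y ≤ R
      mean = ≤-cancelʳ-* q 1≤q (begin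
        2 * Y₀ * ∑ rows Y * q ≡⟨ sh₁ Y₀ (∑ rows Y) q ⟩
        2 * Y₀ * (q * ∑ rows Y) ≤⟨ *-monoʳ-≤ (2 * Y₀) qY ⟩
        2 * Y₀ * (6 * w * R) ≡⟨ sh₂ Y₀ w R ⟩
        12 * w * Y₀ * R ≤⟨ *-monoˡ-≤ R wY ⟩
        q * R ≡⟨ *-comm q R ⟩
        R * q                           ∎)
        where
        sh₁ : ∀ y s q → 2 * y * s * q ≡ 2 * y * (q * s)
        sh₁ = solve-∀
        sh₂ : ∀ y w r → 2 * y * (6 * w * r) ≡ 12 * w * y * r
        sh₂ = solve-∀

    private
      tail-from-weight : ∀ n (Y : Vec A a → ℕ) E x c b → 1 ≤ b → E ≤ c * R → n * c ≤ b →
        b * ∑ rows (λ v → x ^ Y v) ≤ b * R + E → n * ∑ rows (λ v → x ^ Y v) ≤ suc n * length rows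
      tail-from-weight n Y E x c b 1≤b E≤ nc≤b h = ≤-cancelʳ-* b 1≤b (begin
        n * F * b ≡⟨ sh₁ n F b ⟩
        n * (b * F) ≤⟨ *-monoʳ-≤ n (≤-trans h (+-monoʳ-≤ (b * R) E≤)) ⟩
        n * (b * R + c * R) ≡⟨ sh₂ n b R c ⟩
        n * (b * R) + n * c * R ≤⟨ +-monoʳ-≤ (n * (b * R)) (*-monoˡ-≤ R nc≤b) ⟩
        n * (b * R) + b * R ≡⟨ sh₃ n b R ⟩
        suc n * R * b ≡⟨ cong (λ z → suc n * z * b) (sym length-rows) ⟩
        suc n * length rows * b     ∎)
        where
        open ≤-Reasoning
        F = ∑ rows (λ v → x ^ Y v)
        sh₁ : ∀ n F b → n * F * b ≡ n * (b * F)
        sh₁ = solve-∀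
        sh₂ : ∀ n b R c → n * (b * R + c * R) ≡ n * (b * R) + n * c * R
        sh₂ = solve-∀
        sh₃ : ∀ n b R → n * (b * R) + b * R ≡ suc n * R * b
        sh₃ = solve-∀

    heavy-count : ∀ mask w J y S → cardinality mask ≤ w → w ≤ q → 1 ≤ a → a * 8 ^ suc (2 * y) ≤ 2 ^ J →
      count≥ (vecs rows a) (∑ᵥ (λ v → heavy-part J (hits P mask v))) S * suc y ^ S ≤ 8 * R ^ a
    heavy-count mask w J y S h w≤q 1≤a big =
      subst (λ ℓ → count≥ (vecs rows a) (∑ᵥ Y) S * suc y ^ S ≤ 8 * ℓ ^ a) length-rows
        (count-∑ᵥ≥ rows (Vec.replicate a x₀) a (suc y) Y S 1≤a (s≤s z≤n)
          (tail-from-weight a Y E (suc y) (8 ^ suc (2 * y)) (2 ^ J) (^-pos 2 J (s≤s z≤n)) E≤ big total))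
      where
      Y : Vec A a → ℕ
      Y v = heavy-part J (hits P mask v)
      E = ∑ rows (λ v → suc (suc (2 * y)) ^ hits P mask v)
      E≤ : E ≤ 8 ^ suc (2 * y) * R
      E≤ = ≤-cancelʳ-* (q ^ w) (^-pos q w 1≤q) (≤-trans (∑-x^hits-row mask w (suc (2 * y)) h)
        (≤-trans (*-monoˡ-≤ R (power≤8^ q (suc (2 * y)) w 1≤q w≤q)) (≤-reflexive (sh (8 ^ suc (2 * y)) (q ^ w) R))))
        where
        sh : ∀ a b c → a * b * c ≡ a * c * b
        sh = solve-∀
      total : 2 ^ J * ∑ rows (λ v → suc y ^ Y v) ≤ 2 ^ J * R + E
      total = begin
        2 ^ J * ∑ rows (λ v → suc y ^ Y v) ≡⟨ ∑-*ˡ rows (2 ^ J) _ ⟨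
        ∑ rows (λ v → 2 ^ J * suc y ^ Y v) ≤⟨ ∑-mono rows (λ v → heavy-weight J (hits P mask v) y) ⟩
        ∑ rows (λ v → 2 ^ J + suc (suc (2 * y)) ^ hits P mask v) ≡⟨ ∑-+ rows (λ _ → 2 ^ J) _ ⟩
        ∑ rows (λ _ → 2 ^ J) + E ≡⟨ cong (_+ E) (trans (∑-const rows (2 ^ J)) (trans (cong (_* 2 ^ J) length-rows) (*-comm R (2 ^ J)))) ⟩
        2 ^ J * R + E                                      ∎
        where open ≤-Reasoning

    -- The indicator of a row of degree at least D carries the large weight x. By the moment of
    -- 2^deg such a row has probability at most 8^e₀/2^D, and x times this is at most 1/a, as
    -- `count-∑ᵥ≥` asks.
    degree-count : ∀ e₀ D x → 1 ≤ x → 1 ≤ a → a ≡ q * e₀ → a * (x * 8 ^ e₀) ≤ 2 ^ D →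
      count≥ (vecs rows a) (∑ᵥ (λ v → 𝟙 (D ≤ᵇ hits P (λ _ → true) v))) 1 * x ≤ 8 * R ^ a
    degree-count e₀ D x 1≤x 1≤a a≡ big = subst₂ (λ z ℓ → count≥ (vecs rows a) (∑ᵥ Y) 1 * z ≤ 8 * ℓ ^ a) (*-identityʳ x) length-rows
      (count-∑ᵥ≥ rows (Vec.replicate a x₀) a x Y 1 1≤a 1≤x
        (tail-from-weight a Y (x * E) x (x * 8 ^ e₀) (2 ^ D) (^-pos 2 D (s≤s z≤n)) xE≤ big total))
      where
      open ≤-Reasoning
      deg : Vec A a → ℕ
      deg = hits P (λ _ → true)
      Y : Vec A a → ℕ
      Y v = 𝟙 (D ≤ᵇ deg v)
      E = ∑ rows (λ v → 2 ^ deg v)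
      cardinality≤ : cardinality {a} (λ _ → true) ≤ a
      cardinality≤ = ≤-reflexive (trans (length-as-∑ (allFin a)) (length-allFin a))
      E≤ : E ≤ 8 ^ e₀ * R
      E≤ = ≤-cancelʳ-* (q ^ a) (^-pos q a 1≤q) (begin
        E * q ^ a ≤⟨ ∑-x^hits-row (λ _ → true) a 1 cardinality≤ ⟩
        (q + 1) ^ a * R ≡⟨ cong (λ z → (q + 1) ^ z * R) a≡ ⟩
        (q + 1) ^ (q * e₀) * R ≤⟨ *-monoˡ-≤ R (power≤8^* q 1 e₀ 1≤q) ⟩
        8 ^ (1 * e₀) * q ^ (q * e₀) * R ≡⟨ cong₂ (λ u z → 8 ^ u * q ^ z * R) (*-identityˡ e₀) (sym a≡) ⟩
        8 ^ e₀ * q ^ a * R ≡⟨ refl ⟩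
        8 ^ e₀ * R * q ^ a                  ∎)
      xE≤ : x * E ≤ x * 8 ^ e₀ * R
      xE≤ = ≤-trans (*-monoʳ-≤ x E≤) (≤-reflexive (sym (*-assoc x _ R)))
      pointwise : ∀ v → 2 ^ D * x ^ Y v ≤ 2 ^ D + x * 2 ^ deg v
      pointwise v with D ≤ᵇ deg v in e
      ... | false = ≤-trans (≤-reflexive (*-identityʳ (2 ^ D))) (m≤m+n _ _)
      ... | true  = ≤-trans (≤-reflexive (trans (cong (2 ^ D *_) (*-identityʳ x)) (*-comm (2 ^ D) x)))
                      (≤-trans (*-monoʳ-≤ x (^-monoʳ-≤ 2 (≤ᵇ-dec D (deg v) e))) (m≤n+m _ (2 ^ D)))
      total : 2 ^ D * ∑ rows (λ v → x ^ Y v) ≤ 2 ^ D * R + x * E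
      total = begin
        2 ^ D * ∑ rows (λ v → x ^ Y v) ≡⟨ ∑-*ˡ rows (2 ^ D) _ ⟨
        ∑ rows (λ v → 2 ^ D * x ^ Y v) ≤⟨ ∑-mono rows pointwise ⟩
        ∑ rows (λ v → 2 ^ D + x * 2 ^ deg v) ≡⟨ ∑-+ rows (λ _ → 2 ^ D) _ ⟩
        ∑ rows (λ _ → 2 ^ D) + ∑ rows (λ v → x * 2 ^ deg v)
                                                       ≡⟨ cong₂ _+_ (trans (∑-const rows (2 ^ D)) (trans (cong (_* 2 ^ D) length-rows) (*-comm R (2 ^ D)))) (∑-*ˡ rows x _) ⟩
        2 ^ D * R + x * E                              ∎

-- Random matrices

does-sym : (_≟ᴬ_ : DecidableEquality A) → ∀ x y → does (x ≟ᴬ y) ≡ does (y ≟ᴬ x)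
does-sym _≟ᴬ_ x y with x ≟ᴬ y
... | yes e = sym (dec-true (y ≟ᴬ x) (sym e))
... | no ne = sym (dec-false (y ≟ᴬ x) (ne ∘ sym))

Matrix : Set → ℕ → ℕ → Set
Matrix A n m = Vec (Vec A m) n

entry : ∀ {n m} → Matrix A n m → Fin n → Fin m → A
entry M y z = lookup (lookup M y) z

tabulated : ∀ {n m} → (Fin n → Fin m → A) → Matrix A n m
tabulated h = Vec.tabulate (λ x → Vec.tabulate (h x))

entry-tabulated : ∀ {n m} (h : Fin n → Fin m → A) x y → entry (tabulated h) x y ≡ h x y
entry-tabulated h x y = trans (cong (λ v → lookup v y) (lookup∘tabulate (λ x → Vec.tabulate (h x)) x)) (lookup∘tabulate (h x) y)

transposed : ∀ {n m} → Matrix A n m → Matrix A m n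
transposed []      = Vec.replicate _ []
transposed (r ∷ M) = zipWith _∷_ r (transposed M)

entry-transposed : ∀ {n m} (M : Matrix A n m) y z → entry (transposed M) z y ≡ entry M y z
entry-transposed (r ∷ M) zero    z = cong (λ v → lookup v zero) (lookup-zipWith _∷_ z r (transposed M))
entry-transposed (r ∷ M) (suc y) z = trans (cong (λ v → lookup v (suc y)) (lookup-zipWith _∷_ z r (transposed M))) (entry-transposed M y z)

∑-adjoin-column : ∀ (xs : List A) n m (f : Matrix A m (suc n) → ℕ) →
  ∑ (vecs xs m) (λ r → ∑ (vecs (vecs xs n) m) (λ N → f (zipWith _∷_ r N))) ≡ ∑ (vecs (vecs xs (suc n)) m) f
∑-adjoin-column xs n zero    f = +-identityʳ _
∑-adjoin-column xs n (suc m) f = begin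
  ∑ (vecs xs (suc m)) (λ r → ∑ (vecs (vecs xs n) (suc m)) (λ N → f (zipWith _∷_ r N)))
    ≡⟨ ∑-vecs xs m _ ⟩
  ∑ xs (λ x → ∑ (vecs xs m) (λ r → ∑ (vecs (vecs xs n) (suc m)) (λ N → f (zipWith _∷_ (x ∷ r) N))))
    ≡⟨ ∑-cong xs (λ x → trans (∑-cong (vecs xs m) (λ r → ∑-vecs (vecs xs n) m _))
                              (∑-swap (vecs xs m) (vecs xs n) _)) ⟩
  ∑ xs (λ x → ∑ (vecs xs n) (λ v → ∑ (vecs xs m) (λ r → ∑ (vecs (vecs xs n) m) (λ N → f ((x ∷ v) ∷ zipWith _∷_ r N)))))
    ≡⟨ ∑-cong xs (λ x → ∑-cong (vecs xs n) (λ v → ∑-adjoin-column xs n m (λ N → f ((x ∷ v) ∷ N)))) ⟩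
  ∑ xs (λ x → ∑ (vecs xs n) (λ v → ∑ (vecs (vecs xs (suc n)) m) (λ N → f ((x ∷ v) ∷ N))))
    ≡⟨ ∑-vecs xs n (λ w → ∑ (vecs (vecs xs (suc n)) m) (λ N → f (w ∷ N))) ⟨
  ∑ (vecs xs (suc n)) (λ w → ∑ (vecs (vecs xs (suc n)) m) (λ N → f (w ∷ N)))
    ≡⟨ ∑-vecs (vecs xs (suc n)) m f ⟨
  ∑ (vecs (vecs xs (suc n)) (suc m)) f ∎
  where open ≡-Reasoning

-- Transposition is a bijection between the two lists of matrices; it carries every statistic of the
-- rows over to the columns.
∑-transposed : ∀ (xs : List A) n m (f : Matrix A m n → ℕ) →
  ∑ (vecs (vecs xs m) n) (f ∘ transposed) ≡ ∑ (vecs (vecs xs n) m) f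
∑-transposed xs zero    m f = sym (only-empty m f)
  where
  only-empty : ∀ m (f : Matrix _ m 0 → ℕ) → ∑ (vecs (vecs xs 0) m) f ≡ f (Vec.replicate m []) + 0
  only-empty zero    f = refl
  only-empty (suc m) f = trans (∑-vecs (vecs xs 0) m f) (trans (+-identityʳ _) (only-empty m (λ N → f ([] ∷ N))))
∑-transposed xs (suc n) m f = begin
  ∑ (vecs (vecs xs m) (suc n)) (f ∘ transposed)
    ≡⟨ ∑-vecs (vecs xs m) n _ ⟩
  ∑ (vecs xs m) (λ r → ∑ (vecs (vecs xs m) n) (λ M → f (zipWith _∷_ r (transposed M))))
    ≡⟨ ∑-cong (vecs xs m) (λ r → ∑-transposed xs n m (λ N → f (zipWith _∷_ r N))) ⟩
  ∑ (vecs xs m) (λ r → ∑ (vecs (vecs xs n) m) (λ N → f (zipWith _∷_ r N)))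
    ≡⟨ ∑-adjoin-column xs n m f ⟩
  ∑ (vecs (vecs xs (suc n)) m) f ∎
  where open ≡-Reasoning

union-bound : ∀ (Ω : List A) (I : List B) (f : B → A → ℕ) K L C D → 1 ≤ C →
  (∀ i → ∑ Ω (f i) * K ≤ C * D) → C * (length I * L) ≤ K →
  ∑ Ω (λ ω → ∑ I (λ i → f i ω)) * L ≤ D
union-bound Ω []            f K L C D 1≤C h le = ≤-trans (≤-reflexive (cong (_* L) (∑-zero Ω))) z≤n
union-bound {A} Ω I@(_ ∷ _) f K L C D 1≤C h le = ≤-cancelʳ-* (length I * C) (*-mono-≤ {1} {length I} (s≤s z≤n) 1≤C) (begin
  ∑ Ω (λ ω → ∑ I (λ i → f i ω)) * L * (length I * C)
    ≡⟨ cong (λ s → s * L * (length I * C)) (∑-swap Ω I (λ ω i → f i ω)) ⟩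
  ∑ I (λ i → ∑ Ω (f i)) * L * (length I * C)
    ≡⟨ sh (∑ I (λ i → ∑ Ω (f i))) L (length I) C ⟩
  ∑ I (λ i → ∑ Ω (f i)) * (C * (length I * L))
    ≤⟨ *-monoʳ-≤ (∑ I (λ i → ∑ Ω (f i))) le ⟩
  ∑ I (λ i → ∑ Ω (f i)) * K
    ≡⟨ ∑-*ʳ I K (λ i → ∑ Ω (f i)) ⟨
  ∑ I (λ i → ∑ Ω (f i) * K)
    ≤⟨ ∑-bound I (C * D) h ⟩
  length I * (C * D)
    ≡⟨ sh₂ (length I) C D ⟩
  D * (length I * C) ∎)
  where
  open ≤-Reasoning
  sh : ∀ s l i c → s * l * (i * c) ≡ s * (c * (i * l))
  sh = solve-∀
  sh₂ : ∀ i c d → i * (c * d) ≡ d * (i * c)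
  sh₂ = solve-∀

𝟙∨≤ : ∀ b c → 𝟙 (b ∨ c) ≤ 𝟙 b + 𝟙 c
𝟙∨≤ true  c = s≤s z≤n
𝟙∨≤ false c = ≤-refl

∑-𝟙≟ : ∀ {n} (i : Fin n) (g : Fin n → ℕ) → ∑ (allFin n) (λ j → 𝟙 (does (j ≟ i)) * g j) ≡ g i
∑-𝟙≟ {suc n} zero    g = trans (∑-fins n _) (trans (cong (g zero + 0 +_) (∑-zero (allFin n))) (trans (+-identityʳ _) (+-identityʳ _)))
∑-𝟙≟ {suc n} (suc i) g = trans (∑-fins n (λ j → 𝟙 (does (j ≟ suc i)) * g j)) (trans (∑-cong (allFin n) (λ j → cong (λ b → 𝟙 b * g (suc j)) (does-suc j))) (∑-𝟙≟ i (g ∘ suc)))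
  where
  does-suc : ∀ j → does (suc j ≟ suc i) ≡ does (j ≟ i)
  does-suc j with j ≟ i
  ... | yes _ = refl
  ... | no  _ = refl

∑-𝟙≟-one : ∀ {n} (i : Fin n) → ∑ (allFin n) (λ j → 𝟙 (does (j ≟ i))) ≡ 1
∑-𝟙≟-one {n} i = trans (∑-cong (allFin n) (λ j → sym (*-identityʳ (𝟙 (does (j ≟ i)))))) (∑-𝟙≟ i (λ _ → 1))

-- Sets of at most w points are given by vectors with repetitions allowed, so that a union bound
-- over sets has n^w terms.
support : ∀ {n w} → Vec (Fin n) w → Fin n → Bool
support []      l = false
support (x ∷ W) l = does (l ≟ x) ∨ support W l

size-support : ∀ {n w} (W : Vec (Fin n) w) → cardinality (support W) ≤ w
size-support {n} []      = ≤-reflexive (∑-zero (allFin n))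
size-support {n} (x ∷ W) = ≤-trans (∑-mono (allFin n) (λ l → 𝟙∨≤ (does (l ≟ x)) (support W l)))
  (≤-trans (≤-reflexive (∑-+ (allFin n) _ _)) (+-mono-≤ (≤-reflexive (∑-𝟙≟-one x)) (size-support W)))

rectangle-hits : ∀ {n a} → (A → Bool) → (Fin n → Bool) → (Fin a → Bool) → Matrix A n a → ℕ
rectangle-hits {n = n} P U W M = ∑ (allFin n) (λ z → if U z then hits P W (lookup M z) else 0)

-- A rectangle makes at most w² = q e independent trials of probability p/q, so its moment is at
-- most (1 + p y/q)^(q e) ≤ 8^(p y e).
rectangle-count : ∀ (xs : List A) → A → ∀ a (P : A → Bool) (U W : Fin a → Bool) w e y s →
  1 ≤ length xs → cardinality U ≤ w → cardinality W ≤ w → w * w ≡ length xs * e →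
  count≥ (vecs (vecs xs a) a) (rectangle-hits P U W) s * suc y ^ s ≤
  8 ^ (∑ xs (𝟙 ∘ P) * y * e) * (length xs ^ a) ^ a
rectangle-count {A} xs x₀ a P U W w e y s 1≤q hU hW ww = ≤-cancelʳ-* (R ^ w * q ^ (w * w)) pos (begin
  cnt * suc y ^ s * (R ^ w * q ^ (w * w))
    ≤⟨ *-monoˡ-≤ (R ^ w * q ^ (w * w)) (markov-^ (vecs rows a) X s (suc y) (s≤s z≤n)) ⟩
  ∑ (vecs rows a) (λ M → suc y ^ X M) * (R ^ w * q ^ (w * w))
    ≤⟨ *-monoˡ-≤ (R ^ w * q ^ (w * w)) expectation ⟩
  ∏ a (λ z → if U z then F else R) * (R ^ w * q ^ (w * w))
    ≡⟨ *-assoc (∏ a (λ z → if U z then F else R)) (R ^ w) (q ^ (w * w)) ⟨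
  ∏ a (λ z → if U z then F else R) * R ^ w * q ^ (w * w)
    ≤⟨ *-monoˡ-≤ (q ^ (w * w)) (masked-∏ a U w F R R≤F hU) ⟩
  F ^ w * R ^ a * q ^ (w * w)
    ≡⟨ trans (cong (F ^ w * R ^ a *_) (sym (^-*-assoc q w w))) (sh₁ (F ^ w) (R ^ a) ((q ^ w) ^ w)) ⟩
  F ^ w * (q ^ w) ^ w * R ^ a
    ≡⟨ cong (_* R ^ a) (sym (^-distribʳ-* F (q ^ w) w)) ⟩
  (F * q ^ w) ^ w * R ^ a
    ≤⟨ *-monoˡ-≤ (R ^ a) (^-monoˡ-≤ w (∑-x^hits xs x₀ P W w y hW)) ⟩
  ((q + p * y) ^ w * R) ^ w * R ^ a
    ≡⟨ cong (_* R ^ a) (trans (^-distribʳ-* _ R w) (cong (_* R ^ w) (^-*-assoc (q + p * y) w w))) ⟩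
  (q + p * y) ^ (w * w) * R ^ w * R ^ a
    ≤⟨ *-monoˡ-≤ (R ^ a) (*-monoˡ-≤ (R ^ w) Z-bound) ⟩
  8 ^ (p * y * e) * q ^ (w * w) * R ^ w * R ^ a
    ≡⟨ sh₂ (8 ^ (p * y * e)) (q ^ (w * w)) (R ^ w) (R ^ a) ⟩
  8 ^ (p * y * e) * R ^ a * (R ^ w * q ^ (w * w)) ∎)
  where
  open ≤-Reasoning
  q = length xs
  p = ∑ xs (𝟙 ∘ P)
  rows = vecs xs a
  R = q ^ a
  X = rectangle-hits P U W
  cnt = count≥ (vecs rows a) X s
  F = ∑ rows (λ v → suc y ^ hits P W v)
  1≤R : 1 ≤ R
  1≤R = ^-pos q a 1≤q
  pos : 1 ≤ R ^ w * q ^ (w * w)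
  pos = *-mono-≤ (^-pos R w 1≤R) (^-pos q (w * w) 1≤q)
  R≤F : R ≤ F
  R≤F = ≤-trans (≤-reflexive (sym (trans (length-as-∑ rows) (length-vecs xs a)))) (∑-mono rows (λ v → ^-pos (suc y) (hits P W v) (s≤s z≤n)))
  f : Fin a → Vec A a → ℕ
  f z v = if U z then suc y ^ hits P W v else 1
  factor : ∀ z → ∑ rows (f z) ≡ (if U z then F else R)
  factor z with U z
  ... | true  = refl
  ... | false = trans (length-as-∑ rows) (length-vecs xs a)
  expectation : ∑ (vecs rows a) (λ M → suc y ^ X M) ≤ ∏ a (λ z → if U z then F else R)
  expectation = begin
    ∑ (vecs rows a) (λ M → suc y ^ X M) ≡⟨ ∑-cong (vecs rows a) (λ M → trans (sym (∏-^ a (suc y) _)) (∏-cong a (λ z → push (U z) (lookup M z)))) ⟩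
    ∑ (vecs rows a) (λ M → ∏ a (λ z → f z (lookup M z))) ≤⟨ independent-product rows (Vec.replicate a x₀) a f ⟩
    ∏ a (λ z → ∑ rows (f z)) ≡⟨ ∏-cong a factor ⟩
    ∏ a (λ z → if U z then F else R)                           ∎
    where
    push : ∀ b v → suc y ^ (if b then hits P W v else 0) ≡ (if b then suc y ^ hits P W v else 1)
    push true  v = refl
    push false v = refl
  Z-bound : (q + p * y) ^ (w * w) ≤ 8 ^ (p * y * e) * q ^ (w * w)
  Z-bound = subst (λ z → (q + p * y) ^ z ≤ 8 ^ (p * y * e) * q ^ z) (sym ww) (power≤8^* q (p * y) e 1≤q)
  sh₁ : ∀ a b c → a * b * c ≡ a * c * b
  sh₁ = solve-∀
  sh₂ : ∀ a b c d → a * b * c * d ≡ a * d * (c * b)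
  sh₂ = solve-∀

-- Exposing the entries of a matrix row by row, each row from left to right.
module Exposure {A : Set} (xs : List A) (x₀ : A) (P : A → Bool) (single : ∑ xs (𝟙 ∘ P) ≡ 1) (a : ℕ)
                (eligible : Fin a → Fin a → Bool) where

  common-below : Fin a → Vec A a → Vec A a → ℕ
  common-below z v v′ = ∑ (allFin a) (λ t → 𝟙 ((toℕ t <ᵇ toℕ z) ∧ (P (lookup v t) ∧ P (lookup v′ t))))

  -- Depends only on the earlier row z and on the entries of row y to the left of z. Hence it is
  -- decided before the entry at (y, z) is exposed, while that letter is still uniform.
  is-open : Fin a → Fin a → Vec A a → Vec A a → Bool
  is-open y z v v′ = (toℕ z <ᵇ toℕ y) ∧ (eligible y z ∧ (common-below z v v′ ≡ᵇ 0))

  open-at : Fin a → Fin a → Matrix A a a → Bool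
  open-at y z M = is-open y z (lookup M y) (lookup M z)

  open-pairs : Matrix A a a → ℕ
  open-pairs M = ∑ (allFin a) (λ y → ∑ (allFin a) (λ z → 𝟙 (open-at y z M)))

  open-hits : Matrix A a a → ℕ
  open-hits M = ∑ (allFin a) (λ y → ∑ (allFin a) (λ z → 𝟙 (open-at y z M ∧ P (entry M y z))))

  module _ (q′ : ℕ) (length-xs : length xs ≡ suc q′) (1≤q′ : 1 ≤ q′) where
    private
      q = suc q′

      -- The factor of a supermartingale: at an open pair the letter of `P` has weight 0 and the q′
      -- others have weight q, elsewhere every letter has weight q′. Both averages over the q
      -- letters are q′.
      weight : Bool → A → ℕ
      weight true  x = if P x then 0 else q
      weight false x = q′

      ∑-weight : ∀ b → ∑ xs (weight b) ≤ q * q′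
      ∑-weight false = ≤-reflexive (trans (∑-const xs q′) (cong (_* q′) length-xs))
      ∑-weight true  = +-cancelʳ-≤ q _ _ (≤-reflexive (begin
        ∑ xs (weight true) + q ≡⟨ cong (∑ xs (weight true) +_) (sym (trans (cong (_* q) single) (+-identityʳ q))) ⟩
        ∑ xs (weight true) + ∑ xs (𝟙 ∘ P) * q ≡⟨ cong (∑ xs (weight true) +_) (sym (∑-*ʳ xs q (𝟙 ∘ P))) ⟩
        ∑ xs (weight true) + ∑ xs (λ x → 𝟙 (P x) * q) ≡⟨ ∑-+ xs _ _ ⟨
        ∑ xs (λ x → weight true x + 𝟙 (P x) * q) ≡⟨ ∑-cong xs pointwise ⟩
        ∑ xs (λ _ → q) ≡⟨ trans (∑-const xs q) (cong (_* q) length-xs) ⟩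
        q * q ≡⟨ trans (*-suc q q′) (+-comm q (q * q′)) ⟩
        q * q′ + q                                     ∎))
        where
        open ≡-Reasoning
        pointwise : ∀ x → weight true x + 𝟙 (P x) * q ≡ q
        pointwise x with P x
        ... | true  = +-identityʳ q
        ... | false = +-identityʳ q

      <ᵇ-dec : ∀ m n → (m <ᵇ n) ≡ true → m < n
      <ᵇ-dec m n e = <ᵇ⇒< m n (subst T (sym e) _)

      common-below-cong : ∀ z (v v′ u : Vec A a) → (∀ t → toℕ t < toℕ z → lookup v t ≡ lookup v′ t) →
                          common-below z v u ≡ common-below z v′ u
      common-below-cong z v v′ u h = ∑-cong (allFin a) pointwise
        where
        pointwise : ∀ t → 𝟙 ((toℕ t <ᵇ toℕ z) ∧ (P (lookup v t) ∧ P (lookup u t))) ≡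
                          𝟙 ((toℕ t <ᵇ toℕ z) ∧ (P (lookup v′ t) ∧ P (lookup u t)))
        pointwise t with toℕ t <ᵇ toℕ z in e
        ... | false = refl
        ... | true  = cong (λ x → 𝟙 (P x ∧ P (lookup u t))) (h t (<ᵇ-dec (toℕ t) (toℕ z) e))

      is-open-cong : ∀ y z (v v′ u : Vec A a) → (∀ t → toℕ t < toℕ z → lookup v t ≡ lookup v′ t) → is-open y z v u ≡ is-open y z v′ u
      is-open-cong y z v v′ u h = cong (λ c → (toℕ z <ᵇ toℕ y) ∧ (eligible y z ∧ (c ≡ᵇ 0))) (common-below-cong z v v′ u h)

      row-weight : Fin a → Matrix A a a → ℕ
      row-weight y M = ∏ a (λ z → weight (open-at y z M) (entry M y z))

      row-dep : ∀ y M M′ → (∀ t → toℕ t ≤ toℕ y → lookup M t ≡ lookup M′ t) → row-weight y M ≡ row-weight y M′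
      row-dep y M M′ h = ∏-cong a (λ z → cong₂ weight (same z) (cong (λ v → lookup v z) (h y ≤-refl)))
        where
        same : ∀ z → open-at y z M ≡ open-at y z M′
        same z with toℕ z <ᵇ toℕ y in e
        ... | false = refl
        ... | true  = cong₂ (λ v v′ → eligible y z ∧ (common-below z v v′ ≡ᵇ 0)) (h y ≤-refl) (h z (<⇒≤ (<ᵇ-dec (toℕ z) (toℕ y) e)))

      row-bound : ∀ y M → ∑ (vecs xs a) (λ v → row-weight y (M [ y ]≔ v)) ≤ (q * q′) ^ a
      row-bound y M = begin
        ∑ (vecs xs a) (λ v → row-weight y (M [ y ]≔ v)) ≡⟨ ∑-cong (vecs xs a) (λ v → ∏-cong a (factor v)) ⟩
        ∑ (vecs xs a) (λ v → ∏ a (λ z → g z v)) ≤⟨ sequential-product xs x₀ a g (λ _ → q * q′) g-dep g-bound ⟩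
        ∏ a (λ _ → q * q′) ≡⟨ ∏-const a (q * q′) ⟩
        (q * q′) ^ a                                        ∎
        where
        open ≤-Reasoning
        g : Fin a → Vec A a → ℕ
        g z v = weight (is-open y z v (lookup M z)) (lookup v z)
        factor : ∀ v z → weight (open-at y z (M [ y ]≔ v)) (entry (M [ y ]≔ v) y z) ≡ g z v
        factor v z rewrite lookup∘update y M v with toℕ z <ᵇ toℕ y in e
        ... | false = refl
        ... | true  = cong (λ u → weight (eligible y z ∧ (common-below z v u ≡ᵇ 0)) (lookup v z))
                        (lookup∘update′ (λ { refl → <-irrefl refl (<ᵇ-dec (toℕ z) (toℕ z) e) }) M v)
        g-dep : ∀ z v v′ → (∀ t → toℕ t ≤ toℕ z → lookup v t ≡ lookup v′ t) → g z v ≡ g z v′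
        g-dep z v v′ h = cong₂ weight (is-open-cong y z v v′ (lookup M z) (λ t lt → h t (<⇒≤ lt))) (h z ≤-refl)
        g-bound : ∀ z v → ∑ xs (λ x → g z (v [ z ]≔ x)) ≤ q * q′
        g-bound z v = ≤-trans (≤-reflexive (∑-cong xs (λ x → cong₂ weight
            (is-open-cong y z (v [ z ]≔ x) v (lookup M z) (λ t lt → lookup∘update′ (λ { refl → <-irrefl refl lt }) v x))
            (lookup∘update z v x))))
          (∑-weight (is-open y z v (lookup M z)))

      total-weight : Matrix A a a → ℕ
      total-weight M = ∏ a (λ y → row-weight y M)

      ∑-total-weight : ∑ (vecs (vecs xs a) a) total-weight ≤ (q * q′) ^ (a * a)
      ∑-total-weight = ≤-trans (sequential-product (vecs xs a) (Vec.replicate a x₀) a row-weight (λ _ → (q * q′) ^ a) row-dep row-bound)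
        (≤-reflexive (trans (∏-const a _) (^-*-assoc (q * q′) a a)))

      local-weight : ∀ b x → 𝟙 (b ∧ P x) ≡ 0 → weight b x * q′ ^ 𝟙 b ≡ q ^ 𝟙 b * q′
      local-weight false x _ = trans (*-identityʳ q′) (sym (+-identityʳ q′))
      local-weight true  x h with P x
      ... | false = trans (cong (q *_) (*-identityʳ q′)) (cong (_* q′) (sym (*-identityʳ q)))

      missed-weight : ∀ M → open-hits M ≡ 0 → total-weight M * q′ ^ open-pairs M ≡ q ^ open-pairs M * q′ ^ (a * a)
      missed-weight M miss = begin
        total-weight M * q′ ^ open-pairs M
          ≡⟨ cong (total-weight M *_) (sym (∏∏-^ q′ (λ y z → 𝟙 (open-at y z M)))) ⟩
        ∏ a (λ y → row-weight y M) * ∏ a (λ y → ∏ a (λ z → q′ ^ 𝟙 (open-at y z M)))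
          ≡⟨ sym (∏-* a _ _) ⟩
        ∏ a (λ y → row-weight y M * ∏ a (λ z → q′ ^ 𝟙 (open-at y z M)))
          ≡⟨ ∏-cong a (λ y → trans (sym (∏-* a _ _)) (∏-cong a (λ z → local y z))) ⟩
        ∏ a (λ y → ∏ a (λ z → q ^ 𝟙 (open-at y z M) * q′))
          ≡⟨ ∏-cong a (λ y → ∏-* a _ _) ⟩
        ∏ a (λ y → ∏ a (λ z → q ^ 𝟙 (open-at y z M)) * ∏ a (λ _ → q′))
          ≡⟨ ∏-* a _ _ ⟩
        ∏ a (λ y → ∏ a (λ z → q ^ 𝟙 (open-at y z M))) * ∏ a (λ _ → ∏ a (λ _ → q′))
          ≡⟨ cong₂ _*_ (∏∏-^ q (λ y z → 𝟙 (open-at y z M))) (trans (∏-cong a (λ _ → ∏-const a q′)) (trans (∏-const a _) (^-*-assoc q′ a a))) ⟩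
        q ^ open-pairs M * q′ ^ (a * a) ∎
        where
        open ≡-Reasoning
        ∏∏-^ : ∀ x (f : Fin a → Fin a → ℕ) → ∏ a (λ y → ∏ a (λ z → x ^ f y z)) ≡ x ^ ∑ (allFin a) (λ y → ∑ (allFin a) (f y))
        ∏∏-^ x f = trans (∏-cong a (λ y → ∏-^ a x (f y))) (∏-^ a x _)
        local : ∀ y z → weight (open-at y z M) (entry M y z) * q′ ^ 𝟙 (open-at y z M) ≡ q ^ 𝟙 (open-at y z M) * q′
        local y z = local-weight (open-at y z M) (entry M y z) (∑-zero-∈ (∑-zero-∈ miss (∈-allFin y)) (∈-allFin z))

    -- The number of open pairs is random, so the misses cannot simply be multiplied. But a matrix
    -- that misses at all of its open pairs has weight at least (q/q′)^N₀ times the average allowed,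
    -- which leaves a fraction of at most (1 - 1/q)^N₀ of the matrices.
    exposure-bound : ∀ N₀ → ∑ (vecs (vecs xs a) a) (λ M → 𝟙 ((N₀ ≤ᵇ open-pairs M) ∧ (open-hits M ≡ᵇ 0))) * q ^ N₀
                            ≤ q′ ^ N₀ * q ^ (a * a)
    exposure-bound N₀ = ≤-cancelʳ-* (q′ ^ (a * a)) (^-pos q′ (a * a) 1≤q′) (begin
      cnt * q ^ N₀ * q′ ^ (a * a) ≡⟨ trans (*-assoc cnt _ _) (sym (∑-*ʳ Ω _ _)) ⟩
      ∑ Ω (λ M → 𝟙 (bad M) * (q ^ N₀ * q′ ^ (a * a))) ≤⟨ ∑-mono Ω pointwise ⟩
      ∑ Ω (λ M → q′ ^ N₀ * total-weight M) ≡⟨ ∑-*ˡ Ω (q′ ^ N₀) total-weight ⟩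
      q′ ^ N₀ * ∑ Ω total-weight ≤⟨ *-monoʳ-≤ (q′ ^ N₀) ∑-total-weight ⟩
      q′ ^ N₀ * (q * q′) ^ (a * a) ≡⟨ cong (q′ ^ N₀ *_) (^-distribʳ-* q q′ (a * a)) ⟩
      q′ ^ N₀ * (q ^ (a * a) * q′ ^ (a * a)) ≡⟨ *-assoc (q′ ^ N₀) _ _ ⟨
      q′ ^ N₀ * q ^ (a * a) * q′ ^ (a * a)              ∎)
      where
      open ≤-Reasoning
      Ω = vecs (vecs xs a) a
      bad : Matrix A a a → Bool
      bad M = (N₀ ≤ᵇ open-pairs M) ∧ (open-hits M ≡ᵇ 0)
      cnt = ∑ Ω (λ M → 𝟙 (bad M))
      main : ∀ M → N₀ ≤ open-pairs M → open-hits M ≡ 0 → q ^ N₀ * q′ ^ (a * a) ≤ q′ ^ N₀ * total-weight M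
      main M N₀≤ miss = ≤-cancelʳ-* (q′ ^ N) (^-pos q′ N 1≤q′) (begin
        q ^ N₀ * q′ ^ (a * a) * q′ ^ N ≡⟨ cong (λ n → q ^ N₀ * q′ ^ (a * a) * q′ ^ n) (sym (m+[n∸m]≡n N₀≤)) ⟩
        q ^ N₀ * q′ ^ (a * a) * q′ ^ (N₀ + δ) ≡⟨ cong (q ^ N₀ * q′ ^ (a * a) *_) (^-distribˡ-+-* q′ N₀ δ) ⟩
        q ^ N₀ * q′ ^ (a * a) * (q′ ^ N₀ * q′ ^ δ) ≤⟨ *-monoʳ-≤ (q ^ N₀ * q′ ^ (a * a)) (*-monoʳ-≤ (q′ ^ N₀) (^-monoˡ-≤ δ (n≤1+n q′))) ⟩
        q ^ N₀ * q′ ^ (a * a) * (q′ ^ N₀ * q ^ δ) ≡⟨ sh (q ^ N₀) (q′ ^ (a * a)) (q′ ^ N₀) (q ^ δ) ⟩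
        q′ ^ N₀ * (q ^ N₀ * q ^ δ * q′ ^ (a * a)) ≡⟨ cong (λ z → q′ ^ N₀ * (z * q′ ^ (a * a))) (trans (sym (^-distribˡ-+-* q N₀ δ)) (cong (q ^_) (m+[n∸m]≡n N₀≤))) ⟩
        q′ ^ N₀ * (q ^ N * q′ ^ (a * a)) ≡⟨ cong (q′ ^ N₀ *_) (sym (missed-weight M miss)) ⟩
        q′ ^ N₀ * (total-weight M * q′ ^ N) ≡⟨ *-assoc (q′ ^ N₀) _ _ ⟨
        q′ ^ N₀ * total-weight M * q′ ^ N          ∎)
        where
        N = open-pairs M
        δ = N ∸ N₀
        sh : ∀ a b c d → a * b * (c * d) ≡ c * (a * d * b)
        sh = solve-∀
      pointwise : ∀ M → 𝟙 (bad M) * (q ^ N₀ * q′ ^ (a * a)) ≤ q′ ^ N₀ * total-weight M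
      pointwise M with N₀ ≤ᵇ open-pairs M in e₁ | open-hits M ≡ᵇ 0 in e₂
      ... | false | _     = z≤n
      ... | true  | false = z≤n
      ... | true  | true  = ≤-trans (≤-reflexive (+-identityʳ _))
              (main M (≤ᵇ-dec N₀ (open-pairs M) e₁) (≡ᵇ⇒≡ (open-hits M) 0 (subst T (sym e₂) _)))

-- Splitting lists by multiplicity

multiplicity : ∀ {a} → (A → Fin a) → List A → Fin a → ℕ
multiplicity κ ys x = ∑ ys (λ y → 𝟙 (does (κ y ≟ x)))

Distinct : ∀ {a} → (A → Fin a) → List A → Set
Distinct κ ys = ∀ x → multiplicity κ ys x ≤ 1

∑-fibres : ∀ {a} (κ : A → Fin a) (ys : List A) (g : Fin a → ℕ) →
           ∑ ys (g ∘ κ) ≡ ∑ (allFin a) (λ x → multiplicity κ ys x * g x)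
∑-fibres {a = a} κ ys g = begin
  ∑ ys (g ∘ κ) ≡⟨ ∑-cong ys (λ y → sym (trans (∑-cong (allFin a) (λ x → cong (λ b → 𝟙 b * g x) (does-sym _≟_ (κ y) x))) (∑-𝟙≟ (κ y) g))) ⟩
  ∑ ys (λ y → ∑ (allFin a) (λ x → 𝟙 (does (κ y ≟ x)) * g x)) ≡⟨ ∑-swap ys (allFin a) (λ y x → 𝟙 (does (κ y ≟ x)) * g x) ⟩
  ∑ (allFin a) (λ x → ∑ ys (λ y → 𝟙 (does (κ y ≟ x)) * g x)) ≡⟨ ∑-cong (allFin a) (λ x → ∑-*ʳ ys (g x) (λ y → 𝟙 (does (κ y ≟ x)))) ⟩
  ∑ (allFin a) (λ x → multiplicity κ ys x * g x)                  ∎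
  where
  open ≡-Reasoning

∑-distinct : ∀ {a} (κ : A → Fin a) (ys : List A) (g : Fin a → ℕ) → Distinct κ ys →
             ∑ ys (g ∘ κ) ≤ ∑ (allFin a) g
∑-distinct {a = a} κ ys g d = ≤-trans (≤-reflexive (∑-fibres κ ys g))
  (∑-mono (allFin a) (λ x → ≤-trans (*-monoˡ-≤ (g x) (d x)) (≤-reflexive (*-identityˡ (g x)))))

multiplicity-∈ : ∀ {a} (κ : A → Fin a) {ys y} → y ∈ ys → 1 ≤ multiplicity κ ys (κ y)
multiplicity-∈ κ {ys} {y} p = ≤-trans (≤-reflexive (cong 𝟙 (sym (dec-true (κ y ≟ κ y) refl))))
  (∑-∈ p (λ z → 𝟙 (does (κ z ≟ κ y))))

-- The equation for all weights g says that `first` and `rest` partition `ys` as multisets, in the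
-- form in which it is applied.
record Split {a} (κ : A → Fin a) (ys : List A) : Set where
  field
    first rest  : List A
    sums        : ∀ g → ∑ ys g ≡ ∑ first g + ∑ rest g
    distinct    : Distinct κ first
    covers      : ∀ x → 1 ≤ multiplicity κ ys x → 1 ≤ multiplicity κ first x
    ⊆-first     : ∀ {y} → y ∈ first → y ∈ ys

split : ∀ {a} (κ : A → Fin a) (ys : List A) → Split κ ys
split κ [] = record { first = [] ; rest = [] ; sums = λ g → refl ; distinct = λ x → z≤n ; covers = λ x h → h ; ⊆-first = id }
split {a = a} κ (y ∷ ys) with split κ ys
... | s with multiplicity κ (Split.first s) (κ y) in e
... | zero  = record
  { first = y ∷ S.first ; rest = S.rest
  ; sums = λ g → trans (cong (g y +_) (S.sums g)) (sym (+-assoc (g y) _ _))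
  ; distinct = dist
  ; covers = λ x h → cov x h
  ; ⊆-first = λ { (here e′) → here e′ ; (there p) → there (S.⊆-first p) } }
  where
  module S = Split s
  dist : ∀ x → 𝟙 (does (κ y ≟ x)) + multiplicity κ S.first x ≤ 1
  dist x with κ y ≟ x
  ... | yes refl = ≤-reflexive (cong suc e)
  ... | no _     = S.distinct x
  cov : ∀ x → 1 ≤ 𝟙 (does (κ y ≟ x)) + multiplicity κ ys x → 1 ≤ 𝟙 (does (κ y ≟ x)) + multiplicity κ S.first x
  cov x h with κ y ≟ x
  ... | yes _ = s≤s z≤n
  ... | no _  = S.covers x h
... | suc k = record
  { first = S.first ; rest = y ∷ S.rest
  ; sums = λ g → trans (cong (g y +_) (S.sums g)) (sh (g y) (∑ S.first g) (∑ S.rest g))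
  ; distinct = S.distinct
  ; covers = cov
  ; ⊆-first = λ p → there (S.⊆-first p) }
  where
  module S = Split s
  sh : ∀ a b c → a + (b + c) ≡ b + (a + c)
  sh = solve-∀
  cov : ∀ x → 1 ≤ 𝟙 (does (κ y ≟ x)) + multiplicity κ ys x → 1 ≤ multiplicity κ S.first x
  cov x h with κ y ≟ x
  ... | yes refl = ≤-trans (s≤s z≤n) (≤-reflexive (sym e))
  ... | no _  = S.covers x h

pad : A → List A → ∀ m → Vec A m
pad d ys       zero    = []
pad d []       (suc m) = d ∷ pad d [] m
pad d (y ∷ ys) (suc m) = y ∷ pad d ys m

pad-support : ∀ {n} (d : Fin n) ys m {y} → length ys ≤ m → y ∈ ys → support (pad d ys m) y ≡ true
pad-support d (y ∷ ys) (suc m) h (here refl) with y ≟ y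
... | yes _ = refl
... | no ne = contradiction refl ne
pad-support d (x ∷ ys) (suc m) {y} (s≤s h) (there p) with does (y ≟ x)
... | true  = refl
... | false = pad-support d ys m h p

record Prefix (m : ℕ) (ys : List A) : Set where
  field
    vector : Vec A m
    sums≤  : ∀ g → ∑ (Vec.toList vector) g ≤ ∑ ys g
    ⊆-list : ∀ {y} → y ∈ Vec.toList vector → y ∈ ys

prefix : ∀ m (ys : List A) → m ≤ length ys → Prefix m ys
prefix zero    ys       h = record { vector = [] ; sums≤ = λ g → z≤n ; ⊆-list = λ () }
prefix (suc m) (y ∷ ys) (s≤s h) = record
  { vector = y ∷ R.vector ; sums≤ = λ g → +-monoʳ-≤ (g y) (R.sums≤ g) ; ⊆-list = λ { (here e) → here e ; (there p) → there (R.⊆-list p) } }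
  where module R = Prefix (prefix m ys h)

record Chunks {a} (κ : A → Fin a) (w extra : ℕ) (ys : List A) : Set where
  field
    chunks : List (List A)
    sums   : ∀ g → ∑ ys g ≡ ∑ chunks (λ c → ∑ c g)
    short  : All (λ c → length c ≤ w × Distinct κ c) chunks
    number : length chunks * w ≤ length ys + extra

pieces : ∀ {a} (κ : A → Fin a) w fuel (ys : List A) → 1 ≤ w → length ys ≤ fuel → Distinct κ ys → Chunks κ w w ys
pieces κ w fuel ys 1≤w h d with length ys ≤? w
... | yes le = record { chunks = ys ∷ [] ; sums = λ g → sym (+-identityʳ _) ; short = (le , d) ∷ []
                      ; number = ≤-trans (≤-reflexive (+-identityʳ w)) (m≤n+m w (length ys)) }
pieces κ w zero    ys 1≤w h d | no ¬le = contradiction (≤-trans h z≤n) ¬le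
pieces κ w (suc fuel) ys 1≤w h d | no ¬le = record
  { chunks = take w ys ∷ R.chunks
  ; sums = λ g → trans (parts g) (cong (∑ (take w ys) g +_) (R.sums g))
  ; short = (≤-trans (≤-reflexive (length-take w ys)) (m⊓n≤m w _) , λ x → ≤-trans (m≤m+n _ _) (≤-trans (≤-reflexive (sym (parts _))) (d x))) ∷ R.short
  ; number = ≤-trans (+-monoʳ-≤ w R.number) (≤-reflexive (trans (sym (+-assoc w _ w)) (cong (_+ w) (trans (cong (w +_) (length-drop w ys)) (m+[n∸m]≡n w≤))))) }
  where
  w≤ : w ≤ length ys
  w≤ = <⇒≤ (≰⇒> ¬le)
  parts : ∀ g → ∑ ys g ≡ ∑ (take w ys) g + ∑ (drop w ys) g
  parts g = trans (cong (λ l → ∑ l g) (sym (take++drop≡id w ys))) (∑-++ (take w ys) (drop w ys) g)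
  shorter : length (drop w ys) ≤ fuel
  shorter = ≤-trans (≤-reflexive (length-drop w ys)) (≤-trans (∸-monoʳ-≤ (length ys) 1≤w) (∸-monoˡ-≤ 1 h))
  module R = Chunks (pieces κ w fuel (drop w ys) 1≤w shorter (λ x → ≤-trans (m≤n+m _ _) (≤-trans (≤-reflexive (sym (parts _))) (d x))))

-- Removing one element for each value of κ lowers every positive multiplicity, so d rounds exhaust
-- the list. Each round may end with one incomplete chunk, and `d * w` pays for these.
chunks-of : ∀ {a} (κ : A → Fin a) w d (ys : List A) → 1 ≤ w → (∀ x → multiplicity κ ys x ≤ d) → Chunks κ w (d * w) ys
chunks-of κ w zero    []       1≤w h = record { chunks = [] ; sums = λ g → refl ; short = [] ; number = z≤n }
chunks-of κ w zero    (y ∷ ys) 1≤w h = contradiction (≤-trans (multiplicity-∈ κ {y ∷ ys} (here refl)) (h (κ y))) λ ()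
chunks-of κ w (suc d) ys       1≤w h = record
  { chunks = F.chunks ++ R.chunks
  ; sums = λ g → trans (S.sums g) (trans (cong₂ _+_ (F.sums g) (R.sums g)) (sym (∑-++ F.chunks R.chunks _)))
  ; short = ++⁺ F.short R.short
  ; number = begin
      length (F.chunks ++ R.chunks) * w ≡⟨ trans (cong (_* w) (length-++ F.chunks)) (*-distribʳ-+ w (length F.chunks) _) ⟩
      length F.chunks * w + length R.chunks * w ≤⟨ +-mono-≤ F.number R.number ⟩
      length S.first + w + (length S.rest + d * w) ≡⟨ sh (length S.first) w (length S.rest) (d * w) ⟩
      length S.first + length S.rest + (w + d * w) ≡⟨ cong (_+ (w + d * w)) (sym lengths) ⟩
      length ys + (w + d * w)                               ∎ }
  where
  open ≤-Reasoning
  module S = Split (split κ ys)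
  rest-bound : ∀ x → multiplicity κ S.rest x ≤ d
  rest-bound x with multiplicity κ S.rest x in e
  ... | zero  = z≤n
  ... | suc k = s≤s⁻¹ (≤-trans (+-mono-≤ (S.covers x pos) (≤-reflexive (sym e))) (≤-trans (≤-reflexive (sym (S.sums _))) (h x)))
    where
    pos : 1 ≤ multiplicity κ ys x
    pos = ≤-trans (s≤s z≤n) (≤-trans (≤-reflexive (sym e)) (≤-trans (m≤n+m _ _) (≤-reflexive (sym (S.sums _)))))
  module F = Chunks (pieces κ w (length S.first) S.first 1≤w ≤-refl S.distinct)
  module R = Chunks (chunks-of κ w d S.rest 1≤w rest-bound)
  lengths : length ys ≡ length S.first + length S.rest
  lengths = trans (sym (length-as-∑ ys)) (trans (S.sums _) (cong₂ _+_ (length-as-∑ S.first) (length-as-∑ S.rest)))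
  sh : ∀ a b c d → a + b + (c + d) ≡ a + c + (b + d)
  sh = solve-∀

-- Cauchy-Schwarz and averaging

2xy≤x²+y² : ∀ x y → 2 * (x * y) ≤ x * x + y * y
2xy≤x²+y² zero    y       = z≤n
2xy≤x²+y² (suc x) zero    = ≤-trans (≤-reflexive (cong (2 *_) (*-zeroʳ x))) z≤n
2xy≤x²+y² (suc x) (suc y) = ≤-trans (≤-reflexive (sh₁ x y)) (≤-trans (+-monoˡ-≤ (2 * x + 2 * y + 2) (2xy≤x²+y² x y)) (≤-reflexive (sh₂ x y)))
  where
  sh₁ : ∀ x y → 2 * (suc x * suc y) ≡ 2 * (x * y) + (2 * x + 2 * y + 2)
  sh₁ = solve-∀
  sh₂ : ∀ x y → x * x + y * y + (2 * x + 2 * y + 2) ≡ suc x * suc x + suc y * suc y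
  sh₂ = solve-∀

[x+y]²≤2[x²+y²] : ∀ x y → (x + y) * (x + y) ≤ 2 * (x * x + y * y)
[x+y]²≤2[x²+y²] x y = ≤-trans (≤-reflexive (sh₁ x y)) (≤-trans (+-monoʳ-≤ (x * x + y * y) (2xy≤x²+y² x y)) (≤-reflexive (sh₂ (x * x + y * y))))
  where
  sh₁ : ∀ x y → (x + y) * (x + y) ≡ x * x + y * y + 2 * (x * y)
  sh₁ = solve-∀
  sh₂ : ∀ s → s + s ≡ 2 * s
  sh₂ = solve-∀

cauchy-schwarz : ∀ (xs : List A) (f : A → ℕ) → ∑ xs f * ∑ xs f ≤ length xs * ∑ xs (λ x → f x * f x)
cauchy-schwarz xs f = *-cancelˡ-≤ 2 (begin
  2 * (∑ xs f * ∑ xs f) ≡⟨ cong (2 *_) (sym (∑-square xs f)) ⟩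
  2 * ∑ xs (λ x → ∑ xs (λ y → f x * f y)) ≡⟨ sym (trans (∑-cong xs (λ x → ∑-*ˡ xs 2 (λ y → f x * f y))) (∑-*ˡ xs 2 (λ x → ∑ xs (λ y → f x * f y)))) ⟩
  ∑ xs (λ x → ∑ xs (λ y → 2 * (f x * f y))) ≤⟨ ∑-mono xs (λ x → ∑-mono xs (λ y → 2xy≤x²+y² (f x) (f y))) ⟩
  ∑ xs (λ x → ∑ xs (λ y → f x * f x + f y * f y)) ≡⟨ ∑-cong xs (λ x → trans (∑-+ xs (λ _ → f x * f x) (λ y → f y * f y)) (cong (_+ Q) (∑-const xs (f x * f x)))) ⟩
  ∑ xs (λ x → length xs * (f x * f x) + Q) ≡⟨ trans (∑-+ xs (λ x → length xs * (f x * f x)) (λ _ → Q)) (cong₂ _+_ (∑-*ˡ xs (length xs) (λ x → f x * f x)) (∑-const xs Q)) ⟩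
  length xs * Q + length xs * Q ≡⟨ sh (length xs * Q) ⟩
  2 * (length xs * Q)                                         ∎)
  where
  open ≤-Reasoning
  Q = ∑ xs (λ x → f x * f x)
  sh : ∀ s → s + s ≡ 2 * s
  sh = solve-∀

∑-positive : ∀ (xs : List A) f → 1 ≤ ∑ xs f → ∃[ x ] (x ∈ xs × 1 ≤ f x)
∑-positive (x ∷ xs) f h with f x in e
... | suc k = x , here refl , ≤-trans (s≤s z≤n) (≤-reflexive (sym e))
... | zero  with ∑-positive xs f h
... | y , p , q = y , there p , q

∑<⇒∃< : ∀ (xs : List A) f c → ∑ xs f < length xs * c → ∃[ x ] f x < c
∑<⇒∃< (x ∷ xs) f c h with f x <? c
... | yes lt = x , lt
... | no ¬lt = ∑<⇒∃< xs f c (+-cancelˡ-< c _ _ (≤-trans (s≤s (+-monoˡ-≤ (∑ xs f) (≮⇒≥ ¬lt))) h))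

some-large : ∀ (xs : List A) g c → length xs * c ≤ ∑ xs g → 1 ≤ length xs → ∃[ i ] c ≤ g i
some-large (x ∷ xs) g c h _ with c ≤? g x
... | yes le = x , le
some-large (x ∷ []) g c h _ | no ¬le = contradiction (+-cancelʳ-≤ 0 c (g x) h) ¬le
some-large (x ∷ xs@(_ ∷ _)) g c h _ | no ¬le = some-large xs g c
  (+-cancelˡ-≤ c _ _ (≤-trans h (+-monoˡ-≤ (∑ xs g) (<⇒≤ (≰⇒> ¬le))))) (s≤s z≤n)

-- Coloured pairs

record Packing (ℓ n : ℕ) : Set where
  field
    colour    : Fin n → Fin n → Maybe (Fin ℓ)
    symmetric : ∀ u v → colour u v ≡ colour v u
    loopless  : ∀ u → colour u u ≡ nothing
    no-mono   : ∀ u v w i → colour u v ≡ just i → colour v w ≡ just i → colour u w ≡ just i → ⊥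
    hitting   : ∀ (f : Fin n → Fin ℓ) → ∃[ u ] ∃[ v ] (colour u v ≡ just (f u) × f u ≡ f v)

Colour : ℕ → Set
Colour ℓ = Maybe (Fin ℓ)

is : Fin ℓ → Colour ℓ → Bool
is i (just j) = does (j ≟ i)
is i nothing  = false

coloured : Colour ℓ → Bool
coloured (just _) = true
coloured nothing  = false

is⇒≡ : ∀ (i : Fin ℓ) c → is i c ≡ true → c ≡ just i
is⇒≡ i (just j) e with j ≟ i
... | yes p = cong just p
is⇒≡ i (just j) () | no _

≡⇒is : ∀ {i : Fin ℓ} {c} → c ≡ just i → is i c ≡ true
≡⇒is {i = i} refl = dec-true (i ≟ i) refl

-- Repeating the blank e times makes the biased choice, probability 1/(ℓ + e) for each colour, a
-- uniform choice from a list.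
letters : ∀ ℓ → ℕ → List (Colour ℓ)
letters ℓ e = map just (allFin ℓ) ++ replicate e nothing

length-letters : ∀ ℓ e → length (letters ℓ e) ≡ ℓ + e
length-letters ℓ e = trans (length-++ (map just (allFin ℓ)))
  (cong₂ _+_ (trans (length-map just (allFin ℓ)) (length-allFin ℓ)) (length-replicate e))

∑-letters : ∀ ℓ e f → f nothing ≡ 0 → ∑ (letters ℓ e) f ≡ ∑ (allFin ℓ) (f ∘ just)
∑-letters ℓ e f f0 = trans (∑-++ (map just (allFin ℓ)) (replicate e nothing) f)
  (trans (cong₂ _+_ (∑-map just (allFin ℓ) f) (blanks e)) (+-identityʳ _))
  where
  blanks : ∀ e → ∑ (replicate e nothing) f ≡ 0
  blanks zero    = refl
  blanks (suc e) = cong₂ _+_ f0 (blanks e)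

∑-is : ∀ ℓ e (i : Fin ℓ) → ∑ (letters ℓ e) (𝟙 ∘ is i) ≡ 1
∑-is ℓ e i = trans (∑-letters ℓ e (𝟙 ∘ is i) refl) (∑-𝟙≟-one i)

∑-coloured : ∀ ℓ e → ∑ (letters ℓ e) (𝟙 ∘ coloured) ≡ ℓ
∑-coloured ℓ e = trans (∑-letters ℓ e (𝟙 ∘ coloured) refl) (trans (length-as-∑ (allFin ℓ)) (length-allFin ℓ))

∑₂ : List V → (V → V → ℕ) → ℕ
∑₂ ys f = ∑ ys (λ p → ∑ ys (f p))

∑₂-mono : ∀ (ys : List V) {f g} → (∀ p p′ → f p p′ ≤ g p p′) → ∑₂ ys f ≤ ∑₂ ys g
∑₂-mono ys h = ∑-mono ys (λ p → ∑-mono ys (h p))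

∑₂-mono-∈ : ∀ (ys : List V) {f g} → (∀ p p′ → p ∈ ys → p′ ∈ ys → f p p′ ≤ g p p′) → ∑₂ ys f ≤ ∑₂ ys g
∑₂-mono-∈ ys h = ∑-mono-∈ ys (λ p m → ∑-mono-∈ ys (λ p′ → h p p′ m))

∑₂-+ : ∀ (ys : List V) f g → ∑₂ ys (λ p p′ → f p p′ + g p p′) ≡ ∑₂ ys f + ∑₂ ys g
∑₂-+ ys f g = trans (∑-cong ys (λ p → ∑-+ ys (f p) (g p))) (∑-+ ys _ _)

∑-bound-∈ : ∀ (xs : List V) {f} c → (∀ x → x ∈ xs → f x ≤ c) → ∑ xs f ≤ length xs * c
∑-bound-∈ xs c h = ≤-trans (∑-mono-∈ xs h) (≤-reflexive (∑-const xs c))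

𝟙-∧ : ∀ b c → 𝟙 (b ∧ c) ≡ 𝟙 b * 𝟙 c
𝟙-∧ true  c = sym (+-identityʳ _)
𝟙-∧ false c = refl

-- The colour of the pair {y, z} is the entry below the diagonal.
pair-colour : Matrix V ν ν → Fin ν → Fin ν → V
pair-colour M y z = if toℕ z <ᵇ toℕ y then entry M y z else entry M z y

<ᵇ-true : ∀ {m n} → m < n → (m <ᵇ n) ≡ true
<ᵇ-true {m} {n} p with m <ᵇ n | <⇒<ᵇ p
... | true | _ = refl

<ᵇ-false : ∀ {m n} → n ≤ m → (m <ᵇ n) ≡ false
<ᵇ-false {m} {n} p with m <ᵇ n in e
... | false = refl
... | true  = contradiction (<ᵇ⇒< m n (subst T (sym e) _)) (≤⇒≯ p)

pair-colour-sym : ∀ (M : Matrix V ν ν) y z → pair-colour M y z ≡ pair-colour M z y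
pair-colour-sym M y z with <-cmp (toℕ y) (toℕ z)
... | tri< lt _ _ rewrite <ᵇ-false (<⇒≤ lt) | <ᵇ-true lt = refl
... | tri> _ _ gt rewrite <ᵇ-false (<⇒≤ gt) | <ᵇ-true gt = refl
... | tri≈ _ eq _ with toℕ-injective eq
... | refl = refl

pair-colour-≤ : ∀ (M : Matrix (Colour ℓ) ν ν) (P : Colour ℓ → Bool) y z →
                𝟙 (P (pair-colour M y z)) ≤ 𝟙 (P (entry M y z)) + 𝟙 (P (entry M z y))
pair-colour-≤ M P y z with toℕ z <ᵇ toℕ y
... | true  = m≤m+n _ _
... | false = m≤n+m _ _

paths : Matrix (Colour ℓ) ν ν → Fin ℓ → Fin ν → Fin ν → ℕ
paths {ν = ν} M i u v = ∑ (allFin ν) (λ z → 𝟙 (is i (pair-colour M u z) ∧ is i (pair-colour M v z)))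

paths-below : Matrix (Colour ℓ) ν ν → Fin ℓ → Fin ν → Fin ν → ℕ
paths-below {ν = ν} M i u v = ∑ (allFin ν) (λ t → 𝟙 ((toℕ t <ᵇ toℕ u) ∧ ((toℕ t <ᵇ toℕ v) ∧
                                (is i (pair-colour M u t) ∧ is i (pair-colour M v t)))))

paths-sym : ∀ (M : Matrix (Colour ℓ) ν ν) i u v → paths M i u v ≡ paths M i v u
paths-sym M i u v = ∑-cong (allFin _) (λ z → cong 𝟙 (Bool.∧-comm (is i (pair-colour M u z)) (is i (pair-colour M v z))))

paths-below-sym : ∀ (M : Matrix (Colour ℓ) ν ν) i u v → paths-below M i u v ≡ paths-below M i v u
paths-below-sym M i u v = ∑-cong (allFin _) (λ t → cong 𝟙
    (exchange (toℕ t <ᵇ toℕ u) (toℕ t <ᵇ toℕ v) (is i (pair-colour M u t)) (is i (pair-colour M v t))))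
  where
  exchange : ∀ ν b c d → ν ∧ (b ∧ (c ∧ d)) ≡ b ∧ (ν ∧ (d ∧ c))
  exchange ν b c d = trans (sym (Bool.∧-assoc ν b (c ∧ d))) (trans (cong₂ _∧_ (Bool.∧-comm ν b) (Bool.∧-comm c d)) (Bool.∧-assoc b ν (d ∧ c)))

path-∈ : ∀ (M : Matrix (Colour ℓ) ν ν) {i u v} z → pair-colour M u z ≡ just i → pair-colour M v z ≡ just i → paths M i u v ≢ 0
path-∈ M {i} {u} {v} z p q e = contradiction (trans (sym (cong 𝟙 (cong₂ _∧_ (≡⇒is p) (≡⇒is q)))) (∑-zero-∈ e (∈-allFin z))) λ ()

path-below-∈ : ∀ (M : Matrix (Colour ℓ) ν ν) {i u v} t → toℕ t < toℕ u → toℕ t < toℕ v →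
               pair-colour M u t ≡ just i → pair-colour M v t ≡ just i → paths-below M i u v ≢ 0
path-below-∈ M {i} {u} {v} t lt lt′ p q e = contradiction
  (trans (sym (cong 𝟙 (cong₂ _∧_ (<ᵇ-true lt) (cong₂ _∧_ (<ᵇ-true lt′) (cong₂ _∧_ (≡⇒is p) (≡⇒is q)))))) (∑-zero-∈ e (∈-allFin t))) λ ()

-- The square counts the pairs of points of `W` that both have colour i in row z; the sum therefore
-- bounds the paths of length two with both ends in a small set.
RowsSpread ColumnsSpread : Matrix (Colour ℓ) ν ν → ℕ → ℕ → Set
RowsSpread {ℓ} {ν} M w s = ∀ (i : Fin ℓ) (W : Vec (Fin ν) w) →
  ∑ (allFin ν) (λ z → hits (is i) (support W) (lookup M z) * hits (is i) (support W) (lookup M z)) ≤ s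
ColumnsSpread M = RowsSpread (transposed M)

Sparse : Matrix (Colour ℓ) ν ν → ℕ → ℕ → Set
Sparse {ℓ} {ν} M w s = ∀ (U W : Vec (Fin ν) w) → rectangle-hits coloured (support U) (support W) M ≤ s

module _ {ℓ ν w : ℕ} (x₀ : Fin ν) (κ : V → Fin ν) where

  hull : List V → Fin ν → Bool
  hull c = support (pad x₀ (map κ c) w)

  chunk-hits : ∀ c → length c ≤ w → Distinct κ c → ∀ (g : Fin ν → ℕ) →
               ∑ c (g ∘ κ) ≤ ∑ (allFin ν) (λ x → if hull c x then g x else 0)
  chunk-hits c len dist g = ≤-trans (≤-reflexive (∑-fibres κ c g)) (∑-mono (allFin ν) pointwise)
    where
    pointwise : ∀ x → multiplicity κ c x * g x ≤ (if hull c x then g x else 0)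
    pointwise x with multiplicity κ c x in e
    ... | zero  = z≤n
    ... | suc k with ∑-positive c _ (≤-trans (s≤s z≤n) (≤-reflexive (sym e)))
    ... | y , y∈c , pos with κ y ≟ x
    ... | yes refl rewrite pad-support x₀ (map κ c) w (≤-trans (≤-reflexive (length-map κ c)) len) (∈-map⁺ κ y∈c)
                   = ≤-trans (*-monoˡ-≤ (g (κ y)) (≤-trans (≤-reflexive (sym e)) (dist (κ y)))) (≤-reflexive (+-identityʳ _))
    pointwise x | suc k | y , y∈c , () | no _

  module _ (M : Matrix (Colour ℓ) ν ν) (s₂ s₃ : ℕ) (rows : RowsSpread M w s₂) (columns : ColumnsSpread M w s₂) (sparse : Sparse M w s₃) where

    chunk-degree : List V → Fin ℓ → Fin ν → ℕ
    chunk-degree c i z = ∑ c (λ y → 𝟙 (is i (pair-colour M (κ y) z)))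

    -- The colour of {κ y, z} is read in row z or in column z, whichever entry lies below the
    -- diagonal. Counting both entries avoids the distinction and costs the factor 4.
    chunk-paths : ∀ c i → length c ≤ w → Distinct κ c → ∑ (allFin ν) (λ z → chunk-degree c i z * chunk-degree c i z) ≤ 4 * s₂
    chunk-paths c i len dist = begin
      ∑ (allFin ν) (λ z → chunk-degree c i z * chunk-degree c i z)
        ≤⟨ ∑-mono (allFin ν) (λ z → ≤-trans (*-mono-≤ (degree≤ z) (degree≤ z)) ([x+y]²≤2[x²+y²] (in-hits z) (out-hits z))) ⟩
      ∑ (allFin ν) (λ z → 2 * (in-hits z * in-hits z + out-hits z * out-hits z))
        ≡⟨ trans (∑-*ˡ (allFin ν) 2 _) (cong (2 *_) (∑-+ (allFin ν) _ _)) ⟩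
      2 * (∑ (allFin ν) (λ z → in-hits z * in-hits z) + ∑ (allFin ν) (λ z → out-hits z * out-hits z))
        ≤⟨ *-monoʳ-≤ 2 (+-mono-≤ (columns i W) (rows i W)) ⟩
      2 * (s₂ + s₂)
        ≡⟨ sh s₂ ⟩
      4 * s₂ ∎
      where
      open ≤-Reasoning
      W = pad x₀ (map κ c) w
      in-hits out-hits : Fin ν → ℕ
      in-hits z  = hits (is i) (support W) (lookup (transposed M) z)
      out-hits z = hits (is i) (support W) (lookup M z)
      degree≤ : ∀ z → chunk-degree c i z ≤ in-hits z + out-hits z
      degree≤ z = begin
        chunk-degree c i z
          ≤⟨ ∑-mono c (λ y → pair-colour-≤ M (is i) (κ y) z) ⟩
        ∑ c (λ y → 𝟙 (is i (entry M (κ y) z)) + 𝟙 (is i (entry M z (κ y))))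
          ≡⟨ ∑-+ c _ _ ⟩
        ∑ c (λ y → 𝟙 (is i (entry M (κ y) z))) + ∑ c (λ y → 𝟙 (is i (entry M z (κ y))))
          ≤⟨ +-mono-≤ (chunk-hits c len dist (λ x → 𝟙 (is i (entry M x z)))) (chunk-hits c len dist (λ x → 𝟙 (is i (entry M z x)))) ⟩
        ∑ (allFin ν) (λ x → if hull c x then 𝟙 (is i (entry M x z)) else 0) + ∑ (allFin ν) (λ x → if hull c x then 𝟙 (is i (entry M z x)) else 0)
          ≡⟨ cong₂ _+_ (∑-cong (allFin ν) (λ x → trans (if-𝟙 (hull c x) _) (cong (λ u → 𝟙 (hull c x ∧ is i u)) (sym (entry-transposed M x z)))))
                       (∑-cong (allFin ν) (λ x → if-𝟙 (hull c x) _)) ⟩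
        in-hits z + out-hits z ∎
      sh : ∀ s → 2 * (s + s) ≡ 4 * s
      sh = solve-∀

    chunk-sparse : ∀ c c′ → length c ≤ w → Distinct κ c → length c′ ≤ w → Distinct κ c′ →
      ∑ c (λ y → ∑ c′ (λ y′ → 𝟙 (coloured (entry M (κ y) (κ y′))))) ≤ s₃
    chunk-sparse c c′ len dist len′ dist′ = begin
      ∑ c (λ y → ∑ c′ (λ y′ → 𝟙 (coloured (entry M (κ y) (κ y′)))))
        ≤⟨ ∑-mono c (λ y → chunk-hits c′ len′ dist′ (λ x → 𝟙 (coloured (entry M (κ y) x)))) ⟩
      ∑ c (λ y → ∑ (allFin ν) (λ x → if hull c′ x then 𝟙 (coloured (entry M (κ y) x)) else 0))
        ≡⟨ ∑-cong c (λ y → ∑-cong (allFin ν) (λ x → if-𝟙 (hull c′ x) _)) ⟩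
      ∑ c (λ y → hits coloured (hull c′) (lookup M (κ y)))
        ≤⟨ chunk-hits c len dist (λ z → hits coloured (hull c′) (lookup M z)) ⟩
      rectangle-hits coloured (hull c) (hull c′) M
        ≤⟨ sparse (pad x₀ (map κ c) w) (pad x₀ (map κ c′) w) ⟩
      s₃ ∎
      where
      open ≤-Reasoning

    module _ {extra : ℕ} (ys : List V) (chunking : Chunks κ w extra ys) where
      private
        open module C = Chunks chunking using (chunks; sums; short; number)
        t = length chunks

      -- Counted by their middle point, the paths are squared degrees. A degree is the sum of its
      -- parts from the t chunks, so Cauchy-Schwarz loses one factor t and the summation over the
      -- chunks another.
      ∑-paths : ∀ i → ∑₂ ys (λ p p′ → paths M i (κ p) (κ p′)) ≤ t * (t * (4 * s₂))
      ∑-paths i = begin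
        ∑₂ ys (λ p p′ → paths M i (κ p) (κ p′))
          ≡⟨ trans (∑-cong ys (λ p → ∑-swap ys (allFin ν) _)) (∑-swap ys (allFin ν) _) ⟩
        ∑ (allFin ν) (λ z → ∑₂ ys (λ p p′ → 𝟙 (is i (pair-colour M (κ p) z) ∧ is i (pair-colour M (κ p′) z))))
          ≡⟨ ∑-cong (allFin ν) (λ z → trans (∑-cong ys (λ p → ∑-cong ys (λ p′ → 𝟙-∧ (is i (pair-colour M (κ p) z)) _))) (∑-square ys _)) ⟩
        ∑ (allFin ν) (λ z → chunk-degree ys i z * chunk-degree ys i z)
          ≡⟨ ∑-cong (allFin ν) (λ z → cong (λ s → s * s) (sums _)) ⟩
        ∑ (allFin ν) (λ z → ∑ chunks (λ c → chunk-degree c i z) * ∑ chunks (λ c → chunk-degree c i z))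
          ≤⟨ ∑-mono (allFin ν) (λ z → cauchy-schwarz chunks (λ c → chunk-degree c i z)) ⟩
        ∑ (allFin ν) (λ z → t * ∑ chunks (λ c → chunk-degree c i z * chunk-degree c i z))
          ≡⟨ trans (∑-*ˡ (allFin ν) t _) (cong (t *_) (∑-swap (allFin ν) chunks _)) ⟩
        t * ∑ chunks (λ c → ∑ (allFin ν) (λ z → chunk-degree c i z * chunk-degree c i z))
          ≤⟨ *-monoʳ-≤ t (∑-bound-∈ chunks (4 * s₂) (λ c c∈ → let (len , dist) = All.lookup short c∈ in chunk-paths c i len dist)) ⟩
        t * (t * (4 * s₂)) ∎
        where open ≤-Reasoning

      ∑-coloured-pairs : ∑₂ ys (λ p p′ → 𝟙 (coloured (pair-colour M (κ p) (κ p′)))) ≤ t * (t * (2 * s₃))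
      ∑-coloured-pairs = begin
        ∑₂ ys (λ p p′ → 𝟙 (coloured (pair-colour M (κ p) (κ p′))))
          ≤⟨ ∑₂-mono ys (λ p p′ → pair-colour-≤ M coloured (κ p) (κ p′)) ⟩
        ∑₂ ys (λ p p′ → f p p′ + f p′ p)
          ≡⟨ trans (∑₂-+ ys f (λ p p′ → f p′ p)) (cong (∑₂ ys f +_) (∑-swap ys ys (λ p p′ → f p′ p))) ⟩
        ∑₂ ys f + ∑₂ ys f
          ≤⟨ +-mono-≤ half half ⟩
        t * (t * s₃) + t * (t * s₃)
          ≡⟨ sh t s₃ ⟩
        t * (t * (2 * s₃)) ∎
        where
        open ≤-Reasoning
        f : V → V → ℕ
        f p p′ = 𝟙 (coloured (entry M (κ p) (κ p′)))
        half : ∑₂ ys f ≤ t * (t * s₃)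
        half = ≤-trans (≤-reflexive (trans (sums _) (∑-cong chunks (λ c → trans (∑-cong c (λ p → sums (f p))) (∑-swap c chunks (λ p c′ → ∑ c′ (f p)))))))
          (∑-bound-∈ chunks (t * s₃) (λ c c∈ → ∑-bound-∈ chunks s₃ (λ c′ c′∈ →
            let (len , dist) = All.lookup short c∈ ; (len′ , dist′) = All.lookup short c′∈ in chunk-sparse c c′ len dist len′ dist′)))
        sh : ∀ t s → t * (t * s) + t * (t * s) ≡ t * (t * (2 * s))
        sh = solve-∀

-- Surviving edges

∧-true : ∀ b {c} → b ∧ c ≡ true → b ≡ true × c ≡ true
∧-true true e = refl , e

𝟙-positive : ∀ b → 1 ≤ 𝟙 b → b ≡ true
𝟙-positive true _ = refl

≡ᵇ0⇒≡0 : ∀ {n} → (n ≡ᵇ 0) ≡ true → n ≡ 0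
≡ᵇ0⇒≡0 {zero} _ = refl

does≡true⇒ : ∀ {P : Set} (P? : Dec P) → does P? ≡ true → P
does≡true⇒ (yes p) _ = p

does⇒≡ : ∀ {n} {x y : Fin n} → does (x ≟ y) ≡ true → x ≡ y
does⇒≡ {x = x} {y} = does≡true⇒ (x ≟ y)

-- The edges that survive: {x, x′} has colour i in M, the pair is blank in the other matrix N, and neither N
-- nor the part of M below both ends joins it by a path of colour i.
record Link (M N : Matrix (Colour ℓ) ν ν) (i : Fin ℓ) (x x′ y y′ : Fin ν) : Set where
  constructor link
  field
    own-colour   : pair-colour M x x′ ≡ just i
    other-blank  : pair-colour N y y′ ≡ nothing
    ends-differ  : x ≢ x′
    no-own-path  : paths-below M i x x′ ≡ 0
    no-other-path : paths N i y y′ ≡ 0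

open-condition : Matrix (Colour ℓ) ν ν → Fin ℓ → Fin ν → Fin ν → Bool
open-condition N i y y′ = not (coloured (pair-colour N y y′)) ∧ (paths N i y y′ ≡ᵇ 0)

-- Exposure is indexed by points, the condition on `N` by vertices: a pair of points is eligible if
-- some pair of vertices of `ys` above it satisfies the condition.
eligible-pair : Matrix (Colour ℓ) ν ν → (V → Fin ν) → (V → Fin ν) → Fin ℓ → List V → Fin ν → Fin ν → Bool
eligible-pair N κ μ i ys y z = 1 ≤ᵇ ∑₂ ys (λ p p′ → 𝟙 (does (κ p ≟ y) ∧ (does (κ p′ ≟ z) ∧ open-condition N i (μ p) (μ p′))))

module Expose {V : Set} {ℓ ν : ℕ} (e : ℕ) (N : Matrix (Colour ℓ) ν ν) (κ μ : V → Fin ν) (i : Fin ℓ) (ys : List V) =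
  Exposure (letters ℓ e) nothing (is i) (∑-is ℓ e i) ν (eligible-pair N κ μ i ys)

missed : ∀ {V : Set} {ℓ ν} → ℕ → ℕ → (M N : Matrix (Colour ℓ) ν ν) (κ μ : V → Fin ν) → Fin ℓ → List V → Bool
missed e N₀ M N κ μ i ys = (N₀ ≤ᵇ Expose.open-pairs e N κ μ i ys M) ∧ (Expose.open-hits e N κ μ i ys M ≡ᵇ 0)

module OpenPairs {V : Set} {ℓ ν : ℕ} (e : ℕ) (M N : Matrix (Colour ℓ) ν ν) (κ μ : V → Fin ν) (i : Fin ℓ) (ys : List V) where
  open Expose e N κ μ i ys

  eligible⇒ : ∀ {y z} → eligible-pair N κ μ i ys y z ≡ true →
    ∃[ p ] ∃[ p′ ] (p ∈ ys × p′ ∈ ys × κ p ≡ y × κ p′ ≡ z × open-condition N i (μ p) (μ p′) ≡ true)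
  eligible⇒ h with ∑-positive ys _ (≤ᵇ-dec 1 _ h)
  ... | p , p∈ , h₁ with ∑-positive ys _ h₁
  ... | p′ , p′∈ , h₂ with ∧-true _ (𝟙-positive _ h₂)
  ... | e₁ , h₃ with ∧-true _ h₃
  ... | e₂ , h₄ = p , p′ , p∈ , p′∈ , does⇒≡ e₁ , does⇒≡ e₂ , h₄

  ⇒eligible : ∀ {p p′} → p ∈ ys → p′ ∈ ys → open-condition N i (μ p) (μ p′) ≡ true → eligible-pair N κ μ i ys (κ p) (κ p′) ≡ true
  ⇒eligible {p} {p′} p∈ p′∈ h = 1≤⇒ (≤-trans (≤-trans (≤-reflexive (cong 𝟙 (sym
      (cong₂ _∧_ (dec-true (κ p ≟ κ p) refl) (cong₂ _∧_ (dec-true (κ p′ ≟ κ p′) refl) h)))))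
      (∑-∈ p′∈ _)) (∑-∈ p∈ _))
    where
    1≤⇒ : ∀ {n} → 1 ≤ n → (1 ≤ᵇ n) ≡ true
    1≤⇒ {suc n} _ = refl

  open-hit⇒link : 1 ≤ open-hits M → ∃[ p ] ∃[ p′ ] (p ∈ ys × p′ ∈ ys × Link M N i (κ p) (κ p′) (μ p) (μ p′))
  open-hit⇒link h with ∑-positive (allFin ν) _ h
  ... | y , _ , h₁ with ∑-positive (allFin ν) _ h₁
  ... | z , _ , h₂ with ∧-true (open-at y z M) (𝟙-positive _ h₂)
  ... | h₃ , col with ∧-true (toℕ z <ᵇ toℕ y) h₃
  ... | z<ᵇy , h₄ with ∧-true (eligible-pair N κ μ i ys y z) h₄
  ... | el , com with eligible⇒ el
  ... | p , p′ , p∈ , p′∈ , refl , refl , h₅ with ∧-true (not (coloured (pair-colour N (μ p) (μ p′)))) h₅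
  ... | bl , pa = p , p′ , p∈ , p′∈ ,
        link (trans (cong (λ b → if b then entry M (κ p) (κ p′) else entry M (κ p′) (κ p)) z<ᵇy) (is⇒≡ i _ col))
             (blank _ bl) (λ eq → <-irrefl (cong toℕ (sym eq)) z<y) below (≡ᵇ0⇒≡0 pa)
    where
    z<y : toℕ (κ p′) < toℕ (κ p)
    z<y = <ᵇ⇒< _ _ (subst T (sym z<ᵇy) _)
    blank : ∀ (c : Colour ℓ) → not (coloured c) ≡ true → c ≡ nothing
    blank nothing _ = refl
    below : paths-below M i (κ p) (κ p′) ≡ 0
    below = n≤0⇒n≡0 (≤-trans (∑-mono (allFin ν) pointwise) (≤-reflexive (≡ᵇ0⇒≡0 com)))
      where
      pointwise : ∀ t → 𝟙 ((toℕ t <ᵇ toℕ (κ p)) ∧ ((toℕ t <ᵇ toℕ (κ p′)) ∧ (is i (pair-colour M (κ p) t) ∧ is i (pair-colour M (κ p′) t))))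
                      ≤ 𝟙 ((toℕ t <ᵇ toℕ (κ p′)) ∧ (is i (entry M (κ p) t) ∧ is i (entry M (κ p′) t)))
      pointwise t with toℕ t <ᵇ toℕ (κ p)
      ... | false = z≤n
      ... | true with toℕ t <ᵇ toℕ (κ p′)
      ... | true  = ≤-refl
      ... | false = z≤n

  common-below≤paths : ∀ y z → toℕ z < toℕ y → common-below z (lookup M y) (lookup M z) ≤ paths M i y z
  common-below≤paths y z z<y = ∑-mono (allFin ν) pointwise
    where
    pointwise : ∀ t → 𝟙 ((toℕ t <ᵇ toℕ z) ∧ (is i (entry M y t) ∧ is i (entry M z t))) ≤ 𝟙 (is i (pair-colour M y t) ∧ is i (pair-colour M z t))
    pointwise t with toℕ t <ᵇ toℕ z in eq
    ... | false = z≤n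
    ... | true rewrite <ᵇ-true (<-trans (<ᵇ⇒< (toℕ t) (toℕ z) (subst T (sym eq) _)) z<y) = ≤-refl

  -- There are only three ways not to be open: `N` colours the pair, `N` joins it by a path, or `M`
  -- does. Each makes one of the other summands positive.
  pair≤ : ∀ {p p′} → p ∈ ys → p′ ∈ ys → 𝟙 (toℕ (κ p′) <ᵇ toℕ (κ p)) ≤
    𝟙 (open-at (κ p) (κ p′) M) + (𝟙 (coloured (pair-colour N (μ p) (μ p′))) + (paths N i (μ p) (μ p′) + paths M i (κ p) (κ p′)))
  pair≤ {p} {p′} p∈ p′∈ with toℕ (κ p′) <ᵇ toℕ (κ p) in lt
  ... | false = z≤n
  ... | true with coloured (pair-colour N (μ p) (μ p′)) in ec | paths N i (μ p) (μ p′) in ep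
  ... | true  | _     = ≤-trans (s≤s z≤n) (m≤n+m _ (𝟙 (eligible-pair N κ μ i ys (κ p) (κ p′) ∧ (common-below (κ p′) (lookup M (κ p)) (lookup M (κ p′)) ≡ᵇ 0))))
  ... | false | suc k = ≤-trans (s≤s z≤n) (m≤n+m (suc k + paths M i (κ p) (κ p′)) _)
  ... | false | zero with common-below (κ p′) (lookup M (κ p)) (lookup M (κ p′)) in eb
  ... | zero rewrite ⇒eligible p∈ p′∈ (cong₂ _∧_ (cong not ec) (cong (_≡ᵇ 0) ep)) = s≤s z≤n
  ... | suc k = ≤-trans (≤-trans (≤-trans (s≤s z≤n) (≤-reflexive (sym eb)))
                  (common-below≤paths (κ p) (κ p′) (<ᵇ⇒< (toℕ (κ p′)) (toℕ (κ p)) (subst T (sym lt) _)))) (m≤n+m _ _)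

  ordered-pairs : ℕ
  ordered-pairs = ∑₂ ys (λ p p′ → 𝟙 (toℕ (κ p′) <ᵇ toℕ (κ p)))

  square≤ordered-pairs : Distinct κ ys → length ys * length ys ≤ ordered-pairs + ordered-pairs + length ys
  square≤ordered-pairs dist = begin
    length ys * length ys
      ≡⟨ sym (trans (∑-cong ys (λ _ → length-as-∑ ys)) (∑-const ys (length ys))) ⟩
    ∑₂ ys (λ _ _ → 1)
      ≤⟨ ∑₂-mono ys trichotomy ⟩
    ∑₂ ys (λ p p′ → 𝟙 (toℕ (κ p′) <ᵇ toℕ (κ p)) + 𝟙 (toℕ (κ p) <ᵇ toℕ (κ p′)) + 𝟙 (does (κ p′ ≟ κ p)))
      ≡⟨ trans (∑₂-+ ys _ _) (cong (_+ ∑ ys (λ p → multiplicity κ ys (κ p))) (∑₂-+ ys _ _)) ⟩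
    ordered-pairs + ∑₂ ys (λ p p′ → 𝟙 (toℕ (κ p) <ᵇ toℕ (κ p′))) + ∑ ys (λ p → multiplicity κ ys (κ p))
      ≤⟨ +-mono-≤ (≤-reflexive (cong (ordered-pairs +_) (∑-swap ys ys (λ p p′ → 𝟙 (toℕ (κ p) <ᵇ toℕ (κ p′))))))
                  (≤-trans (∑-bound ys 1 (λ p → dist (κ p))) (≤-reflexive (*-identityʳ _))) ⟩
    ordered-pairs + ordered-pairs + length ys ∎
    where
    open ≤-Reasoning
    trichotomy : ∀ p p′ → 1 ≤ 𝟙 (toℕ (κ p′) <ᵇ toℕ (κ p)) + 𝟙 (toℕ (κ p) <ᵇ toℕ (κ p′)) + 𝟙 (does (κ p′ ≟ κ p))
    trichotomy p p′ with <-cmp (toℕ (κ p)) (toℕ (κ p′))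
    ... | tri< lt _ _ rewrite <ᵇ-true lt = ≤-trans (m≤n+m 1 (𝟙 (toℕ (κ p′) <ᵇ toℕ (κ p)))) (m≤m+n _ _)
    ... | tri> _ _ gt rewrite <ᵇ-true gt = s≤s z≤n
    ... | tri≈ _ eq _ = ≤-trans (≤-reflexive (cong 𝟙 (sym (dec-true (κ p′ ≟ κ p) (sym (toℕ-injective eq)))))) (m≤n+m _ _)

  open-∑₂≤ : Distinct κ ys → ∑₂ ys (λ p p′ → 𝟙 (open-at (κ p) (κ p′) M)) ≤ open-pairs M
  open-∑₂≤ dist = ≤-trans (∑-mono ys (λ p → ∑-distinct κ ys (λ z → 𝟙 (open-at (κ p) z M)) dist))
    (∑-distinct κ ys (λ y → ∑ (allFin ν) (λ z → 𝟙 (open-at y z M))) dist)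

  ordered-pairs≤ : Distinct κ ys → ordered-pairs ≤ open-pairs M +
    (∑₂ ys (λ p p′ → 𝟙 (coloured (pair-colour N (μ p) (μ p′)))) +
      (∑₂ ys (λ p p′ → paths N i (μ p) (μ p′)) + ∑₂ ys (λ p p′ → paths M i (κ p) (κ p′))))
  ordered-pairs≤ dist = ≤-trans (∑₂-mono-∈ ys (λ p p′ → pair≤ {p} {p′}))
    (≤-trans (≤-reflexive (trans (∑₂-+ ys _ _) (cong₂ _+_ refl (trans (∑₂-+ ys _ _) (cong₂ _+_ refl (∑₂-+ ys _ _))))))
      (+-monoˡ-≤ _ (open-∑₂≤ dist)))

few-chunks : ∀ t w m s c → t * w ≤ 2 * m → c * s * 64 ≤ w * w → c * (t * (t * s)) * 16 ≤ m * m
few-chunks t w m s c tw cs = *-cancelˡ-≤ 4 (begin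
  4 * (c * (t * (t * s)) * 16) ≡⟨ sh₁ t s c ⟩
  t * t * (c * s * 64) ≤⟨ *-monoʳ-≤ (t * t) cs ⟩
  t * t * (w * w) ≡⟨ sh₂ t w ⟩
  t * w * (t * w) ≤⟨ *-mono-≤ tw tw ⟩
  2 * m * (2 * m) ≡⟨ sh₃ m ⟩
  4 * (m * m)                      ∎)
  where
  open ≤-Reasoning
  sh₁ : ∀ t s c → 4 * (c * (t * (t * s)) * 16) ≡ t * t * (c * s * 64)
  sh₁ = solve-∀
  sh₂ : ∀ t w → t * t * (w * w) ≡ t * w * (t * w)
  sh₂ = solve-∀
  sh₃ : ∀ m → 2 * m * (2 * m) ≡ 4 * (m * m)
  sh₃ = solve-∀

module HalfHitting {V : Set} {ℓ ν : ℕ} (e : ℕ) (M N : Matrix (Colour ℓ) ν ν) (x₀ : Fin ν) (κ μ : V → Fin ν)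
  (w m d N₀ s₂ s₃ : ℕ) (1≤w : 1 ≤ w) (w≤m : w ≤ m) (dw≤m : d * w ≤ m) (4≤m : 4 ≤ m)
  (s₂-small : 4 * s₂ * 64 ≤ w * w) (s₃-small : 2 * s₃ * 128 ≤ w * w) (N₀-small : 8 * N₀ ≤ m * m)
  (M-rows : RowsSpread M w s₂) (M-columns : ColumnsSpread M w s₂) (M-sparse : Sparse M w s₃)
  (N-rows : RowsSpread N w s₂) (N-columns : ColumnsSpread N w s₂) (N-sparse : Sparse N w s₃)
  where

  half-hitting : ∀ i (ys : List V) → length ys ≡ m → Distinct κ ys → (∀ x → multiplicity μ ys x ≤ d) →
    missed e N₀ M N κ μ i ys ≡ false →
    ∃[ p ] ∃[ p′ ] (p ∈ ys × p′ ∈ ys × Link M N i (κ p) (κ p′) (μ p) (μ p′))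
  half-hitting i ys len dist mult not-missed = open-hit⇒link hits≥1
    where
    open OpenPairs e M N κ μ i ys
    open Expose e N κ μ i ys using (open-pairs; open-hits)
    own   = pieces κ w (length ys) ys 1≤w ≤-refl dist
    other = chunks-of μ w d ys 1≤w mult
    t  = length (Chunks.chunks own)
    t′ = length (Chunks.chunks other)
    2m : ∀ x → x ≤ m → length ys + x ≤ 2 * m
    2m x x≤m = ≤-trans (+-mono-≤ (≤-reflexive len) x≤m) (≤-reflexive (cong (m +_) (sym (+-identityʳ m))))
    Sc = ∑₂ ys (λ p p′ → 𝟙 (coloured (pair-colour N (μ p) (μ p′))))
    SN = ∑₂ ys (λ p p′ → paths N i (μ p) (μ p′))
    SM = ∑₂ ys (λ p p′ → paths M i (κ p) (κ p′))
    SM≤ : SM * 16 ≤ m * m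
    SM≤ = ≤-trans (*-monoˡ-≤ 16 (∑-paths x₀ κ M s₂ s₃ M-rows M-columns M-sparse ys own i))
      (≤-trans (≤-reflexive (sh t s₂)) (few-chunks t w m s₂ 4 (≤-trans (Chunks.number own) (2m w w≤m)) s₂-small))
      where
      sh : ∀ t s → t * (t * (4 * s)) * 16 ≡ 4 * (t * (t * s)) * 16
      sh = solve-∀
    SN≤ : SN * 16 ≤ m * m
    SN≤ = ≤-trans (*-monoˡ-≤ 16 (∑-paths x₀ μ N s₂ s₃ N-rows N-columns N-sparse ys other i))
      (≤-trans (≤-reflexive (sh t′ s₂)) (few-chunks t′ w m s₂ 4 (≤-trans (Chunks.number other) (2m (d * w) dw≤m)) s₂-small))
      where
      sh : ∀ t s → t * (t * (4 * s)) * 16 ≡ 4 * (t * (t * s)) * 16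
      sh = solve-∀
    Sc≤ : Sc * 32 ≤ m * m
    Sc≤ = ≤-trans (*-monoˡ-≤ 32 (∑-coloured-pairs x₀ μ N s₂ s₃ N-rows N-columns N-sparse ys other))
      (≤-trans (≤-reflexive (sh t′ s₃)) (few-chunks t′ w m s₃ 4 (≤-trans (Chunks.number other) (2m (d * w) dw≤m))
        (≤-trans (≤-reflexive (sh₂ s₃)) s₃-small)))
      where
      sh : ∀ t s → t * (t * (2 * s)) * 32 ≡ 4 * (t * (t * s)) * 16
      sh = solve-∀
      sh₂ : ∀ s → 4 * s * 64 ≡ 2 * s * 128
      sh₂ = solve-∀
    -- The m² pairs are twice the ordered ones plus at most m ≤ m²/4. The three losses are at most
    -- m²/32, m²/16 and m²/16, so fewer than N₀ ≤ m²/8 open pairs would give 32 m² ≤ 26 m².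
    enough : N₀ ≤ open-pairs M
    enough = ≮⇒≥ λ few → <-irrefl refl (begin-strict
      32 * (m * m) ≤⟨ *-monoʳ-≤ 32 (subst (λ l → l * l ≤ X + X + l) len (square≤ordered-pairs dist)) ⟩
      32 * (X + X + m) ≡⟨ sh₁ X m ⟩
      64 * X + 32 * m ≤⟨ +-monoˡ-≤ (32 * m) (*-monoʳ-≤ 64 (ordered-pairs≤ dist)) ⟩
      64 * (O + (Sc + (SN + SM))) + 32 * m ≡⟨ sh₂ O Sc SN SM m ⟩
      8 * (8 * O) + (2 * (Sc * 32) + (4 * (SN * 16) + 4 * (SM * 16))) + 32 * m
        ≤⟨ +-mono-≤ (+-mono-≤ (*-monoʳ-≤ 8 (≤-trans (*-monoʳ-≤ 8 (<⇒≤ few)) N₀-small))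
                              (+-mono-≤ (*-monoʳ-≤ 2 Sc≤) (+-mono-≤ (*-monoʳ-≤ 4 SN≤) (*-monoʳ-≤ 4 SM≤))))
                    (*-monoʳ-≤ 8 (*-monoˡ-≤ m 4≤m) |> λ h → ≤-trans (≤-reflexive (sh₃ m)) h) ⟩
      8 * (m * m) + (2 * (m * m) + (4 * (m * m) + 4 * (m * m))) + 8 * (m * m)
        ≡⟨ sh₄ (m * m) ⟩
      26 * (m * m) <⟨ *-monoˡ-< (m * m) {{>-nonZero (*-mono-≤ 1≤m 1≤m)}} (m≤m+n 27 5) ⟩
      32 * (m * m)                                            ∎)
      where
      open ≤-Reasoning
      X = ordered-pairs
      O = open-pairs M
      1≤m : 1 ≤ m
      1≤m = ≤-trans (s≤s z≤n) 4≤m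
      sh₁ : ∀ X m → 32 * (X + X + m) ≡ 64 * X + 32 * m
      sh₁ = solve-∀
      sh₂ : ∀ O c s t m → 64 * (O + (c + (s + t))) + 32 * m ≡ 8 * (8 * O) + (2 * (c * 32) + (4 * (s * 16) + 4 * (t * 16))) + 32 * m
      sh₂ = solve-∀
      sh₃ : ∀ m → 32 * m ≡ 8 * (4 * m)
      sh₃ = solve-∀
      sh₄ : ∀ x → 8 * x + (2 * x + (4 * x + 4 * x)) + 8 * x ≡ 26 * x
      sh₄ = solve-∀
    hits≥1 : 1 ≤ open-hits M
    hits≥1 = n≢0⇒n>0 λ none → contradiction (trans (sym (both-true (≤⇒≤ᵇ-true enough) (cong (_≡ᵇ 0) none))) not-missed) λ ()
      where
      ≤⇒≤ᵇ-true : ∀ {m n} → m ≤ n → (m ≤ᵇ n) ≡ true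
      ≤⇒≤ᵇ-true {m} {n} p with m ≤ᵇ n | ≤⇒≤ᵇ p
      ... | true | _ = refl
      both-true : ∀ {b c} → b ≡ true → c ≡ true → b ∧ c ≡ true
      both-true refl refl = refl

-- Assembling the packing from two matrices

keeps : Matrix (Colour ℓ) ν ν → Matrix (Colour ℓ) ν ν → Fin ν → Fin ν → Fin ν → Fin ν → Fin ℓ → Bool
keeps M N x x′ y y′ i = not (does (x ≟ x′)) ∧ ((paths-below M i x x′ ≡ᵇ 0) ∧ (paths N i y y′ ≡ᵇ 0))

-- Pairs coloured by both matrices are dropped, so each surviving colour comes from exactly one
-- matrix and meets a blank in the other.
pick : Colour ℓ → Colour ℓ → (Fin ℓ → Bool) → (Fin ℓ → Bool) → Colour ℓ
pick (just i) nothing  k k′ = if k i then just i else nothing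
pick nothing  (just i) k k′ = if k′ i then just i else nothing
pick (just _) (just _) k k′ = nothing
pick nothing  nothing  k k′ = nothing

pick-cong : ∀ (c c′ : Colour ℓ) {k k₁ k′ k₁′} → (∀ i → k i ≡ k₁ i) → (∀ i → k′ i ≡ k₁′ i) → pick c c′ k k′ ≡ pick c c′ k₁ k₁′
pick-cong (just i) nothing  h h′ = cong (λ b → if b then just i else nothing) (h i)
pick-cong nothing  (just i) h h′ = cong (λ b → if b then just i else nothing) (h′ i)
pick-cong (just _) (just _) h h′ = refl
pick-cong nothing  nothing  h h′ = refl

pick-none : ∀ (c c′ : Colour ℓ) → pick c c′ (λ _ → false) (λ _ → false) ≡ nothing
pick-none (just _) nothing  = refl
pick-none nothing  (just _) = refl
pick-none (just _) (just _) = refl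
pick-none nothing  nothing  = refl

pick⇒ : ∀ (c c′ : Colour ℓ) k k′ i → pick c c′ k k′ ≡ just i →
        (c ≡ just i × c′ ≡ nothing × k i ≡ true) ⊎ (c′ ≡ just i × c ≡ nothing × k′ i ≡ true)
pick⇒ (just j) nothing  k k′ i e with k j in kj
pick⇒ (just j) nothing  k k′ i refl | true = inj₁ (refl , refl , kj)
pick⇒ nothing  (just j) k k′ i e with k′ j in kj
pick⇒ nothing  (just j) k k′ i refl | true = inj₂ (refl , refl , kj)

∑-filterᵇ : ∀ (p : V → Bool) xs f → ∑ (filterᵇ p xs) f ≡ ∑ xs (λ x → if p x then f x else 0)
∑-filterᵇ p []       f = refl
∑-filterᵇ p (x ∷ xs) f with p x
... | true  = cong (f x +_) (∑-filterᵇ p xs f)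
... | false = ∑-filterᵇ p xs f

∈-filterᵇ⇒ : ∀ (p : V → Bool) xs {x} → x ∈ filterᵇ p xs → p x ≡ true
∈-filterᵇ⇒ p (y ∷ xs) m with p y in e
∈-filterᵇ⇒ p (y ∷ xs) (here refl) | true = e
∈-filterᵇ⇒ p (y ∷ xs) (there m)   | true = ∈-filterᵇ⇒ p xs m
∈-filterᵇ⇒ p (y ∷ xs) m           | false = ∈-filterᵇ⇒ p xs m

⇒∈-filterᵇ : ∀ (p : V → Bool) {xs x} → x ∈ xs → p x ≡ true → x ∈ filterᵇ p xs
⇒∈-filterᵇ p {y ∷ xs} (here refl) e rewrite e = here refl
⇒∈-filterᵇ p {y ∷ xs} (there m)   e with p y
... | true  = there (⇒∈-filterᵇ p m e)
... | false = ⇒∈-filterᵇ p m e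

-- The smallest of the three points lies below the other two and joins them by a path. So it
-- suffices that `Link` forbids paths from below, the only ones known when an entry is exposed.
no-own-triangle : ∀ (M N : Matrix (Colour ℓ) ν ν) {i x y z x′ y′ z′} →
  Link M N i x y x′ y′ → Link M N i y z y′ z′ → Link M N i x z x′ z′ → ⊥
no-own-triangle M N {i} {x} {y} {z} (link xy _ x≢y bxy _) (link yz _ y≢z byz _) (link xz _ x≢z bxz _) = cases
  where
  swapped : ∀ {u v} → pair-colour M u v ≡ just i → pair-colour M v u ≡ just i
  swapped {u} {v} = trans (pair-colour-sym M v u)
  below : ∀ {u v} → u ≢ v → ¬ toℕ v < toℕ u → toℕ u < toℕ v
  below {u} {v} u≢v v≮u = ≤∧≢⇒< (≮⇒≥ v≮u) (u≢v ∘ toℕ-injective)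
  cases : ⊥
  cases with toℕ x <? toℕ y
  ... | yes x<y with toℕ x <? toℕ z
  ...   | yes x<z = path-below-∈ M x x<y x<z (swapped xy) (swapped xz) byz
  ...   | no x≮z  = path-below-∈ M z (below (x≢z ∘ sym) x≮z) (<-trans (below (x≢z ∘ sym) x≮z) x<y) xz yz bxy
  cases | no x≮y with toℕ y <? toℕ z
  ...   | yes y<z = path-below-∈ M y (below (x≢y ∘ sym) x≮y) y<z xy (swapped yz) bxz
  ...   | no y≮z  = path-below-∈ M z (<-trans (below (y≢z ∘ sym) y≮z) (below (x≢y ∘ sym) x≮y)) (below (y≢z ∘ sym) y≮z) xz yz bxy

-- The two edges from `M` form a path across the edge from `N`. Here every middle point can be
-- forbidden, because one matrix is kept fixed while the other is exposed.
no-mixed-triangle : ∀ (M N : Matrix (Colour ℓ) ν ν) {i x y z x′ y′} →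
  Link N M i x′ y′ x y → pair-colour M x z ≡ just i → pair-colour M y z ≡ just i → ⊥
no-mixed-triangle M N {z = z} l p q = path-∈ M z p q (Link.no-other-path l)

module Assemble {ℓ ν n : ℕ} (e : ℕ) (A B : Matrix (Colour ℓ) ν ν) (α β : Fin n → Fin ν) where

  colour : Fin n → Fin n → Colour ℓ
  colour u v = pick (pair-colour A (α u) (α v)) (pair-colour B (β u) (β v))
                    (keeps A B (α u) (α v) (β u) (β v)) (keeps B A (β u) (β v) (α u) (α v))

  keeps-sym : ∀ (M N : Matrix (Colour ℓ) ν ν) x x′ y y′ i → keeps M N x x′ y y′ i ≡ keeps M N x′ x y′ y i
  keeps-sym M N x x′ y y′ i = cong₂ _∧_ (cong not (does-sym _≟_ x x′))
    (cong₂ (λ s t → (s ≡ᵇ 0) ∧ (t ≡ᵇ 0)) (paths-below-sym M i x x′) (paths-sym N i y y′))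

  colour-sym : ∀ u v → colour u v ≡ colour v u
  colour-sym u v = trans
    (cong₂ (λ c c′ → pick c c′ (keeps A B (α u) (α v) (β u) (β v)) (keeps B A (β u) (β v) (α u) (α v)))
      (pair-colour-sym A (α u) (α v)) (pair-colour-sym B (β u) (β v)))
    (pick-cong (pair-colour A (α v) (α u)) (pair-colour B (β v) (β u))
      (keeps-sym A B (α u) (α v) (β u) (β v)) (keeps-sym B A (β u) (β v) (α u) (α v)))

  colour-loop : ∀ u → colour u u ≡ nothing
  colour-loop u = trans (pick-cong (pair-colour A (α u) (α u)) (pair-colour B (β u) (β u))
      (no-loop A B (α u) (β u)) (no-loop B A (β u) (α u))) (pick-none (pair-colour A (α u) (α u)) (pair-colour B (β u) (β u)))
    where
    no-loop : ∀ M N x y i → keeps M N x x y y i ≡ false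
    no-loop M N x y i = cong (λ b → not b ∧ ((paths-below M i x x ≡ᵇ 0) ∧ (paths N i y y ≡ᵇ 0))) (dec-true (x ≟ x) refl)

  LinkA LinkB : Fin ℓ → Fin n → Fin n → Set
  LinkA i u v = Link A B i (α u) (α v) (β u) (β v)
  LinkB i u v = Link B A i (β u) (β v) (α u) (α v)

  keeps⇒link : ∀ (M N : Matrix (Colour ℓ) ν ν) {x x′ y y′ i} → pair-colour M x x′ ≡ just i →
               pair-colour N y y′ ≡ nothing → keeps M N x x′ y y′ i ≡ true → Link M N i x x′ y y′
  keeps⇒link M N {x} {x′} c b k with ∧-true (not (does (x ≟ x′))) k
  ... | ne , k′ with ∧-true _ k′
  ... | p , q = link c b (λ eq → contradiction (trans (sym ne) (cong not (dec-true (x ≟ x′) eq))) λ ()) (≡ᵇ0⇒≡0 p) (≡ᵇ0⇒≡0 q)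

  colour⇒link : ∀ u v {i} → colour u v ≡ just i → LinkA i u v ⊎ LinkB i u v
  colour⇒link u v {i} h with pick⇒ (pair-colour A (α u) (α v)) (pair-colour B (β u) (β v)) _ _ i h
  ... | inj₁ (c , b , k) = inj₁ (keeps⇒link A B c b k)
  ... | inj₂ (c , b , k) = inj₂ (keeps⇒link B A c b k)

  link⇒keeps : ∀ (M N : Matrix (Colour ℓ) ν ν) {i x x′ y y′} → Link M N i x x′ y y′ → keeps M N x x′ y y′ i ≡ true
  link⇒keeps M N {x = x} {x′} (link c b ne p q) rewrite dec-false (x ≟ x′) ne | p | q = refl

  linkA⇒colour : ∀ {i u v} → LinkA i u v → colour u v ≡ just i
  linkA⇒colour l rewrite Link.own-colour l | Link.other-blank l | link⇒keeps A B l = refl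

  linkB⇒colour : ∀ {i u v} → LinkB i u v → colour u v ≡ just i
  linkB⇒colour l rewrite Link.own-colour l | Link.other-blank l | link⇒keeps B A l = refl

  colour-no-mono : ∀ u v w i → colour u v ≡ just i → colour v w ≡ just i → colour u w ≡ just i → ⊥
  colour-no-mono u v w i uv vw uw with colour⇒link u v uv | colour⇒link v w vw | colour⇒link u w uw
  ... | inj₁ l₁ | inj₁ l₂ | inj₁ l₃ = no-own-triangle A B l₁ l₂ l₃
  ... | inj₂ l₁ | inj₂ l₂ | inj₂ l₃ = no-own-triangle B A l₁ l₂ l₃
  ... | inj₂ l₁ | inj₁ l₂ | inj₁ l₃ = no-mixed-triangle A B l₁ (Link.own-colour l₃) (Link.own-colour l₂)
  ... | inj₁ l₁ | inj₂ l₂ | inj₂ l₃ = no-mixed-triangle B A l₁ (Link.own-colour l₃) (Link.own-colour l₂)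
  ... | inj₁ l₁ | inj₂ l₂ | inj₁ l₃ = no-mixed-triangle A B l₂ (trans (pair-colour-sym A (α v) (α u)) (Link.own-colour l₁)) (trans (pair-colour-sym A (α w) (α u)) (Link.own-colour l₃))
  ... | inj₂ l₁ | inj₁ l₂ | inj₂ l₃ = no-mixed-triangle B A l₂ (trans (pair-colour-sym B (β v) (β u)) (Link.own-colour l₁)) (trans (pair-colour-sym B (β w) (β u)) (Link.own-colour l₃))
  ... | inj₁ l₁ | inj₁ l₂ | inj₂ l₃ = no-mixed-triangle A B l₃ (Link.own-colour l₁) (trans (pair-colour-sym A (α w) (α v)) (Link.own-colour l₂))
  ... | inj₂ l₁ | inj₂ l₂ | inj₁ l₃ = no-mixed-triangle B A l₃ (Link.own-colour l₁) (trans (pair-colour-sym B (β w) (β v)) (Link.own-colour l₂))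

  module _ (x₀ : Fin ν) (w m k d N₀ s₂ s₃ : ℕ) (1≤w : 1 ≤ w) (w≤m : w ≤ m) (dw≤m : d * w ≤ m) (4≤m : 4 ≤ m)
    (s₂-small : 4 * s₂ * 64 ≤ w * w) (s₃-small : 2 * s₃ * 128 ≤ w * w) (N₀-small : 8 * N₀ ≤ m * m)
    (A-rows : RowsSpread A w s₂) (A-columns : ColumnsSpread A w s₂) (A-sparse : Sparse A w s₃)
    (B-rows : RowsSpread B w s₂) (B-columns : ColumnsSpread B w s₂) (B-sparse : Sparse B w s₃)
    (A-exposed : ∀ i (I : Vec (Fin n) m) → missed e N₀ A B α β i (Vec.toList I) ≡ false)
    (B-exposed : ∀ i (I : Vec (Fin n) m) → missed e N₀ B A β α i (Vec.toList I) ≡ false)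
    (α-fibres : ∀ x → multiplicity α (allFin n) x ≤ d) (β-fibres : ∀ x → multiplicity β (allFin n) x ≤ d)
    (no-dense : ∀ (S S′ : Vec (Fin ν) m) → ∑ (allFin n) (λ v → 𝟙 (support S (α v) ∧ support S′ (β v))) < k)
    (1≤r : 1 ≤ ℓ) (rk≤n : ℓ * k ≤ n)
    where

    half : ∀ (M N : Matrix (Colour ℓ) ν ν) (κ μ : Fin n → Fin ν) →
      RowsSpread M w s₂ → ColumnsSpread M w s₂ → Sparse M w s₃ →
      RowsSpread N w s₂ → ColumnsSpread N w s₂ → Sparse N w s₃ →
      (∀ i (I : Vec (Fin n) m) → missed e N₀ M N κ μ i (Vec.toList I) ≡ false) →
      (∀ x → multiplicity μ (allFin n) x ≤ d) →
      ∀ i (p : Fin n → Bool) (u : List (Fin n)) → Distinct κ u → (∀ {v} → v ∈ u → v ∈ filterᵇ p (allFin n)) →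
      (∀ g → ∑ u g ≤ ∑ (filterᵇ p (allFin n)) g) → m ≤ length u →
      ∃[ v ] ∃[ v′ ] (p v ≡ true × p v′ ≡ true × Link M N i (κ v) (κ v′) (μ v) (μ v′))
    half M N κ μ h₁ h₂ h₃ h₄ h₅ h₆ exposed fibres i p u dist u⊆ u≤ m≤ =
      let v , v′ , v∈ , v′∈ , l = found in v , v′ , ∈-filterᵇ⇒ p (allFin n) (u⊆ (⊆-list v∈)) , ∈-filterᵇ⇒ p (allFin n) (u⊆ (⊆-list v′∈)) , l
      where
      open Prefix (prefix m u m≤)
      filter≤ : ∀ g → ∑ (filterᵇ p (allFin n)) g ≤ ∑ (allFin n) g
      filter≤ g = ≤-trans (≤-reflexive (∑-filterᵇ p (allFin n) g)) (∑-mono (allFin n) (λ x → if≤ (p x) (g x)))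
        where
        if≤ : ∀ b c → (if b then c else 0) ≤ c
        if≤ true  c = ≤-refl
        if≤ false c = z≤n
      found = HalfHitting.half-hitting e M N x₀ κ μ w m d N₀ s₂ s₃ 1≤w w≤m dw≤m 4≤m s₂-small s₃-small N₀-small
        h₁ h₂ h₃ h₄ h₅ h₆ i (Vec.toList vector) (length-toList vector)
        (λ x → ≤-trans (sums≤ _) (dist x))
        (λ x → ≤-trans (sums≤ _) (≤-trans (u≤ _) (≤-trans (filter≤ _) (fibres x))))
        (exposed i vector)

    -- Some class of `f` has at least k vertices. With fewer than m values of α and fewer than m
    -- values of β it would lie in a rectangle excluded by `no-dense`; otherwise m of its vertices
    -- differ in one coordinate, and the matrix of that coordinate has a surviving edge among them.
    colour-hitting : ∀ (f : Fin n → Fin ℓ) → ∃[ u ] ∃[ v ] (colour u v ≡ just (f u) × f u ≡ f v)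
    colour-hitting f = conclude
      where
      class : Fin ℓ → Fin n → Bool
      class i v = does (f v ≟ i)
      big-class : ∃[ i ] k ≤ multiplicity f (allFin n) i
      big-class = some-large (allFin ℓ) (multiplicity f (allFin n)) k
          (≤-trans (≤-reflexive (cong (_* k) (length-allFin ℓ))) (≤-trans rk≤n (≤-reflexive total)))
          (subst (1 ≤_) (sym (length-allFin ℓ)) 1≤r)
        where
        total : n ≡ ∑ (allFin ℓ) (multiplicity f (allFin n))
        total = trans (sym (trans (length-as-∑ (allFin n)) (length-allFin n)))
          (trans (∑-fibres f (allFin n) (λ _ → 1)) (∑-cong (allFin ℓ) (λ x → *-identityʳ _)))
      i = proj₁ big-class
      L = filterᵇ (class i) (allFin n)
      module SA = Split (split α L)
      module SB = Split (split β L)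
      finish : (∃[ v ] ∃[ v′ ] (class i v ≡ true × class i v′ ≡ true × colour v v′ ≡ just i)) → ∃[ u ] ∃[ v ] (colour u v ≡ just (f u) × f u ≡ f v)
      finish (v , v′ , e₁ , e₂ , c) = v , v′ , trans c (cong just (sym (does⇒≡ e₁))) , trans (does⇒≡ e₁) (sym (does⇒≡ e₂))
      conclude : ∃[ u ] ∃[ v ] (colour u v ≡ just (f u) × f u ≡ f v)
      conclude with m ≤? length SA.first
      ... | yes le = finish (let v , v′ , p , q , l = half A B α β A-rows A-columns A-sparse B-rows B-columns B-sparse A-exposed β-fibres
                                     i (class i) SA.first SA.distinct SA.⊆-first (λ g → ≤-trans (m≤m+n _ _) (≤-reflexive (sym (SA.sums g)))) le
                             in v , v′ , p , q , linkA⇒colour l)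
      ... | no ¬leA with m ≤? length SB.first
      ... | yes le = finish (let v , v′ , p , q , l = half B A β α B-rows B-columns B-sparse A-rows A-columns A-sparse B-exposed α-fibres
                                     i (class i) SB.first SB.distinct SB.⊆-first (λ g → ≤-trans (m≤m+n _ _) (≤-reflexive (sym (SB.sums g)))) le
                             in v , v′ , p , q , linkB⇒colour l)
      ... | no ¬leB = contradiction (≤-trans (no-dense S S′) (≤-trans (proj₂ big-class) (∑-mono (allFin n) inside))) (<-irrefl refl)
        where
        S  = pad x₀ (map α SA.first) m
        S′ = pad x₀ (map β SB.first) m
        covered : ∀ (κ : Fin n → Fin ν) (u : List (Fin n)) → ¬ (m ≤ length u) → ∀ v → 1 ≤ multiplicity κ u (κ v) → support (pad x₀ (map κ u) m) (κ v) ≡ true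
        covered κ u ¬le v h with ∑-positive u _ h
        ... | v′ , v′∈ , e = pad-support x₀ (map κ u) m
              (≤-trans (≤-reflexive (length-map κ u)) (<⇒≤ (≰⇒> ¬le)))
              (subst (_∈ map κ u) (does⇒≡ (𝟙-positive _ e)) (∈-map⁺ κ v′∈))
        inside : ∀ v → 𝟙 (class i v) ≤ 𝟙 (support S (α v) ∧ support S′ (β v))
        inside v with class i v in c
        ... | false = z≤n
        ... | true  = ≤-reflexive (cong 𝟙 (sym (cong₂ _∧_
                        (covered α SA.first ¬leA v (SA.covers (α v) (multiplicity-∈ α v∈)))
                        (covered β SB.first ¬leB v (SB.covers (β v) (multiplicity-∈ β v∈))))))
          where
          v∈ : v ∈ L
          v∈ = ⇒∈-filterᵇ (class i) (∈-allFin v) c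

    packing : Packing ℓ n
    packing = record { colour = colour ; symmetric = colour-sym ; loopless = colour-loop ; no-mono = colour-no-mono ; hitting = colour-hitting }

-- Existence by counting

𝟙≡0⇒false : ∀ b → 𝟙 b ≡ 0 → b ≡ false
𝟙≡0⇒false false _ = refl

≤ᵇ-false : ∀ m n → (m ≤ᵇ n) ≡ false → n < m
≤ᵇ-false m n e = ≰⇒> (λ p → subst T e (≤⇒≤ᵇ p))

n+m≡0 : ∀ {m n} → m + n ≡ 0 → m ≡ 0 × n ≡ 0
n+m≡0 {zero} {zero} _ = refl , refl

count-zero⇒< : ∀ s x → 𝟙 (s ≤ᵇ x) ≡ 0 → x < s
count-zero⇒< s x e = ≤ᵇ-false s x (𝟙≡0⇒false (s ≤ᵇ x) e)

∈-all-vecs : ∀ {a w} (W : Vec (Fin a) w) → W ∈ vecs (allFin a) w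
∈-all-vecs W = ∈-vecs (allFin _) W (λ i → ∈-allFin (lookup W i))

length-all-vecs : ∀ a w → length (vecs (allFin a) w) ≡ a ^ w
length-all-vecs a w = trans (length-vecs (allFin a) w) (cong (_^ w) (length-allFin a))

module RandomMatrix (r e a w : ℕ) (1≤r : 1 ≤ r) (1≤a : 1 ≤ a) (w≤q : w ≤ r + e)
  (N Y₀ a′ s J : ℕ) (2≤N : 2 ≤ N) (1≤Y₀ : 1 ≤ Y₀) (J²≤N : 2 * (J * J) ≤ N) (wY₀ : 12 * w * Y₀ ≤ r + e) (a≡ : a ≡ Y₀ * a′)
  (light-wins : a ^ w * (r * 64) ≤ 2 ^ s)
  (y S : ℕ) (heavy-rare : a * 8 ^ suc (2 * y) ≤ 2 ^ J) (heavy-wins : 8 * (a ^ w * (r * 64)) ≤ suc y ^ S)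
  (e₀ D X : ℕ) (1≤X : 1 ≤ X) (a≡₂ : a ≡ (r + e) * e₀) (degree-rare : a * (X * 8 ^ e₀) ≤ 2 ^ D) (degree-wins : 8 * (r * 64) ≤ X)
  (e₃ s₃ : ℕ) (ww≡ : w * w ≡ (r + e) * e₃) (sparse-wins : 8 ^ (r * 3 * e₃) * (a ^ w * (a ^ w * 64)) ≤ 4 ^ s₃)
  where

  q = r + e
  xs = letters r e
  Mat = Matrix (Colour r) a a
  Ω : List Mat
  Ω = vecs (vecs xs a) a
  Λ = (q ^ a) ^ a
  threshold = 2 * a′ + N * s
  -- Light rows plus heavy rows: where no row has degree above D, a heavy count d contributes d² ≤ D
  -- d.
  s₂ = threshold + D * S

  1≤q : 1 ≤ q
  1≤q = ≤-trans 1≤r (m≤m+n r e)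

  length-Ω : length Ω ≡ Λ
  length-Ω = trans (length-vecs (vecs xs a) a) (cong (_^ a) (trans (length-vecs xs a) (cong (_^ a) (length-letters r e))))

  degree-stat : Fin r → Mat → ℕ
  degree-stat i = ∑ᵥ (λ v → 𝟙 (D ≤ᵇ hits (is i) (λ _ → true) v))

  light-stat heavy-stat : Fin r → Vec (Fin a) w → Mat → ℕ
  light-stat i W = ∑ᵥ (λ v → light-part J (hits (is i) (support W) v))
  heavy-stat i W = ∑ᵥ (λ v → heavy-part J (hits (is i) (support W) v))

  crowded-degree crowded-light crowded-heavy crowded-rectangle crowded : Mat → ℕ
  crowded-degree M = ∑ (allFin r) (λ i → 𝟙 (1 ≤ᵇ degree-stat i M))
  crowded-light  M = ∑ (allFin r) (λ i → ∑ (vecs (allFin a) w) (λ W → 𝟙 (threshold ≤ᵇ light-stat i W M)))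
  crowded-heavy  M = ∑ (allFin r) (λ i → ∑ (vecs (allFin a) w) (λ W → 𝟙 (S ≤ᵇ heavy-stat i W M)))
  crowded-rectangle M = ∑ (vecs (allFin a) w) (λ U → ∑ (vecs (allFin a) w) (λ W → 𝟙 (s₃ ≤ᵇ rectangle-hits coloured (support U) (support W) M)))

  crowded-rows : Mat → ℕ
  crowded-rows M = crowded-degree M + (crowded-light M + crowded-heavy M)

  crowded M = crowded-rows M + (crowded-rows (transposed M) + crowded-rectangle M)

  private
    outer : ∀ (f : Fin r → Mat → ℕ) → (∀ i → ∑ Ω (f i) * (r * 64) ≤ Λ) → ∑ Ω (λ M → ∑ (allFin r) (λ i → f i M)) * 64 ≤ Λ
    outer f h = union-bound Ω (allFin r) f (r * 64) 64 1 Λ ≤-refl (λ i → ≤-trans (h i) (≤-reflexive (sym (+-identityʳ Λ))))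
      (≤-reflexive (trans (+-identityʳ _) (cong (_* 64) (length-allFin r))))

  length-q : ∀ {f : ℕ → Set} → f (length xs) → f q
  length-q {f} = subst f (length-letters r e)

  rare-degree : ∑ Ω crowded-degree * 64 ≤ Λ
  rare-degree = union-bound Ω (allFin r) (λ i M → 𝟙 (1 ≤ᵇ degree-stat i M)) X 64 8 Λ (s≤s z≤n)
    (λ i → length-q {λ q → count≥ Ω (degree-stat i) 1 * X ≤ 8 * (q ^ a) ^ a}
      (RowStatistics.degree-count xs nothing (is i) (∑-is r e i) a (subst (1 ≤_) (sym (length-letters r e)) 1≤q) e₀ D X 1≤X 1≤a
        (trans a≡₂ (cong (_* e₀) (sym (length-letters r e)))) degree-rare))
    (≤-trans (≤-reflexive (cong (λ l → 8 * (l * 64)) (length-allFin r))) degree-wins)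

  rare-light : ∑ Ω crowded-light * 64 ≤ Λ
  rare-light = outer _ λ i → union-bound Ω (vecs (allFin a) w) (λ W M → 𝟙 (threshold ≤ᵇ light-stat i W M)) (2 ^ s) (r * 64) 1 Λ ≤-refl
    (λ W → ≤-trans (length-q {λ q → count≥ Ω (light-stat i W) threshold * 2 ^ s ≤ (q ^ a) ^ a}
      (RowStatistics.light-count xs nothing (is i) (∑-is r e i) a (subst (1 ≤_) (sym (length-letters r e)) 1≤q) (support W) w J N Y₀ a′ s
        (size-support W) 2≤N 1≤Y₀ J²≤N (≤-trans wY₀ (≤-reflexive (sym (length-letters r e)))) a≡)) (≤-reflexive (sym (+-identityʳ Λ))))
    (≤-trans (≤-reflexive (trans (+-identityʳ _) (cong (_* (r * 64)) (length-all-vecs a w)))) light-wins)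

  rare-heavy : ∑ Ω crowded-heavy * 64 ≤ Λ
  rare-heavy = outer _ λ i → union-bound Ω (vecs (allFin a) w) (λ W M → 𝟙 (S ≤ᵇ heavy-stat i W M)) (suc y ^ S) (r * 64) 8 Λ (s≤s z≤n)
    (λ W → length-q {λ q → count≥ Ω (heavy-stat i W) S * suc y ^ S ≤ 8 * (q ^ a) ^ a}
      (RowStatistics.heavy-count xs nothing (is i) (∑-is r e i) a (subst (1 ≤_) (sym (length-letters r e)) 1≤q) (support W) w J y S
        (size-support W) (≤-trans w≤q (≤-reflexive (sym (length-letters r e)))) 1≤a heavy-rare))
    (≤-trans (≤-reflexive (cong (λ l → 8 * (l * (r * 64))) (length-all-vecs a w))) heavy-wins)

  rare-rectangle : ∑ Ω crowded-rectangle * 64 ≤ Λ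
  rare-rectangle = union-bound Ω (vecs (allFin a) w) (λ U M → ∑ (vecs (allFin a) w) (λ W → 𝟙 (s₃ ≤ᵇ rectangle-hits coloured (support U) (support W) M)))
      (a ^ w * 64) 64 1 Λ ≤-refl
      (λ U → ≤-trans (union-bound Ω (vecs (allFin a) w) (λ W M → 𝟙 (s₃ ≤ᵇ rectangle-hits coloured (support U) (support W) M))
        (4 ^ s₃) (a ^ w * 64) (8 ^ (r * 3 * e₃)) Λ (^-pos 8 (r * 3 * e₃) (s≤s z≤n))
        (λ W → single U W)
        (≤-trans (≤-reflexive (cong (λ l → 8 ^ (r * 3 * e₃) * (l * (a ^ w * 64))) (length-all-vecs a w))) sparse-wins))
        (≤-reflexive (sym (+-identityʳ Λ))))
      (≤-reflexive (trans (+-identityʳ _) (cong (_* 64) (length-all-vecs a w))))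
    where
    single : ∀ U W → count≥ Ω (rectangle-hits coloured (support U) (support W)) s₃ * 4 ^ s₃ ≤ 8 ^ (r * 3 * e₃) * Λ
    single U W = subst (λ p → cnt * 4 ^ s₃ ≤ 8 ^ (p * 3 * e₃) * Λ) (∑-coloured r e)
      (length-q {λ q → cnt * 4 ^ s₃ ≤ 8 ^ (∑ xs (𝟙 ∘ coloured) * 3 * e₃) * (q ^ a) ^ a}
        (rectangle-count xs nothing a coloured (support U) (support W) w e₃ 3 s₃ (subst (1 ≤_) (sym (length-letters r e)) 1≤q)
          (size-support U) (size-support W) (trans ww≡ (cong (_* e₃) (sym (length-letters r e))))))
      where
      cnt = count≥ Ω (rectangle-hits coloured (support U) (support W)) s₃

  rare-rows : ∑ Ω crowded-rows * 64 ≤ 3 * Λ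
  rare-rows = ≤-trans (≤-reflexive (cong (_* 64) (trans (∑-+ Ω _ _) (cong (∑ Ω crowded-degree +_) (∑-+ Ω _ _)))))
    (≤-trans (≤-reflexive (sh (∑ Ω crowded-degree) (∑ Ω crowded-light) (∑ Ω crowded-heavy)))
      (≤-trans (+-mono-≤ rare-degree (+-mono-≤ rare-light rare-heavy)) (≤-reflexive (sh₂ Λ))))
    where
    sh : ∀ a b c → (a + (b + c)) * 64 ≡ a * 64 + (b * 64 + c * 64)
    sh = solve-∀
    sh₂ : ∀ x → x + (x + x) ≡ 3 * x
    sh₂ = solve-∀

  rare : ∑ Ω crowded * 64 ≤ 7 * Λ
  rare = ≤-trans (≤-reflexive (cong (_* 64) (trans (∑-+ Ω _ _) (cong (∑ Ω crowded-rows +_)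
      (trans (∑-+ Ω _ _) (cong (_+ ∑ Ω crowded-rectangle) (∑-transposed xs a a crowded-rows)))))))
    (≤-trans (≤-reflexive (sh (∑ Ω crowded-rows) (∑ Ω crowded-rectangle)))
      (≤-trans (+-mono-≤ rare-rows (+-mono-≤ rare-rows rare-rectangle)) (≤-reflexive (sh₂ Λ))))
    where
    sh : ∀ a c → (a + (a + c)) * 64 ≡ a * 64 + (a * 64 + c * 64)
    sh = solve-∀
    sh₂ : ∀ x → 3 * x + (3 * x + x) ≡ 7 * x
    sh₂ = solve-∀

  hits≤hits-all : ∀ {n} (P : Colour r → Bool) (mask : Fin n → Bool) (v : Vec (Colour r) n) → hits P mask v ≤ hits P (λ _ → true) v
  hits≤hits-all {n} P mask v = ∑-mono (allFin n) (λ l → 𝟙∧≤ (mask l) (P (lookup v l)))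
    where
    𝟙∧≤ : ∀ b c → 𝟙 (b ∧ c) ≤ 𝟙 c
    𝟙∧≤ true  c = ≤-refl
    𝟙∧≤ false c = z≤n

  uncrowded-rows : ∀ M → crowded-rows M ≡ 0 → RowsSpread M w s₂
  uncrowded-rows M none i W = begin
    ∑ (allFin a) (λ z → d z * d z) ≤⟨ ∑-mono (allFin a) (λ z → sq≤light+heavy J D (d z) (d≤D z)) ⟩
    ∑ (allFin a) (λ z → light-part J (d z) + D * heavy-part J (d z)) ≡⟨ trans (∑-+ (allFin a) _ _) (cong (light-stat i W M +_) (∑-*ˡ (allFin a) D _)) ⟩
    light-stat i W M + D * heavy-stat i W M ≤⟨ +-mono-≤ (<⇒≤ few-light) (*-monoʳ-≤ D (<⇒≤ few-heavy)) ⟩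
    s₂                                                                        ∎
    where
    open ≤-Reasoning
    d : Fin a → ℕ
    d z = hits (is i) (support W) (lookup M z)
    parts = n+m≡0 none
    parts₂ = n+m≡0 (proj₂ parts)
    few-light : light-stat i W M < threshold
    few-light = count-zero⇒< threshold _ (∑-zero-∈ (∑-zero-∈ (proj₁ parts₂) (∈-allFin i)) (∈-all-vecs W))
    few-heavy : heavy-stat i W M < S
    few-heavy = count-zero⇒< S _ (∑-zero-∈ (∑-zero-∈ (proj₂ parts₂) (∈-allFin i)) (∈-all-vecs W))
    no-degree : degree-stat i M ≡ 0
    no-degree = n<1⇒n≡0 (count-zero⇒< 1 _ (∑-zero-∈ (proj₁ parts) (∈-allFin i)))
    d≤D : ∀ z → d z ≤ D
    d≤D z = ≤-trans (hits≤hits-all (is i) (support W) (lookup M z))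
      (<⇒≤ (count-zero⇒< D (hits (is i) (λ _ → true) (lookup M z)) (∑-zero-∈ no-degree (∈-allFin z))))

  uncrowded : ∀ M → crowded M ≡ 0 → RowsSpread M w s₂ × ColumnsSpread M w s₂ × Sparse M w s₃
  uncrowded M none = uncrowded-rows M (proj₁ p) , uncrowded-rows (transposed M) (proj₁ p₂) ,
    λ U W → <⇒≤ (count-zero⇒< s₃ _ (∑-zero-∈ (∑-zero-∈ (proj₂ p₂) (∈-all-vecs U)) (∈-all-vecs W)))
    where
    p  = n+m≡0 none
    p₂ = n+m≡0 (proj₂ p)

  module _ (n m N₀ q′ : ℕ) (q≡ : q ≡ suc q′) (1≤q′ : 1 ≤ q′) (exposure-wins : q′ ^ N₀ * (n ^ m * (r * 64)) ≤ q ^ N₀) (α β : Fin n → Fin a) where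

    unexposed : (κ μ : Fin n → Fin a) → Mat → Mat → ℕ
    unexposed κ μ M N = ∑ (allFin r) (λ i → ∑ (vecs (allFin n) m) (λ I → 𝟙 (missed e N₀ M N κ μ i (Vec.toList I))))

    rare-unexposed : ∀ κ μ N → ∑ Ω (λ M → unexposed κ μ M N) * 64 ≤ Λ
    rare-unexposed κ μ N = outer _ λ i → union-bound Ω (vecs (allFin n) m) (λ I M → 𝟙 (missed e N₀ M N κ μ i (Vec.toList I)))
      (q ^ N₀) (r * 64) (q′ ^ N₀) Λ (^-pos q′ N₀ 1≤q′)
      (λ I → subst₂ (λ u L → ∑ Ω (λ M → 𝟙 (missed e N₀ M N κ μ i (Vec.toList I))) * u ^ N₀ ≤ q′ ^ N₀ * L) (sym q≡)
          (trans (cong (_^ (a * a)) (sym q≡)) (sym (^-*-assoc q a a)))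
          (Expose.exposure-bound e N κ μ i (Vec.toList I) q′ (trans (length-letters r e) q≡) 1≤q′ N₀))
      (≤-trans (≤-reflexive (cong (λ l → q′ ^ N₀ * (l * (r * 64))) (length-all-vecs n m))) exposure-wins)

    1≤Λ : 1 ≤ Λ
    1≤Λ = ^-pos (q ^ a) a (^-pos q a 1≤q)

    Defects : Mat → Mat → ℕ
    Defects A B = (crowded A + crowded B) + (unexposed α β A B + unexposed β α B A)

    -- In units of 1/64, crowding costs 7 for each matrix (three statistics of rows, three of
    -- columns, one of rectangles), and a failed exposure costs 1 for each of the two roles: 16 in
    -- all.
    few-defects : ∑ Ω (λ A → ∑ Ω (Defects A)) < length Ω * Λ
    few-defects = *-cancelʳ-< 64 _ _ (begin-strict
      ∑ Ω (λ A → ∑ Ω (Defects A)) * 64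
        ≡⟨ cong (_* 64) (trans (∑-cong Ω inner) (trans (∑-+ Ω _ _) (cong₂ _+_ (trans (∑-+ Ω _ _) (cong₂ _+_ (∑-*ˡ Ω (length Ω) crowded) (∑-const Ω (∑ Ω crowded))))
              (trans (∑-+ Ω _ _) (cong (_+ E₂) (∑-swap Ω Ω (unexposed α β))))))) ⟩
      (length Ω * ∑ Ω crowded + length Ω * ∑ Ω crowded + (E₁ + E₂)) * 64
        ≡⟨ sh (length Ω) (∑ Ω crowded) E₁ E₂ ⟩
      length Ω * (∑ Ω crowded * 64) + length Ω * (∑ Ω crowded * 64) + (E₁ * 64 + E₂ * 64)
        ≤⟨ +-mono-≤ (+-mono-≤ (*-monoʳ-≤ (length Ω) rare) (*-monoʳ-≤ (length Ω) rare))
                    (+-mono-≤ (average (λ B A → unexposed α β A B) (λ B → rare-unexposed α β B))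
                              (average (λ A B → unexposed β α B A) (λ A → rare-unexposed β α A))) ⟩
      length Ω * (7 * Λ) + length Ω * (7 * Λ) + (length Ω * Λ + length Ω * Λ)
        ≡⟨ sh₂ (length Ω) Λ ⟩
      length Ω * Λ * 16
        <⟨ *-monoʳ-< (length Ω * Λ) {{>-nonZero (*-mono-≤ (≤-trans 1≤Λ (≤-reflexive (sym length-Ω))) 1≤Λ)}} (m≤m+n 17 47) ⟩
      length Ω * Λ * 64 ∎)
      where
      open ≤-Reasoning
      E₁ = ∑ Ω (λ B → ∑ Ω (λ A → unexposed α β A B))
      E₂ = ∑ Ω (λ A → ∑ Ω (λ B → unexposed β α B A))
      inner : ∀ A → ∑ Ω (Defects A) ≡ (length Ω * crowded A + ∑ Ω crowded) + (∑ Ω (unexposed α β A) + ∑ Ω (λ B → unexposed β α B A))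
      inner A = trans (∑-+ Ω _ _) (cong₂ _+_ (trans (∑-+ Ω (λ _ → crowded A) crowded) (cong (_+ ∑ Ω crowded) (∑-const Ω (crowded A)))) (∑-+ Ω _ _))
      average : ∀ (f : Mat → Mat → ℕ) → (∀ B → ∑ Ω (f B) * 64 ≤ Λ) → ∑ Ω (λ B → ∑ Ω (f B)) * 64 ≤ length Ω * Λ
      average f h = ≤-trans (≤-reflexive (sym (∑-*ʳ Ω 64 _))) (∑-bound Ω Λ h)
      sh : ∀ l c x y → (l * c + l * c + (x + y)) * 64 ≡ l * (c * 64) + l * (c * 64) + (x * 64 + y * 64)
      sh = solve-∀
      sh₂ : ∀ l x → l * (7 * x) + l * (7 * x) + (l * x + l * x) ≡ l * x * 16
      sh₂ = solve-∀

    Exposed : (κ μ : Fin n → Fin a) → Mat → Mat → Set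
    Exposed κ μ M N = ∀ i (I : Vec (Fin n) m) → missed e N₀ M N κ μ i (Vec.toList I) ≡ false

    Uncrowded : Mat → Set
    Uncrowded M = RowsSpread M w s₂ × ColumnsSpread M w s₂ × Sparse M w s₃

    good-matrices : ∃[ A ] ∃[ B ] (Uncrowded A × Uncrowded B × Exposed α β A B × Exposed β α B A)
    good-matrices = read-off (proj₁ half-done) (∑<length⇒zero Ω (Defects (proj₁ half-done)) (≤-trans (proj₂ half-done) (≤-reflexive (sym length-Ω))))
      where
      half-done : ∃[ A ] ∑ Ω (Defects A) < Λ
      half-done = ∑<⇒∃< Ω (λ A → ∑ Ω (Defects A)) Λ few-defects
      exposed : ∀ (f : Fin r → Vec (Fin n) m → Bool) → ∑ (allFin r) (λ i → ∑ (vecs (allFin n) m) (λ I → 𝟙 (f i I))) ≡ 0 → ∀ i I → f i I ≡ false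
      exposed f z i I = 𝟙≡0⇒false (f i I) (∑-zero-∈ (∑-zero-∈ z (∈-allFin i)) (∈-all-vecs I))
      read-off : ∀ A → ∃[ B ] Defects A B ≡ 0 → ∃[ A ] ∃[ B ] (Uncrowded A × Uncrowded B × Exposed α β A B × Exposed β α B A)
      read-off A (B , none) = A , B , uncrowded A (proj₁ p₁) , uncrowded B (proj₂ p₁) ,
          exposed (λ i I → missed e N₀ A B α β i (Vec.toList I)) (proj₁ p₂) , exposed (λ i I → missed e N₀ B A β α i (Vec.toList I)) (proj₂ p₂)
        where
        p  = n+m≡0 none
        p₁ = n+m≡0 (proj₁ p)
        p₂ = n+m≡0 (proj₂ p)

-- Random coordinates

module RandomCoordinates (a n m k d b y z : ℕ) (1≤a : 1 ≤ a) (1≤n : 1 ≤ n) (n≡ : n ≡ a * b)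
  (spread : n * (m * m) * y ≤ k * (a * a)) (dense-wins : 8 ^ k * (a ^ m * (a ^ m * 4)) ≤ suc y ^ k)
  (fibre-wins : 8 ^ (z * b) * (a * 4) ≤ suc z ^ suc d) where

  points : List (Fin a × Fin a)
  points = concatMap (λ x → map (x ,_) (allFin a)) (allFin a)

  ∑-points : ∀ f → ∑ points f ≡ ∑ (allFin a) (λ x → ∑ (allFin a) (λ y → f (x , y)))
  ∑-points f = trans (∑-concatMap _ (allFin a) f) (∑-cong (allFin a) (λ x → ∑-map (x ,_) (allFin a) f))

  length-points : length points ≡ a * a
  length-points = trans (sym (length-as-∑ points)) (trans (∑-points _)
    (trans (∑-cong (allFin a) (λ _ → trans (length-as-∑ (allFin a)) (length-allFin a))) (trans (∑-const (allFin a) a) (cong (_* a) (length-allFin a)))))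

  origin : Fin a × Fin a
  origin = x₀ , x₀
    where
    x₀ = proj₁ (∑-positive (allFin a) (λ _ → 1) (subst (1 ≤_) (sym (trans (length-as-∑ (allFin a)) (length-allFin a))) 1≤a))

  Ω : List (Vec (Fin a × Fin a) n)
  Ω = vecs points n
  Λ = (a * a) ^ n

  length-Ω : length Ω ≡ Λ
  length-Ω = trans (length-vecs points n) (cong (_^ n) length-points)

  dense-stat : Vec (Fin a) m → Vec (Fin a) m → Vec (Fin a × Fin a) n → ℕ
  dense-stat U W = ∑ᵥ (λ p → 𝟙 (support U (proj₁ p) ∧ support W (proj₂ p)))

  fibre-stat₁ fibre-stat₂ : Fin a → Vec (Fin a × Fin a) n → ℕ
  fibre-stat₁ x = ∑ᵥ (λ p → 𝟙 (does (proj₁ p ≟ x)))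
  fibre-stat₂ x = ∑ᵥ (λ p → 𝟙 (does (proj₂ p ≟ x)))

  -- By `spread` the moment (1 + m² y/a²)^n is at most (1 + k/n)^n ≤ 8^k, so even k vertices in the
  -- rectangle have probability at most (8/(y + 1))^k.
  rare-dense : ∀ U W → count≥ Ω (dense-stat U W) k * suc y ^ k ≤ 8 ^ k * Λ
  rare-dense U W = ≤-cancelʳ-* (n ^ n) (^-pos n n 1≤n) (begin
    count≥ Ω (dense-stat U W) k * suc y ^ k * n ^ n
      ≤⟨ *-monoˡ-≤ (n ^ n) (≤-trans (markov-^ Ω (dense-stat U W) k (suc y) (s≤s z≤n)) (∑-x^∑ᵥ points origin n (suc y) (𝟙 ∘ P))) ⟩
    (∑ points (λ p → suc y ^ 𝟙 (P p))) ^ n * n ^ n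
      ≡⟨ cong (λ s → s ^ n * n ^ n) (∑-x^𝟙 points P y) ⟩
    (length points + ∑ points (𝟙 ∘ P) * y) ^ n * n ^ n
      ≤⟨ *-monoˡ-≤ (n ^ n) (^-monoˡ-≤ n (+-mono-≤ (≤-reflexive length-points) (*-monoˡ-≤ y area))) ⟩
    (a * a + m * m * y) ^ n * n ^ n
      ≡⟨ trans (sym (^-distribʳ-* _ n n)) (cong (_^ n) (sh (a * a) (m * m) y n)) ⟩
    (n * (a * a) + n * (m * m) * y) ^ n
      ≤⟨ ^-monoˡ-≤ n (+-monoʳ-≤ (n * (a * a)) spread) ⟩
    (n * (a * a) + k * (a * a)) ^ n
      ≡⟨ trans (cong (_^ n) (sym (*-distribʳ-+ (a * a) n k))) (^-distribʳ-* (n + k) (a * a) n) ⟩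
    (n + k) ^ n * Λ
      ≤⟨ *-monoˡ-≤ Λ (power≤8^ n k n 1≤n ≤-refl) ⟩
    8 ^ k * n ^ n * Λ
      ≡⟨ sh₂ (8 ^ k) (n ^ n) Λ ⟩
    8 ^ k * Λ * n ^ n ∎)
    where
    open ≤-Reasoning
    P : Fin a × Fin a → Bool
    P p = support U (proj₁ p) ∧ support W (proj₂ p)
    area : ∑ points (𝟙 ∘ P) ≤ m * m
    area = ≤-trans (≤-reflexive (trans (∑-points _) (trans (∑-cong (allFin a) (λ x → trans (∑-cong (allFin a) (λ u → 𝟙-∧ (support U x) (support W u))) (∑-*ˡ (allFin a) (𝟙 (support U x)) _)))
      (∑-*ʳ (allFin a) (cardinality (support W)) _)))) (*-mono-≤ (size-support U) (size-support W))
    sh : ∀ A M y n → (A + M * y) * n ≡ n * A + n * M * y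
    sh = solve-∀
    sh₂ : ∀ a b c → a * b * c ≡ a * c * b
    sh₂ = solve-∀

  rare-fibre : ∀ (P : Fin a × Fin a → Bool) → ∑ points (𝟙 ∘ P) ≡ a → count≥ Ω (∑ᵥ (𝟙 ∘ P)) (suc d) * suc z ^ suc d ≤ 8 ^ (z * b) * Λ
  rare-fibre P line = begin
    count≥ Ω (∑ᵥ (𝟙 ∘ P)) (suc d) * suc z ^ suc d
      ≤⟨ ≤-trans (markov-^ Ω (∑ᵥ (𝟙 ∘ P)) (suc d) (suc z) (s≤s z≤n)) (∑-x^∑ᵥ points origin n (suc z) (𝟙 ∘ P)) ⟩
    (∑ points (λ p → suc z ^ 𝟙 (P p))) ^ n
      ≡⟨ cong (_^ n) (trans (∑-x^𝟙 points P z) (cong₂ (λ l s → l + s * z) length-points line)) ⟩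
    (a * a + a * z) ^ n
      ≡⟨ trans (cong (_^ n) (sym (*-distribˡ-+ a a z))) (^-distribʳ-* a (a + z) n) ⟩
    a ^ n * (a + z) ^ n
      ≤⟨ *-monoʳ-≤ (a ^ n) (subst (λ u → (a + z) ^ u ≤ 8 ^ (z * b) * a ^ u) (sym n≡) (power≤8^* a z b 1≤a)) ⟩
    a ^ n * (8 ^ (z * b) * a ^ n)
      ≡⟨ trans (sh (a ^ n) (8 ^ (z * b))) (cong (8 ^ (z * b) *_) (sym (^-distribʳ-* a a n))) ⟩
    8 ^ (z * b) * Λ ∎
    where
    open ≤-Reasoning
    sh : ∀ x y → x * (y * x) ≡ y * (x * x)
    sh = solve-∀

  line₁ : ∀ x → ∑ points (λ p → 𝟙 (does (proj₁ p ≟ x))) ≡ a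
  line₁ x = trans (∑-points _) (trans (∑-cong (allFin a) (λ u → trans (∑-const (allFin a) _) (trans (cong (_* 𝟙 (does (u ≟ x))) (length-allFin a)) (*-comm a _)))) (∑-𝟙≟ x (λ _ → a)))

  line₂ : ∀ x → ∑ points (λ p → 𝟙 (does (proj₂ p ≟ x))) ≡ a
  line₂ x = trans (∑-points _) (trans (∑-cong (allFin a) (λ _ → ∑-𝟙≟-one x)) (trans (∑-const (allFin a) 1) (trans (*-identityʳ _) (length-allFin a))))

  defects₁ defects₂ defects₃ : Vec (Fin a × Fin a) n → ℕ
  defects₁ φ = ∑ (vecs (allFin a) m) (λ U → ∑ (vecs (allFin a) m) (λ W → 𝟙 (k ≤ᵇ dense-stat U W φ)))
  defects₂ φ = ∑ (allFin a) (λ x → 𝟙 (suc d ≤ᵇ fibre-stat₁ x φ))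
  defects₃ φ = ∑ (allFin a) (λ x → 𝟙 (suc d ≤ᵇ fibre-stat₂ x φ))

  few₁ : ∑ Ω defects₁ * 4 ≤ Λ
  few₁ = union-bound Ω (vecs (allFin a) m) (λ U φ → ∑ (vecs (allFin a) m) (λ W → 𝟙 (k ≤ᵇ dense-stat U W φ))) (a ^ m * 4) 4 1 Λ ≤-refl
    (λ U → ≤-trans (union-bound Ω (vecs (allFin a) m) (λ W φ → 𝟙 (k ≤ᵇ dense-stat U W φ)) (suc y ^ k) (a ^ m * 4) (8 ^ k) Λ (^-pos 8 k (s≤s z≤n))
      (rare-dense U) (≤-trans (≤-reflexive (cong (λ l → 8 ^ k * (l * (a ^ m * 4))) (length-all-vecs a m))) dense-wins)) (≤-reflexive (sym (+-identityʳ Λ))))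
    (≤-reflexive (trans (+-identityʳ _) (cong (_* 4) (length-all-vecs a m))))

  few-fibres : ∀ (P : Fin a → Fin a × Fin a → Bool) → (∀ x → ∑ points (𝟙 ∘ P x) ≡ a) → ∑ Ω (λ φ → ∑ (allFin a) (λ x → 𝟙 (suc d ≤ᵇ ∑ᵥ (𝟙 ∘ P x) φ))) * 4 ≤ Λ
  few-fibres P line = union-bound Ω (allFin a) (λ x φ → 𝟙 (suc d ≤ᵇ ∑ᵥ (𝟙 ∘ P x) φ)) (suc z ^ suc d) 4 (8 ^ (z * b)) Λ (^-pos 8 (z * b) (s≤s z≤n))
    (λ x → rare-fibre (P x) (line x))
    (≤-trans (≤-reflexive (cong (λ l → 8 ^ (z * b) * (l * 4)) (length-allFin a))) fibre-wins)

  few : ∑ Ω (λ φ → defects₁ φ + (defects₂ φ + defects₃ φ)) < length Ω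
  few = *-cancelʳ-< 4 _ _ (begin-strict
    ∑ Ω (λ φ → defects₁ φ + (defects₂ φ + defects₃ φ)) * 4 ≡⟨ cong (_* 4) (trans (∑-+ Ω _ _) (cong (∑ Ω defects₁ +_) (∑-+ Ω _ _))) ⟩
    (∑ Ω defects₁ + (∑ Ω defects₂ + ∑ Ω defects₃)) * 4 ≡⟨ sh (∑ Ω defects₁) (∑ Ω defects₂) (∑ Ω defects₃) ⟩
    ∑ Ω defects₁ * 4 + (∑ Ω defects₂ * 4 + ∑ Ω defects₃ * 4) ≤⟨ +-mono-≤ few₁ (+-mono-≤ (few-fibres (λ x p → does (proj₁ p ≟ x)) line₁) (few-fibres (λ x p → does (proj₂ p ≟ x)) line₂)) ⟩
    Λ + (Λ + Λ) ≡⟨ sh₂ Λ ⟩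
    Λ * 3 <⟨ *-monoʳ-< Λ {{>-nonZero (^-pos (a * a) n (*-mono-≤ 1≤a 1≤a))}} (m≤m+n 4 0) ⟩
    Λ * 4 ≡⟨ cong (_* 4) (sym length-Ω) ⟩
    length Ω * 4                                                ∎)
    where
    open ≤-Reasoning
    sh : ∀ a b c → (a + (b + c)) * 4 ≡ a * 4 + (b * 4 + c * 4)
    sh = solve-∀
    sh₂ : ∀ x → x + (x + x) ≡ x * 3
    sh₂ = solve-∀

  Spread : (α β : Fin n → Fin a) → Set
  Spread α β = (∀ (S S′ : Vec (Fin a) m) → ∑ (allFin n) (λ v → 𝟙 (support S (α v) ∧ support S′ (β v))) < k) ×
               (∀ x → multiplicity α (allFin n) x ≤ d) × (∀ x → multiplicity β (allFin n) x ≤ d)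

  coordinates : ∃[ α ] ∃[ β ] Spread α β
  coordinates = read-off (∑<length⇒zero Ω (λ φ → defects₁ φ + (defects₂ φ + defects₃ φ)) few)
    where
    read-off : ∃[ φ ] defects₁ φ + (defects₂ φ + defects₃ φ) ≡ 0 → ∃[ α ] ∃[ β ] Spread α β
    read-off (φ , none) = proj₁ ∘ lookup φ , proj₂ ∘ lookup φ ,
      (λ S S′ → count-zero⇒< k (dense-stat S S′ φ) (∑-zero-∈ (∑-zero-∈ (proj₁ p) (∈-all-vecs S)) (∈-all-vecs S′))) ,
      (λ x → s≤s⁻¹ (count-zero⇒< (suc d) (fibre-stat₁ x φ) (∑-zero-∈ (proj₁ p₂) (∈-allFin x)))) ,
      (λ x → s≤s⁻¹ (count-zero⇒< (suc d) (fibre-stat₂ x φ) (∑-zero-∈ (proj₂ p₂) (∈-allFin x))))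
      where
      p  = n+m≡0 none
      p₂ = n+m≡0 (proj₂ p)

-- The choice of the parameters

-- Sealed, so that the powers below are never unfolded.
abstract
  P : ℕ → ℕ
  P n = 2 ^ n

  P≡2^ : ∀ n → P n ≡ 2 ^ n
  P≡2^ n = refl

P-+ : ∀ m n → P m * P n ≡ P (m + n)
P-+ m n rewrite P≡2^ m | P≡2^ n | P≡2^ (m + n) = sym (^-distribˡ-+-* 2 m n)

P-mono : ∀ {m n} → m ≤ n → P m ≤ P n
P-mono {m} {n} h rewrite P≡2^ m | P≡2^ n = ^-monoʳ-≤ 2 h

1≤P : ∀ n → 1 ≤ P n
1≤P n rewrite P≡2^ n = ^-pos 2 n (s≤s z≤n)

n<P : ∀ n → n < P n
n<P n rewrite P≡2^ n = n<2^n n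

P-^ : ∀ m n → P m ^ n ≡ 2 ^ (m * n)
P-^ m n rewrite P≡2^ m = ^-*-assoc 2 m n

slack : ∀ {m n} d → m + d ≡ n → m ≤ n
slack d refl = m≤m+n _ d

2^-* : ∀ m n → 2 ^ m * 2 ^ n ≡ 2 ^ (m + n)
2^-* m n = sym (^-distribˡ-+-* 2 m n)

8^≡ : ∀ n → 8 ^ n ≡ 2 ^ (3 * n)
8^≡ n = ^-*-assoc 2 3 n

module Numbers (s : ℕ) where

  -- Here r = 2^(8 t), so t is the logarithm of r up to a constant, and the offset 128 lets powers
  -- of t absorb the numerical constants. Most exponents below are written relative to c = 8 t - 64.
  t = s + 128
  c = 8 * s + 960
  r = P (c + 64)
  q = P (c + 88)
  e = q ∸ r
  -- This is m/d, so that incomplete chunks at most double the number of chunks. As w = 2⁻³¹ q, a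
  -- row seldom meets w points twice in the same colour.
  w = P (c + 57)
  a = P (2 * c + 128)
  -- The factor 2³⁶ is the one with 8 N₀ = m²: then the open pairs guaranteed among m points are as
  -- many as the union bound over n^m choices of them requires.
  b = P 36 * t
  n = a * b
  k = r * b
  m = P (c + 61) * b
  d = 16 * b
  -- J = r^(1/4) is at least 22 · 2^t, which makes heavy rows rare enough, while N = 2 J² keeps
  -- `N * s₁` of order t r^(3/2), far below w².
  J = P (2 * t)
  N = P (4 * t + 1)
  Y₀ = P 27
  a′ = P (2 * c + 101)
  s₁ = 32 * t * w
  y = pred (P t)
  S = 17 * w
  e₀ = P (c + 40)
  D = P (c + 43)
  X = P (c + 73)
  e₃ = P (c + 26)
  s₃ = P (2 * c + 106)
  z₀ = 64 * t * m
  N₀ = q * z₀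
  q′ = pred q
  y₁ = pred (P (7 * t))

  8t≡c+64 : 8 * t ≡ c + 64
  8t≡c+64 = eq s
    where
    eq : ∀ s → 8 * (s + 128) ≡ 8 * s + 960 + 64
    eq = solve-∀

  suc-y : suc y ≡ P t
  suc-y = suc-pred (P t) {{>-nonZero (1≤P t)}}

  suc-y₁ : suc y₁ ≡ P (7 * t)
  suc-y₁ = suc-pred (P (7 * t)) {{>-nonZero (1≤P (7 * t))}}

  suc-q′ : q ≡ suc q′
  suc-q′ = sym (suc-pred q {{>-nonZero (1≤P (c + 88))}})

  r≤q : r ≤ q
  r≤q = P-mono (+-monoʳ-≤ c (m≤m+n 64 24))

  r+e≡q : r + e ≡ q
  r+e≡q = m+[n∸m]≡n r≤q

  1≤t : 1 ≤ t
  1≤t = ≤-trans (s≤s z≤n) (m≤n+m 128 s)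

  1≤b : 1 ≤ b
  1≤b = *-mono-≤ (1≤P 36) 1≤t

  a≡ : a ≡ Y₀ * a′
  a≡ = trans (cong P (eq c)) (sym (P-+ 27 (2 * c + 101)))
    where
    eq : ∀ c → 2 * c + 128 ≡ 27 + (2 * c + 101)
    eq = solve-∀

  a≡₂ : a ≡ q * e₀
  a≡₂ = trans (cong P (eq c)) (sym (P-+ (c + 88) (c + 40)))
    where
    eq : ∀ c → 2 * c + 128 ≡ c + 88 + (c + 40)
    eq = solve-∀

  a≡r*r : a ≡ r * r
  a≡r*r = trans (cong P (eq c)) (sym (P-+ (c + 64) (c + 64)))
    where
    eq : ∀ c → 2 * c + 128 ≡ c + 64 + (c + 64)
    eq = solve-∀

  ww≡ : w * w ≡ q * e₃
  ww≡ = trans (P-+ (c + 57) (c + 57)) (trans (cong P (eq c)) (sym (P-+ (c + 88) (c + 26))))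
    where
    eq : ∀ c → c + 57 + (c + 57) ≡ c + 88 + (c + 26)
    eq = solve-∀

  w*w : w * w ≡ P (2 * c + 114)
  w*w = trans (P-+ (c + 57) (c + 57)) (cong P (eq c))
    where
    eq : ∀ c → c + 57 + (c + 57) ≡ 2 * c + 114
    eq = solve-∀

  rk≡n : r * k ≡ n
  rk≡n = trans (sym (*-assoc r r b)) (cong (_* b) (sym a≡r*r))

  P-lit : ∀ l j x → l ≡ 2 ^ j → l * P x ≡ P (j + x)
  P-lit l j x refl = trans (cong (_* P x) (sym (P≡2^ j))) (P-+ j x)

  dw≡m : d * w ≡ m
  dw≡m = trans (sh b w) (cong (_* b) (trans (P-lit 16 4 (c + 57) refl) (cong P (eq c))))
    where
    sh : ∀ b w → 16 * b * w ≡ 16 * w * b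
    sh = solve-∀
    eq : ∀ c → 4 + (c + 57) ≡ c + 61
    eq = solve-∀

  w≤m : w ≤ m
  w≤m = ≤-trans (P-mono (+-monoʳ-≤ c (m≤m+n 57 4))) (≤-trans (≤-reflexive (sym (*-identityʳ _))) (*-monoʳ-≤ (P (c + 61)) 1≤b))

  1≤w : 1 ≤ w
  1≤w = 1≤P _

  4≤m : 4 ≤ m
  4≤m = ≤-trans (≤-trans (≤-trans (≤-reflexive (sym (P≡2^ 2))) (P-mono (≤-trans (m≤m+n 2 55) (m≤n+m 57 c)))) ≤-refl) w≤m

  8m≡k : 8 * m ≡ k
  8m≡k = trans (sym (*-assoc 8 (P (c + 61)) b)) (cong (_* b) (trans (P-lit 8 3 (c + 61) refl) (cong P (eq c))))
    where
    eq : ∀ c → 3 + (c + 61) ≡ c + 64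
    eq = solve-∀

  w≤q : w ≤ q
  w≤q = P-mono (+-monoʳ-≤ c (m≤m+n 57 31))

  J²≤N : 2 * (J * J) ≤ N
  J²≤N = ≤-reflexive (trans (cong (2 *_) (P-+ (2 * t) (2 * t))) (trans (P-lit 2 1 (2 * t + 2 * t) refl) (cong P (eq t))))
    where
    eq : ∀ t → 1 + (2 * t + 2 * t) ≡ 4 * t + 1
    eq = solve-∀

  2≤N : 2 ≤ N
  2≤N = ≤-trans (≤-reflexive (sym (P≡2^ 1))) (P-mono (m≤n+m 1 (4 * t)))

  wY₀ : 12 * w * Y₀ ≤ q
  wY₀ = ≤-trans (*-monoˡ-≤ Y₀ (*-monoˡ-≤ w (m≤m+n 12 4)))
    (≤-reflexive (trans (cong (_* Y₀) (P-lit 16 4 (c + 57) refl)) (trans (P-+ (4 + (c + 57)) 27) (cong P (eq c)))))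
    where
    eq : ∀ c → 4 + (c + 57) + 27 ≡ c + 88
    eq = solve-∀

  a≡2^16t : a ≡ P (16 * t)
  a≡2^16t = cong P (eq s)
    where
    eq : ∀ s → 2 * (8 * s + 960) + 128 ≡ 16 * (s + 128)
    eq = solve-∀

  r≡2^8t : r ≡ P (8 * t)
  r≡2^8t = cong P (sym 8t≡c+64)

  a^ : ∀ x → a ^ x ≡ 2 ^ (16 * t * x)
  a^ x = trans (cong (_^ x) a≡2^16t) (P-^ (16 * t) x)

  r64 : r * 64 ≡ 2 ^ (8 * t + 6)
  r64 = trans (cong (_* 64) (trans r≡2^8t (P≡2^ (8 * t)))) (2^-* (8 * t) 6)

  index-count : a ^ w * (r * 64) ≡ 2 ^ (16 * t * w + (8 * t + 6))
  index-count = trans (cong₂ _*_ (a^ w) r64) (2^-* (16 * t * w) (8 * t + 6))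

  t≤tw : t ≤ t * w
  t≤tw = ≤-trans (≤-reflexive (sym (*-identityʳ t))) (*-monoʳ-≤ t 1≤w)

  1≤tw : 1 ≤ t * w
  1≤tw = *-mono-≤ 1≤t 1≤w

  light-wins : a ^ w * (r * 64) ≤ 2 ^ s₁
  light-wins = ≤-trans (≤-reflexive index-count) (^-monoʳ-≤ 2 (begin
    16 * t * w + (8 * t + 6) ≤⟨ +-monoʳ-≤ (16 * t * w) (+-mono-≤ (*-monoʳ-≤ 8 t≤tw) (*-monoʳ-≤ 6 1≤tw)) ⟩
    16 * t * w + (8 * (t * w) + 6 * (t * w)) ≤⟨ slack (2 * (t * w)) (eq t w) ⟩
    32 * t * w                            ∎))
    where
    open ≤-Reasoning
    eq : ∀ t w → 16 * t * w + (8 * (t * w) + 6 * (t * w)) + 2 * (t * w) ≡ 32 * t * w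
    eq = solve-∀

  16≤w : 16 ≤ w
  16≤w = ≤-trans (≤-reflexive (sym (P≡2^ 4))) (P-mono (≤-trans (m≤m+n 4 53) (m≤n+m 57 c)))

  heavy-wins : 8 * (a ^ w * (r * 64)) ≤ suc y ^ S
  heavy-wins = begin
    8 * (a ^ w * (r * 64)) ≡⟨ trans (cong (8 *_) index-count) (2^-* 3 (16 * t * w + (8 * t + 6))) ⟩
    2 ^ (3 + (16 * t * w + (8 * t + 6))) ≤⟨ ^-monoʳ-≤ 2 exponents ⟩
    2 ^ (t * (17 * w)) ≡⟨ P-^ t (17 * w) ⟨
    P t ^ (17 * w) ≡⟨ cong (_^ S) suc-y ⟨
    suc y ^ S                                  ∎
    where
    open ≤-Reasoning
    9≤8t : 9 ≤ 8 * t
    9≤8t = ≤-trans (m≤m+n 9 (1015)) (*-monoʳ-≤ 8 (m≤n+m 128 s))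
    exponents : 3 + (16 * t * w + (8 * t + 6)) ≤ t * (17 * w)
    exponents = begin
      3 + (16 * t * w + (8 * t + 6)) ≡⟨ eq t w ⟩
      16 * t * w + (8 * t + 9) ≤⟨ +-monoʳ-≤ (16 * t * w) (+-monoʳ-≤ (8 * t) 9≤8t) ⟩
      16 * t * w + (8 * t + 8 * t) ≡⟨ eq₂ t w ⟩
      16 * t * w + t * 16 ≤⟨ +-monoʳ-≤ (16 * t * w) (*-monoʳ-≤ t 16≤w) ⟩
      16 * t * w + t * w ≡⟨ eq₃ t w ⟩
      t * (17 * w)                     ∎
      where
      eq : ∀ t w → 3 + (16 * t * w + (8 * t + 6)) ≡ 16 * t * w + (8 * t + 9)
      eq = solve-∀
      eq₂ : ∀ t w → 16 * t * w + (8 * t + 8 * t) ≡ 16 * t * w + t * 16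
      eq₂ = solve-∀
      eq₃ : ∀ t w → 16 * t * w + t * w ≡ t * (17 * w)
      eq₃ = solve-∀

  22≤Pt : 22 ≤ P t
  22≤Pt = ≤-trans (m≤m+n 22 106) (≤-trans (m≤n+m 128 s) (<⇒≤ (n<P t)))

  heavy-rare : a * 8 ^ suc (2 * y) ≤ 2 ^ J
  heavy-rare = begin
    a * 8 ^ suc (2 * y) ≤⟨ *-monoʳ-≤ a (^-monoʳ-≤ 8 {suc (2 * y)} {2 * P t} 2y+1≤) ⟩
    a * 8 ^ (2 * P t) ≡⟨ cong₂ _*_ (trans a≡2^16t (P≡2^ (16 * t))) (8^≡ (2 * P t)) ⟩
    2 ^ (16 * t) * 2 ^ (3 * (2 * P t)) ≡⟨ 2^-* (16 * t) (3 * (2 * P t)) ⟩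
    2 ^ (16 * t + 3 * (2 * P t)) ≤⟨ ^-monoʳ-≤ 2 exponents ⟩
    2 ^ J                            ∎
    where
    open ≤-Reasoning
    2y+1≤ : suc (2 * y) ≤ 2 * P t
    2y+1≤ = ≤-trans (n≤1+n _) (≤-reflexive (trans (eq y) (cong (2 *_) suc-y)))
      where
      eq : ∀ y → suc (suc (2 * y)) ≡ 2 * suc y
      eq = solve-∀
    exponents : 16 * t + 3 * (2 * P t) ≤ J
    exponents = begin
      16 * t + 3 * (2 * P t) ≤⟨ +-monoˡ-≤ (3 * (2 * P t)) (*-monoʳ-≤ 16 (<⇒≤ (n<P t))) ⟩
      16 * P t + 3 * (2 * P t) ≡⟨ eq (P t) ⟩
      22 * P t ≤⟨ *-monoˡ-≤ (P t) 22≤Pt ⟩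
      P t * P t ≡⟨ trans (P-+ t t) (cong P (eq₂ t)) ⟩
      J                              ∎
      where
      eq : ∀ p → 16 * p + 3 * (2 * p) ≡ 22 * p
      eq = solve-∀
      eq₂ : ∀ t → t + t ≡ 2 * t
      eq₂ = solve-∀

  degree-wins : 8 * (r * 64) ≤ X
  degree-wins = ≤-reflexive (trans (eq r) (trans (P-lit 512 9 (c + 64) refl) (cong P (eq₂ c))))
    where
    eq : ∀ r → 8 * (r * 64) ≡ 512 * r
    eq = solve-∀
    eq₂ : ∀ c → 9 + (c + 64) ≡ c + 73
    eq₂ = solve-∀

  c<e₀ : c + 40 < e₀
  c<e₀ = n<P (c + 40)

  degree-rare : a * (X * 8 ^ e₀) ≤ 2 ^ D
  degree-rare = begin
    a * (X * 8 ^ e₀) ≡⟨ cong₂ _*_ (P≡2^ (2 * c + 128)) (cong₂ _*_ (P≡2^ (c + 73)) (8^≡ e₀)) ⟩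
    2 ^ (2 * c + 128) * (2 ^ (c + 73) * 2 ^ (3 * e₀)) ≡⟨ trans (cong (2 ^ (2 * c + 128) *_) (2^-* (c + 73) (3 * e₀))) (2^-* (2 * c + 128) (c + 73 + 3 * e₀)) ⟩
    2 ^ (2 * c + 128 + (c + 73 + 3 * e₀)) ≤⟨ ^-monoʳ-≤ 2 exponents ⟩
    2 ^ D                                               ∎
    where
    open ≤-Reasoning
    exponents : 2 * c + 128 + (c + 73 + 3 * e₀) ≤ D
    exponents = begin
      2 * c + 128 + (c + 73 + 3 * e₀) ≤⟨ slack (2 * c + 4) (eq c e₀) ⟩
      5 * (c + 41) + 3 * e₀ ≤⟨ +-monoˡ-≤ (3 * e₀) (*-monoʳ-≤ 5 (≤-trans (≤-reflexive (+-suc c 40)) c<e₀)) ⟩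
      5 * e₀ + 3 * e₀ ≡⟨ eq₂ e₀ ⟩
      8 * e₀ ≡⟨ trans (P-lit 8 3 (c + 40) refl) (cong P (eq₃ c)) ⟩
      D                                          ∎
      where
      eq : ∀ c e → 2 * c + 128 + (c + 73 + 3 * e) + (2 * c + 4) ≡ 5 * (c + 41) + 3 * e
      eq = solve-∀
      eq₂ : ∀ e → 5 * e + 3 * e ≡ 8 * e
      eq₂ = solve-∀
      eq₃ : ∀ c → 3 + (c + 40) ≡ c + 43
      eq₃ = solve-∀

  sparse-wins : 8 ^ (r * 3 * e₃) * (a ^ w * (a ^ w * 64)) ≤ 4 ^ s₃
  sparse-wins = begin
    8 ^ (r * 3 * e₃) * (a ^ w * (a ^ w * 64))
      ≡⟨ cong₂ _*_ (8^≡ (r * 3 * e₃)) (cong₂ (λ u v → u * (v * 64)) (a^ w) (a^ w)) ⟩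
    2 ^ (3 * (r * 3 * e₃)) * (2 ^ (16 * t * w) * (2 ^ (16 * t * w) * 2 ^ 6))
      ≡⟨ trans (cong (λ u → 2 ^ (3 * (r * 3 * e₃)) * (2 ^ (16 * t * w) * u)) (2^-* (16 * t * w) 6))
         (trans (cong (2 ^ (3 * (r * 3 * e₃)) *_) (2^-* (16 * t * w) (16 * t * w + 6))) (2^-* (3 * (r * 3 * e₃)) (16 * t * w + (16 * t * w + 6)))) ⟩
    2 ^ (3 * (r * 3 * e₃) + (16 * t * w + (16 * t * w + 6)))
      ≤⟨ ^-monoʳ-≤ 2 exponents ⟩
    2 ^ (2 * s₃)
      ≡⟨ ^-*-assoc 2 2 s₃ ⟨
    4 ^ s₃ ∎
    where
    open ≤-Reasoning
    re₃ : r * e₃ ≡ P (2 * c + 90)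
    re₃ = trans (P-+ (c + 64) (c + 26)) (cong P (eq c))
      where
      eq : ∀ c → c + 64 + (c + 26) ≡ 2 * c + 90
      eq = solve-∀
    tw≤ : t * w ≤ P (2 * c + 58)
    tw≤ = ≤-trans (*-monoˡ-≤ w (≤-trans t≤c (<⇒≤ (n<P (c + 1))))) (≤-reflexive (trans (P-+ (c + 1) (c + 57)) (cong P (eq c))))
      where
      t≤c : t ≤ c + 1
      t≤c = slack (7 * s + 833) (eq₁ s)
        where
        eq₁ : ∀ s → s + 128 + (7 * s + 833) ≡ 8 * s + 960 + 1
        eq₁ = solve-∀
      eq : ∀ c → c + 1 + (c + 57) ≡ 2 * c + 58
      eq = solve-∀
    Q = P (2 * c + 90)
    exponents : 3 * (r * 3 * e₃) + (16 * t * w + (16 * t * w + 6)) ≤ 2 * s₃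
    exponents = begin
      3 * (r * 3 * e₃) + (16 * t * w + (16 * t * w + 6)) ≡⟨ eq₁ r e₃ t w ⟩
      9 * (r * e₃) + 32 * (t * w) + 6 ≤⟨ +-mono-≤ (+-mono-≤ (≤-reflexive (cong (9 *_) re₃)) (*-monoʳ-≤ 32 (≤-trans tw≤ (P-mono (+-monoʳ-≤ (2 * c) (m≤m+n 58 32)))))) (*-monoʳ-≤ 6 (1≤P (2 * c + 90))) ⟩
      9 * Q + 32 * Q + 6 * Q ≤⟨ slack (17 * Q) (eq₂ Q) ⟩
      64 * Q ≡⟨ P-lit 64 6 (2 * c + 90) refl ⟩
      P (6 + (2 * c + 90)) ≤⟨ P-mono (slack 11 (eq₃ c)) ⟩
      P (1 + (2 * c + 106)) ≡⟨ P-lit 2 1 (2 * c + 106) refl ⟨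
      2 * s₃                                                ∎
      where
      eq₁ : ∀ r e t w → 3 * (r * 3 * e) + (16 * t * w + (16 * t * w + 6)) ≡ 9 * (r * e) + 32 * (t * w) + 6
      eq₁ = solve-∀
      eq₂ : ∀ Q → 9 * Q + 32 * Q + 6 * Q + 17 * Q ≡ 64 * Q
      eq₂ = solve-∀
      eq₃ : ∀ c → 6 + (2 * c + 90) + 11 ≡ 1 + (2 * c + 106)
      eq₃ = solve-∀

  s₃-small : 2 * s₃ * 128 ≤ w * w
  s₃-small = ≤-reflexive (trans (eq s₃) (trans (P-lit 256 8 (2 * c + 106) refl) (trans (cong P (eq₂ c)) (sym w*w))))
    where
    eq : ∀ x → 2 * x * 128 ≡ 256 * x
    eq = solve-∀
    eq₂ : ∀ c → 8 + (2 * c + 106) ≡ 2 * c + 114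
    eq₂ = solve-∀

  s₂ = 2 * a′ + N * s₁ + D * S

  s₂-small : 4 * s₂ * 64 ≤ w * w
  s₂-small = begin
    4 * (2 * a′ + N * s₁ + D * S) * 64 ≤⟨ *-monoˡ-≤ 64 (*-monoʳ-≤ 4 (+-mono-≤ (+-monoʳ-≤ (2 * a′) Ns₁) DS)) ⟩
    4 * (2 * a′ + a′ + 17 * a′) * 64 ≤⟨ slack (3072 * a′) (eq a′) ⟩
    8192 * a′ ≡⟨ P-lit 8192 13 (2 * c + 101) refl ⟩
    P (13 + (2 * c + 101)) ≡⟨ trans (cong P (eq₂ c)) (sym w*w) ⟩
    w * w                                    ∎
    where
    open ≤-Reasoning
    eq : ∀ x → 4 * (2 * x + x + 17 * x) * 64 + 3072 * x ≡ 8192 * x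
    eq = solve-∀
    eq₂ : ∀ c → 13 + (2 * c + 101) ≡ 2 * c + 114
    eq₂ = solve-∀
    DS : D * S ≤ 17 * a′
    DS = ≤-trans (≤-reflexive (sh D w)) (*-monoʳ-≤ 17 (≤-trans (≤-reflexive (P-+ (c + 43) (c + 57))) (P-mono (slack 1 (eq₃ c)))))
      where
      sh : ∀ D w → D * (17 * w) ≡ 17 * (D * w)
      sh = solve-∀
      eq₃ : ∀ c → c + 43 + (c + 57) + 1 ≡ 2 * c + 101
      eq₃ = solve-∀
    Ns₁ : N * s₁ ≤ a′
    Ns₁ = begin
      P (4 * t + 1) * (32 * t * w) ≡⟨ sh (P (4 * t + 1)) t w ⟩
      32 * P (4 * t + 1) * (t * w) ≤⟨ *-monoʳ-≤ (32 * P (4 * t + 1)) (*-monoˡ-≤ w (<⇒≤ (n<P t))) ⟩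
      32 * P (4 * t + 1) * (P t * w) ≡⟨ cong₂ _*_ (P-lit 32 5 (4 * t + 1) refl) (P-+ t (c + 57)) ⟩
      P (5 + (4 * t + 1)) * P (t + (c + 57)) ≡⟨ P-+ (5 + (4 * t + 1)) (t + (c + 57)) ⟩
      P (5 + (4 * t + 1) + (t + (c + 57))) ≤⟨ P-mono (slack (3 * s + 358) (eq₃ s)) ⟩
      a′                                      ∎
      where
      sh : ∀ p t w → p * (32 * t * w) ≡ 32 * p * (t * w)
      sh = solve-∀
      eq₃ : ∀ s → 5 + (4 * (s + 128) + 1) + (s + 128 + (8 * s + 960 + 57)) + (3 * s + 358) ≡ 2 * (8 * s + 960) + 101
      eq₃ = solve-∀

  N₀-small : 8 * N₀ ≤ m * m
  N₀-small = ≤-reflexive (trans (sh q t m) (cong (_* m) (trans (cong (_* t) (trans (P-lit 512 9 (c + 88) refl) (trans (cong P (eq c)) (sym (P-+ (c + 61) 36))))) (*-assoc (P (c + 61)) (P 36) t))))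
    where
    sh : ∀ q t m → 8 * (q * (64 * t * m)) ≡ 512 * q * t * m
    sh = solve-∀
    eq : ∀ c → 9 + (c + 88) ≡ c + 61 + 36
    eq = solve-∀

  1≤m : 1 ≤ m
  1≤m = ≤-trans 1≤w w≤m

  n≤ : n ≤ 2 ^ (17 * t + 36)
  n≤ = begin
    a * (P 36 * t) ≤⟨ *-monoʳ-≤ a (*-monoʳ-≤ (P 36) (<⇒≤ (n<P t))) ⟩
    a * (P 36 * P t) ≡⟨ cong₂ _*_ a≡2^16t (P-+ 36 t) ⟩
    P (16 * t) * P (36 + t) ≡⟨ P-+ (16 * t) (36 + t) ⟩
    P (16 * t + (36 + t)) ≡⟨ trans (P≡2^ _) (cong (2 ^_) (eq t)) ⟩
    2 ^ (17 * t + 36)                 ∎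
    where
    open ≤-Reasoning
    eq : ∀ t → 16 * t + (36 + t) ≡ 17 * t + 36
    eq = solve-∀

  1≤q′ : 1 ≤ q′
  1≤q′ = s≤s⁻¹ (≤-trans (≤-trans (≤-reflexive (sym (P≡2^ 1))) (P-mono (≤-trans (m≤m+n 1 87) (m≤n+m 88 c)))) (≤-reflexive suc-q′))

  exposure-wins : q′ ^ N₀ * (n ^ m * (r * 64)) ≤ q ^ N₀
  exposure-wins = begin
    q′ ^ (q * z₀) * (n ^ m * (r * 64)) ≤⟨ *-monoʳ-≤ (q′ ^ (q * z₀)) index ⟩
    q′ ^ (q * z₀) * 2 ^ z₀ ≡⟨ cong (λ u → q′ ^ u * 2 ^ z₀) (cong (_* z₀) suc-q′) ⟩
    q′ ^ (z₀ + q′ * z₀) * 2 ^ z₀ ≡⟨ cong (_* 2 ^ z₀) (^-distribˡ-+-* q′ z₀ (q′ * z₀)) ⟩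
    q′ ^ z₀ * q′ ^ (q′ * z₀) * 2 ^ z₀ ≡⟨ sh (q′ ^ z₀) (q′ ^ (q′ * z₀)) (2 ^ z₀) ⟩
    q′ ^ z₀ * (2 ^ z₀ * q′ ^ (q′ * z₀)) ≤⟨ *-mono-≤ (^-monoˡ-≤ z₀ (n≤1+n q′)) (2^s-gain q′ z₀ 1≤q′) ⟩
    suc q′ ^ z₀ * suc q′ ^ (q′ * z₀) ≡⟨ ^-distribˡ-+-* (suc q′) z₀ (q′ * z₀) ⟨
    suc q′ ^ (suc q′ * z₀) ≡⟨ cong (λ u → u ^ (u * z₀)) suc-q′ ⟨
    q ^ N₀                                          ∎
    where
    open ≤-Reasoning
    sh : ∀ x y z → x * y * z ≡ x * (z * y)
    sh = solve-∀
    t≤tm : t ≤ t * m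
    t≤tm = ≤-trans (≤-reflexive (sym (*-identityʳ t))) (*-monoʳ-≤ t 1≤m)
    6≤t : 6 ≤ t
    6≤t = ≤-trans (m≤m+n 6 122) (m≤n+m 128 s)
    36≤t : 36 ≤ t
    36≤t = ≤-trans (m≤m+n 36 92) (m≤n+m 128 s)
    index : n ^ m * (r * 64) ≤ 2 ^ z₀
    index = begin
      n ^ m * (r * 64) ≤⟨ *-mono-≤ (^-monoˡ-≤ m n≤) (≤-reflexive r64) ⟩
      (2 ^ (17 * t + 36)) ^ m * 2 ^ (8 * t + 6) ≡⟨ trans (cong (_* 2 ^ (8 * t + 6)) (^-*-assoc 2 (17 * t + 36) m)) (2^-* ((17 * t + 36) * m) (8 * t + 6)) ⟩
      2 ^ ((17 * t + 36) * m + (8 * t + 6)) ≤⟨ ^-monoʳ-≤ 2 (+-mono-≤ (*-monoˡ-≤ m (+-monoʳ-≤ (17 * t) 36≤t)) (+-mono-≤ (*-monoʳ-≤ 8 t≤tm) (≤-trans 6≤t t≤tm))) ⟩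
      2 ^ ((17 * t + t) * m + (8 * (t * m) + t * m)) ≤⟨ ^-monoʳ-≤ 2 (slack {(17 * t + t) * m + (8 * (t * m) + t * m)} {64 * t * m} (37 * (t * m)) (eq t m)) ⟩
      2 ^ (64 * t * m)                                   ∎
      where
      eq : ∀ t m → (17 * t + t) * m + (8 * (t * m) + t * m) + 37 * (t * m) ≡ 64 * t * m
      eq = solve-∀

  -- The offset 128 of t is spent here: 2⁷² t² has to stay below 2^t. The factor 64 is kept for the
  -- use in `spread`, where it cancels against m = k/8.
  b² : b * b ≤ 64 * P t
  b² = begin
    P 36 * t * (P 36 * t) ≡⟨ sh (P 36) t ⟩
    P 36 * P 36 * (t * t) ≡⟨ cong (_* (t * t)) (P-+ 36 36) ⟩
    P 72 * ((s + 128) * (s + 128)) ≤⟨ *-monoʳ-≤ (P 72) (square s) ⟩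
    P 72 * P (s + 56) ≡⟨ trans (P-+ 72 (s + 56)) (cong P (eq s)) ⟩
    P (t + 0) ≡⟨ cong P (+-identityʳ t) ⟩
    P t ≤⟨ m≤m+n (P t) (63 * P t) ⟩
    64 * P t                            ∎
    where
    open ≤-Reasoning
    sh : ∀ p t → p * t * (p * t) ≡ p * p * (t * t)
    sh = solve-∀
    eq : ∀ s → 72 + (s + 56) ≡ s + 128 + 0
    eq = solve-∀
    square : ∀ s → (s + 128) * (s + 128) ≤ P (s + 56)
    square zero    = ≤-trans (≤-reflexive (sym (P≡2^ 14))) (P-mono (m≤m+n 14 42))
    square (suc s) = begin
      suc (s + 128) * suc (s + 128) ≤⟨ slack (s * s + 254 * s + 16127) (eq₁ s) ⟩
      2 * ((s + 128) * (s + 128)) ≤⟨ *-monoʳ-≤ 2 (square s) ⟩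
      2 * P (s + 56) ≡⟨ P-lit 2 1 (s + 56) refl ⟩
      P (suc s + 56)                         ∎
      where
      eq₁ : ∀ s → suc (s + 128) * suc (s + 128) + (s * s + 254 * s + 16127) ≡ 2 * ((s + 128) * (s + 128))
      eq₁ = solve-∀

  -- An m × m rectangle expects n m²/a² = k b²/(64 r) vertices. By `b²` and r = 2^(8 t) this is at
  -- most k/2^(7 t), which is the origin of y₁.
  spread : n * (m * m) * y₁ ≤ k * (a * a)
  spread = *-cancelˡ-≤ 64 (begin
    64 * (n * (m * m) * y₁) ≤⟨ *-monoʳ-≤ 64 (*-monoʳ-≤ (n * (m * m)) (≤-trans (n≤1+n y₁) (≤-reflexive suc-y₁))) ⟩
    64 * (n * (m * m) * P (7 * t)) ≡⟨ sh₁ n m (P (7 * t)) ⟩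
    n * (8 * m * (8 * m)) * P (7 * t) ≡⟨ cong₂ (λ u v → u * (v * v) * P (7 * t)) (sym rk≡n) 8m≡k ⟩
    r * k * (r * b * (r * b)) * P (7 * t) ≡⟨ sh₂ r k b (P (7 * t)) ⟩
    r * r * r * k * (b * b * P (7 * t)) ≤⟨ *-monoʳ-≤ (r * r * r * k) (*-monoˡ-≤ (P (7 * t)) b²) ⟩
    r * r * r * k * (64 * P t * P (7 * t)) ≡⟨ cong (r * r * r * k *_) (trans (*-assoc 64 (P t) (P (7 * t))) (cong (64 *_) (trans (P-+ t (7 * t)) (sym r≡2^8t)))) ⟩
    r * r * r * k * (64 * r) ≡⟨ sh₃ r k ⟩
    64 * (k * (r * r * (r * r))) ≡⟨ cong (λ u → 64 * (k * (u * u))) {r * r} {a} (sym a≡r*r) ⟩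
    64 * (k * (a * a))                              ∎)
    where
    open ≤-Reasoning
    sh₁ : ∀ n m p → 64 * (n * (m * m) * p) ≡ n * (8 * m * (8 * m)) * p
    sh₁ = solve-∀
    sh₂ : ∀ r k b p → r * k * (r * b * (r * b)) * p ≡ r * r * r * k * (b * b * p)
    sh₂ = solve-∀
    sh₃ : ∀ r k → r * r * r * k * (64 * r) ≡ 64 * (k * (r * r * (r * r)))
    sh₃ = solve-∀

  dense-wins : 8 ^ k * (a ^ m * (a ^ m * 4)) ≤ suc y₁ ^ k
  dense-wins = begin
    8 ^ k * (a ^ m * (a ^ m * 4))
      ≡⟨ cong₂ _*_ (8^≡ k) (cong₂ (λ u v → u * (v * 4)) (a^ m) (a^ m)) ⟩
    2 ^ (3 * k) * (2 ^ (16 * t * m) * (2 ^ (16 * t * m) * 2 ^ 2))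
      ≡⟨ trans (cong (λ u → 2 ^ (3 * k) * (2 ^ (16 * t * m) * u)) (2^-* (16 * t * m) 2))
         (trans (cong (2 ^ (3 * k) *_) (2^-* (16 * t * m) (16 * t * m + 2))) (2^-* (3 * k) (16 * t * m + (16 * t * m + 2)))) ⟩
    2 ^ (3 * k + (16 * t * m + (16 * t * m + 2)))
      ≤⟨ ^-monoʳ-≤ 2 exponents ⟩
    2 ^ (7 * t * k)
      ≡⟨ trans (cong (_^ k) suc-y₁) (P-^ (7 * t) k) ⟨
    suc y₁ ^ k ∎
    where
    open ≤-Reasoning
    1≤k : 1 ≤ k
    1≤k = ≤-trans 1≤m (≤-trans (m≤m+n m (7 * m)) (≤-reflexive 8m≡k))
    5≤t : 5 ≤ t
    5≤t = ≤-trans (m≤m+n 5 123) (m≤n+m 128 s)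
    exponents : 3 * k + (16 * t * m + (16 * t * m + 2)) ≤ 7 * t * k
    exponents = begin
      3 * k + (16 * t * m + (16 * t * m + 2)) ≡⟨ eq t m k ⟩
      3 * k + 2 * 1 + 4 * t * (8 * m) ≤⟨ +-mono-≤ (+-monoʳ-≤ (3 * k) (*-monoʳ-≤ 2 1≤k)) (≤-reflexive (cong (4 * t *_) 8m≡k)) ⟩
      3 * k + 2 * k + 4 * t * k ≡⟨ eq₂ k t ⟩
      5 * k + 4 * t * k ≤⟨ +-monoˡ-≤ (4 * t * k) (*-monoˡ-≤ k 5≤t) ⟩
      t * k + 4 * t * k ≤⟨ slack (2 * (t * k)) (eq₃ t k) ⟩
      7 * t * k                                  ∎
      where
      eq : ∀ t m k → 3 * k + (16 * t * m + (16 * t * m + 2)) ≡ 3 * k + 2 * 1 + 4 * t * (8 * m)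
      eq = solve-∀
      eq₂ : ∀ k t → 3 * k + 2 * k + 4 * t * k ≡ 5 * k + 4 * t * k
      eq₂ = solve-∀
      eq₃ : ∀ t k → t * k + 4 * t * k + 2 * (t * k) ≡ 7 * t * k
      eq₃ = solve-∀

  -- With weight 16 a fibre of mean b has moment at most 8^(15 b) = 2^(45 b), against more than
  -- 2^(64 b) at the threshold d + 1 = 16 b + 1. The difference pays for the choice of the
  -- coordinate value.
  fibre-wins : 8 ^ (15 * b) * (a * 4) ≤ 16 ^ suc d
  fibre-wins = begin
    8 ^ (15 * b) * (a * 4) ≡⟨ cong₂ _*_ (8^≡ (15 * b)) (cong (_* 4) (trans a≡2^16t (P≡2^ (16 * t)))) ⟩
    2 ^ (3 * (15 * b)) * (2 ^ (16 * t) * 2 ^ 2) ≡⟨ trans (cong (2 ^ (3 * (15 * b)) *_) (2^-* (16 * t) 2)) (2^-* (3 * (15 * b)) (16 * t + 2)) ⟩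
    2 ^ (3 * (15 * b) + (16 * t + 2)) ≤⟨ ^-monoʳ-≤ 2 exponents ⟩
    2 ^ (4 * suc d) ≡⟨ ^-*-assoc 2 4 (suc d) ⟨
    16 ^ suc d                                  ∎
    where
    open ≤-Reasoning
    t≤b : t ≤ b
    t≤b = ≤-trans (≤-reflexive (sym (*-identityˡ t))) (*-monoˡ-≤ t (1≤P 36))
    exponents : 3 * (15 * b) + (16 * t + 2) ≤ 4 * suc (16 * b)
    exponents = begin
      3 * (15 * b) + (16 * t + 2) ≤⟨ +-monoʳ-≤ (3 * (15 * b)) (+-monoˡ-≤ 2 (*-monoʳ-≤ 16 t≤b)) ⟩
      3 * (15 * b) + (16 * b + 2) ≤⟨ slack (3 * b + 2) (eq b) ⟩
      4 * suc (16 * b)                  ∎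
      where
      eq : ∀ b → 3 * (15 * b) + (16 * b + 2) + (3 * b + 2) ≡ 4 * suc (16 * b)
      eq = solve-∀

  q-cond : ∀ {ℓ} (Q : ℕ → Set ℓ) → Q q → Q (r + e)
  q-cond Q = subst Q (sym r+e≡q)

  large-packing : Packing r n
  large-packing = from (RandomCoordinates.coordinates a n m k d b y₁ 15 (1≤P _) (*-mono-≤ (1≤P _) 1≤b) refl spread dense-wins fibre-wins)
    where
    module C = RandomCoordinates a n m k d b y₁ 15 (1≤P _) (*-mono-≤ (1≤P _) 1≤b) refl spread dense-wins fibre-wins using (Spread; origin)
    module R = RandomMatrix r e a w (1≤P _) (1≤P _) (q-cond (w ≤_) w≤q) N Y₀ a′ s₁ J 2≤N (1≤P 27) J²≤N (q-cond (12 * w * Y₀ ≤_) wY₀) a≡ light-wins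
      y S heavy-rare heavy-wins e₀ D X (1≤P _) (q-cond (λ u → a ≡ u * e₀) a≡₂) degree-rare degree-wins
      e₃ s₃ (q-cond (λ u → w * w ≡ u * e₃) ww≡) sparse-wins
    from : ∃[ α ] ∃[ β ] C.Spread α β → Packing r n
    from (α , β , no-dense , α-fibres , β-fibres) = build (R.good-matrices n m N₀ q′ (trans r+e≡q suc-q′) 1≤q′
        (q-cond (λ u → q′ ^ N₀ * (n ^ m * (r * 64)) ≤ u ^ N₀) exposure-wins) α β)
      where
      build : _ → Packing r n
      build (A , B , (A₁ , A₂ , A₃) , (B₁ , B₂ , B₃) , A-exposed , B-exposed) =
        Assemble.packing e A B α β (proj₁ C.origin) w m k d N₀ R.s₂ s₃ 1≤w w≤m (≤-reflexive dw≡m) 4≤m s₂-small s₃-small N₀-small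
          A₁ A₂ A₃ B₁ B₂ B₃ A-exposed B-exposed α-fibres β-fibres no-dense (1≤P _) (≤-reflexive rk≡n)

-- Ramsey theorem for triangles

∑-mono-strict : ∀ {xs : List A} {f g x} → (∀ y → f y ≤ g y) → x ∈ xs → f x < g x → ∑ xs f < ∑ xs g
∑-mono-strict {xs = _ ∷ xs} h (here refl) lt = +-mono-<-≤ lt (∑-mono xs h)
∑-mono-strict h (there m)   lt = +-mono-≤-< (h _) (∑-mono-strict h m lt)

𝟙-mono : ∀ {P Q : Set} (P? : Dec P) (Q? : Dec Q) → (P → Q) → 𝟙 (does P?) ≤ 𝟙 (does Q?)
𝟙-mono (no _)  Q?      f = z≤n
𝟙-mono (yes p) (yes _) f = ≤-refl
𝟙-mono (yes p) (no ¬q) f = contradiction (f p) ¬q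

module Ramsey (K : ℕ) (c₀ : Fin K) where

  bound : ℕ → ℕ
  bound zero    = 0
  bound (suc L) = suc (K * bound L)

  module _ {M : ℕ} (κ : Fin M → Fin M → Fin K) where

    -- x₀ < x₁ < … where the colour of a pair is decided by its smaller element.
    record EndColoured (L : ℕ) (xs : List (Fin M)) : Set where
      field
        point  : Fin L → Fin M
        colour : Fin L → Fin K
        inside : ∀ i → point i ∈ xs
        rising : ∀ i j → toℕ i < toℕ j → toℕ (point i) < toℕ (point j)
        agrees : ∀ i j → toℕ i < toℕ j → κ (point i) (point j) ≡ colour i

    end-coloured : ∀ L xs → AllPairs (λ x y → toℕ x < toℕ y) xs → bound L ≤ length xs → EndColoured L xs
    end-coloured zero    xs sorted h = record { point = λ () ; colour = λ () ; inside = λ () ; rising = λ () ; agrees = λ () }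
    end-coloured (suc L) (x ∷ ys) (x< ∷ sorted) (s≤s h) = record
      { point  = λ { zero → x ; (suc i) → R.point i }
      ; colour = λ { zero → c ; (suc i) → R.colour i }
      ; inside = λ { zero → here refl ; (suc i) → there (⊆ys (R.inside i)) }
      ; rising = λ { zero (suc j) _ → All.lookup x< (⊆ys (R.inside j)) ; (suc i) (suc j) (s≤s lt) → R.rising i j lt }
      ; agrees = λ { zero (suc j) _ → does⇒≡ (∈-filterᵇ⇒ p ys (R.inside j)) ; (suc i) (suc j) (s≤s lt) → R.agrees i j lt } }
      where
      large : ∃[ c ] bound L ≤ multiplicity (κ x) ys c
      large = some-large (allFin K) (multiplicity (κ x) ys) (bound L)
        (≤-trans (≤-reflexive (cong (_* bound L) (length-allFin K))) (≤-trans h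
          (≤-reflexive (trans (sym (length-as-∑ ys)) (trans (∑-fibres (κ x) ys (λ _ → 1)) (∑-cong (allFin K) (λ c → *-identityʳ _)))))))
        (subst (1 ≤_) (sym (length-allFin K)) (≤-trans (s≤s z≤n) (toℕ<n c₀)))
      c = proj₁ large
      p : Fin M → Bool
      p y = does (κ x y ≟ c)
      zs = filterᵇ p ys
      ⊆ys : ∀ {z} → z ∈ zs → z ∈ ys
      ⊆ys = proj₁ ∘ ∈-filter⁻ (T? ∘ p)
      if-one : ∀ b → 𝟙 b ≡ (if b then 1 else 0)
      if-one true  = refl
      if-one false = refl
      module R = EndColoured (end-coloured L zs (AllPairs.filter⁺ _ sorted) (≤-trans (proj₂ large) (≤-reflexive
        (trans (∑-cong ys (λ y → if-one (p y))) (trans (sym (∑-filterᵇ p ys (λ _ → 1))) (length-as-∑ zs))))))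

  size-needed : ℕ
  size-needed = bound (suc (suc K))

  mono-triple : ∀ (κ : Fin size-needed → Fin size-needed → Fin K) →
    ∃[ x ] ∃[ y ] ∃[ z ] (toℕ x < toℕ y × toℕ y < toℕ z × κ x y ≡ κ y z × κ x y ≡ κ x z)
  -- There are K + 2 points, but the pigeonhole principle is applied to the first K + 1 only, so the
  -- last one is free to be the third vertex.
  mono-triple κ = build (pigeonhole (n<1+n K) (E.colour ∘ inject₁))
    where
    sorted : AllPairs (λ x y → toℕ x < toℕ y) (allFin size-needed)
    sorted = AllPairs.tabulate⁺-< (λ lt → lt)
    module E = EndColoured (end-coloured κ (suc (suc K)) (allFin size-needed) sorted (≤-reflexive (sym (length-allFin size-needed))))
    build : ∃[ i ] ∃[ j ] (toℕ i < toℕ j × E.colour (inject₁ i) ≡ E.colour (inject₁ j)) → _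
    build (i , j , i<j , same) = E.point i′ , E.point j′ , E.point l , E.rising i′ j′ i′<j′ , E.rising j′ l j′<l ,
        trans (E.agrees i′ j′ i′<j′) (trans same (sym (E.agrees j′ l j′<l))) ,
        trans (E.agrees i′ j′ i′<j′) (sym (E.agrees i′ l (<-trans i′<j′ j′<l)))
      where
      i′ = inject₁ i
      j′ = inject₁ j
      l  = fromℕ (suc K)
      i′<j′ : toℕ i′ < toℕ j′
      i′<j′ = subst₂ _<_ (sym (toℕ-inject₁ i)) (sym (toℕ-inject₁ j)) i<j
      j′<l : toℕ j′ < toℕ l
      j′<l = subst₂ _<_ (sym (toℕ-inject₁ j)) (sym (toℕ-fromℕ (suc K))) (toℕ<n j)

-- Rigid colourings

minimiser : ∀ (xs : List A) x₀ → x₀ ∈ xs → (f : A → ℕ) → ∃[ x ] (∀ y → y ∈ xs → f x ≤ f y)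
minimiser (x ∷ []) x₀ m f = x , λ { y (here refl) → ≤-refl }
minimiser (x ∷ xs@(z ∷ _)) x₀ m f with minimiser xs z (here refl) f
... | w , min with f x ≤? f w
... | yes le = x , λ { y (here refl) → ≤-refl ; y (there p) → ≤-trans le (min y p) }
... | no ¬le = w , λ { y (here refl) → <⇒≤ (≰⇒> ¬le) ; y (there p) → min y p }

MonoTriple : ∀ {r N} → (Fin N → Fin N → Fin r) → Fin N × Fin N × Fin N → Set
MonoTriple g (x , y , z) = (toℕ x < toℕ y × toℕ y < toℕ z) × (g x y ≡ g y z × g x y ≡ g x z)

-- The set of monochromatic triples is minimal under inclusion. Only values at x < y enter, so
-- neither g nor h has to be symmetric.
record RigidColouring (r : ℕ) : Set where
  field
    N     : ℕ
    g     : Fin N → Fin N → Fin r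
    p q s : Fin N
    pqs-mono : MonoTriple g (p , q , s)
    rigid : ∀ (h : Fin N → Fin N → Fin r) → (∀ t → MonoTriple h t → MonoTriple g t) → ∀ t → MonoTriple g t → MonoTriple h t

-- A colouring of the pairs x < y with as few monochromatic triples as possible is rigid.
module Rigid (r : ℕ) (c₀ : Fin r) where

  open Ramsey r c₀ using (size-needed; mono-triple)

  N = size-needed
  Triple = Fin N × Fin N × Fin N

  Mono : (Fin N → Fin N → Fin r) → Triple → Set
  Mono = MonoTriple

  mono? : ∀ g t → Dec (Mono g t)
  mono? g (x , y , z) = (toℕ x <? toℕ y ×-dec toℕ y <? toℕ z) ×-dec (g x y ≟ g y z ×-dec g x y ≟ g x z)

  triples-at₂ : Fin N → Fin N → List Triple
  triples-at₂ x y = map (λ z → x , y , z) (allFin N)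

  triples-at : Fin N → List Triple
  triples-at x = concatMap (triples-at₂ x) (allFin N)

  triples : List Triple
  triples = concatMap triples-at (allFin N)

  ∈-triples : ∀ t → t ∈ triples
  ∈-triples (x , y , z) = ∈-concatMap⁺ triples-at (∈-allFin x) (∈-concatMap⁺ (triples-at₂ x) (∈-allFin y) (∈-map⁺ (λ z → x , y , z) (∈-allFin z)))

  monos : (Fin N → Fin N → Fin r) → ℕ
  monos g = ∑ triples (λ t → 𝟙 (does (mono? g t)))

  colourings : List (Matrix (Fin r) N N)
  colourings = vecs (vecs (allFin r) N) N

  ∈-colourings : ∀ M → M ∈ colourings
  ∈-colourings M = ∈-vecs _ M (λ x → ∈-vecs _ (lookup M x) (λ y → ∈-allFin _))

  private
    least = minimiser colourings (tabulated (λ _ _ → c₀)) (∈-colourings _) (monos ∘ entry)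

  g : Fin N → Fin N → Fin r
  g = entry (proj₁ least)

  g-least : ∀ h → monos g ≤ monos h
  g-least h = ≤-trans (proj₂ least (tabulated h) (∈-colourings _)) (∑-mono triples (λ t → mono-≤ t))
    where
    mono-≤ : ∀ t → 𝟙 (does (mono? (entry (tabulated h)) t)) ≤ 𝟙 (does (mono? h t))
    mono-≤ t@(x , y , z) = 𝟙-mono (mono? (entry (tabulated h)) t) (mono? h t) λ (lt , e₁ , e₂) → lt ,
      trans (sym (entry-tabulated h x y)) (trans e₁ (entry-tabulated h y z)) ,
      trans (sym (entry-tabulated h x y)) (trans e₂ (entry-tabulated h x z))

  rigid : ∀ h → (∀ t → Mono h t → Mono g t) → ∀ t → Mono g t → Mono h t
  rigid h sub t mono with mono? h t
  ... | yes p = p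
  ... | no ¬p = contradiction (∑-mono-strict h≤g (∈-triples t) strict) (≤⇒≯ (g-least h))
    where
    h≤g : ∀ s → 𝟙 (does (mono? h s)) ≤ 𝟙 (does (mono? g s))
    h≤g s = 𝟙-mono (mono? h s) (mono? g s) (sub s)
    strict : 𝟙 (does (mono? h t)) < 𝟙 (does (mono? g t))
    strict = subst₂ (λ b b′ → 𝟙 b < 𝟙 b′) (sym (dec-false (mono? h t) ¬p)) (sym (dec-true (mono? g t) mono)) (s≤s z≤n)

  p q s : Fin N
  p = proj₁ (mono-triple g)
  q = proj₁ (proj₂ (mono-triple g))
  s = proj₁ (proj₂ (proj₂ (mono-triple g)))

  pqs-mono : Mono g (p , q , s)
  pqs-mono = let lt₁ , lt₂ , e₁ , e₂ = proj₂ (proj₂ (proj₂ (mono-triple g))) in (lt₁ , lt₂) , e₁ , e₂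

  rigid-colouring : RigidColouring r
  rigid-colouring = record { N = N ; g = g ; p = p ; q = q ; s = s ; pqs-mono = pqs-mono ; rigid = rigid }

-- Removing unwanted triangles

∧-true⁺ : ∀ {b c} → b ≡ true → c ≡ true → b ∧ c ≡ true
∧-true⁺ refl refl = refl

data Order : Set where
  same below above : Order

opposite : Order → Order
opposite same  = same
opposite below = above
opposite above = below

stands : ∀ {M} → Order → Fin M → Fin M → Bool
stands same  x y = does (x ≟ y)
stands below x y = does (toℕ x <? toℕ y)
stands above x y = does (toℕ y <? toℕ x)

stands-opposite : ∀ {M} o (x y : Fin M) → stands o x y ≡ stands (opposite o) y x
stands-opposite below x y = refl
stands-opposite above x y = refl
stands-opposite same  x y = does-sym _≟_ x y

data Class : Set where
  first second third other : Class

-- The order in which two vertices must stand: no three levels agree with it on a first, a second and a third,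
-- but levels exist as soon as one of these classes is missing.
order : Class → Class → Order
order first  third  = below
order third  first  = above
order other  other  = same
order other  _      = above
order _      other  = below
order _      _      = same

order-opposite : ∀ C C′ → order C′ C ≡ opposite (order C C′)
order-opposite first  first  = refl
order-opposite first  second = refl
order-opposite first  third  = refl
order-opposite first  other  = refl
order-opposite second first  = refl
order-opposite second second = refl
order-opposite second third  = refl
order-opposite second other  = refl
order-opposite third  first  = refl
order-opposite third  second = refl
order-opposite third  third  = refl
order-opposite third  other  = refl
order-opposite other  first  = refl
order-opposite other  second = refl
order-opposite other  third  = refl
order-opposite other  other  = refl

-- If a second occurs, a first and a third do not both occur, and all three classes can share the
-- bottom level. Otherwise the third moves one level up. The remaining types stay above both, since
-- they could not be level with a first and a third at once.
level : Bool → Class → Fin 3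
level has-second first  = zero
level has-second second = zero
level true       third  = zero
level false      third  = suc zero
level has-second other  = suc (suc zero)

level-order : ∀ b C C′ → (C ≡ second → b ≡ true) → (C′ ≡ second → b ≡ true) →
  (b ≡ true → C ≡ first → C′ ≡ third → ⊥) → (b ≡ true → C ≡ third → C′ ≡ first → ⊥) →
  stands (order C C′) (level b C) (level b C′) ≡ true
level-order b     first  first  h h′ f f′ = refl
level-order b     first  second h h′ f f′ = refl
level-order true  first  third  h h′ f f′ = ⊥-elim (f refl refl refl)
level-order false first  third  h h′ f f′ = refl
level-order b     first  other  h h′ f f′ = refl
level-order b     second first  h h′ f f′ = refl
level-order b     second second h h′ f f′ = refl
level-order b     second third  h h′ f f′ rewrite h refl = refl
level-order b     second other  h h′ f f′ = refl
level-order true  third  first  h h′ f f′ = ⊥-elim (f′ refl refl refl)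
level-order false third  first  h h′ f f′ = refl
level-order b     third  second h h′ f f′ rewrite h′ refl = refl
level-order true  third  third  h h′ f f′ = refl
level-order false third  third  h h′ f f′ = refl
level-order true  third  other  h h′ f f′ = refl
level-order false third  other  h h′ f f′ = refl
level-order b     other  first  h h′ f f′ = refl
level-order b     other  second h h′ f f′ = refl
level-order true  other  third  h h′ f f′ = refl
level-order false other  third  h h′ f f′ = refl
level-order b     other  other  h h′ f f′ = refl

module Lifting (r : ℕ) (c₀ : Fin r) {T : Set} (_≟ᵀ_ : DecidableEquality T) (E : T → T → Bool) (E-sym : ∀ t u → E t u ≡ E u t) where

  record BadTriple : Set where
    constructor bad-triple
    field
      i j k : T
      i≢j : i ≢ j
      j≢k : j ≢ k
      i≢k : i ≢ k

  Occurs : T → ∀ {n} → (Fin n → T) → Set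
  Occurs t b = ∃[ i ] b i ≡ t

  Avoids : ∀ {n} → (Fin n → T) → BadTriple → Set
  Avoids b s = let open BadTriple s in Occurs i b → Occurs j b → Occurs k b → ⊥

  Section : ∀ {p n} (type : Fin p → T) (adjacent : Fin p → Fin p → Bool) (c : Fin p → Fin p → Fin r) (χ : T → T → Fin r) (b : Fin n → T) → Set
  Section {p} {n} type adjacent c χ b = Σ (Fin n → Fin p) λ σ → (∀ i → type (σ i) ≡ b i) ×
    (∀ i j → E (b i) (b j) ≡ true → adjacent (σ i) (σ j) ≡ true × c (σ i) (σ j) ≡ χ (b i) (b j))

  -- A graph over the type graph E without triangles of the bad types in which every colouring looks, on some
  -- copy of each tuple of types avoiding the bad triples, like a colouring of E.
  record Lifted (bad : List BadTriple) : Set where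
    field
      size      : ℕ
      type      : Fin size → T
      adjacent  : Fin size → Fin size → Bool
      adjacent-sym : ∀ u v → adjacent u v ≡ adjacent v u
      adjacent⇒E   : ∀ u v → adjacent u v ≡ true → E (type u) (type v) ≡ true
      no-bad    : ∀ s → s ∈ bad → ∀ u v w → type u ≡ BadTriple.i s → type v ≡ BadTriple.j s → type w ≡ BadTriple.k s →
                  adjacent u v ≡ true → adjacent v w ≡ true → adjacent u w ≡ true → ⊥
      -- One χ serves all tuples at once: triples of types will limit its monochromatic triangles,
      -- and the tuple of the packing will then contradict it.
      sections  : ∀ (c : Fin size → Fin size → Fin r) → ∃[ χ ] (∀ {n} (b : Fin n → T) → (∀ s → s ∈ bad → Avoids b s) → Section type adjacent c χ b)

  module Step (s : BadTriple) (bad : List BadTriple) (Q : Lifted bad) where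
    open BadTriple s
    open Lifted Q

    class : T → Class
    class t with t ≟ᵀ i | t ≟ᵀ j | t ≟ᵀ k
    ... | yes _ | _     | _     = first
    ... | no _  | yes _ | _     = second
    ... | no _  | no _  | yes _ = third
    ... | no _  | no _  | no _  = other

    class-first : ∀ t → class t ≡ first → t ≡ i
    class-first t e with t ≟ᵀ i | t ≟ᵀ j | t ≟ᵀ k
    ... | yes p | _     | _     = p
    class-first t () | no _ | yes _ | _
    class-first t () | no _ | no _ | yes _
    class-first t () | no _ | no _ | no _

    class-second : ∀ t → class t ≡ second → t ≡ j
    class-second t e with t ≟ᵀ i | t ≟ᵀ j | t ≟ᵀ k
    ... | no _ | yes p | _     = p
    class-second t () | yes _ | _ | _
    class-second t () | no _ | no _ | yes _
    class-second t () | no _ | no _ | no _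

    class-third : ∀ t → class t ≡ third → t ≡ k
    class-third t e with t ≟ᵀ i | t ≟ᵀ j | t ≟ᵀ k
    ... | no _ | no _ | yes p = p
    class-third t () | yes _ | _ | _
    class-third t () | no _ | yes _ | _
    class-third t () | no _ | no _ | no _

    class-i : class i ≡ first
    class-i with i ≟ᵀ i | i ≟ᵀ j | i ≟ᵀ k
    ... | yes _ | _ | _ = refl
    ... | no ne | _ | _ = contradiction refl ne

    class-j : class j ≡ second
    class-j with j ≟ᵀ i | j ≟ᵀ j | j ≟ᵀ k
    ... | yes e | _     | _ = contradiction (sym e) i≢j
    ... | no _  | yes _ | _ = refl
    ... | no _  | no ne | _ = contradiction refl ne

    class-k : class k ≡ third
    class-k with k ≟ᵀ i | k ≟ᵀ j | k ≟ᵀ k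
    ... | yes e | _     | _ = contradiction (sym e) i≢k
    ... | no _  | yes e | _ = contradiction (sym e) j≢k
    ... | no _  | no _  | yes _ = refl
    ... | no _  | no _  | no ne = contradiction refl ne

    orderᵀ : T → T → Order
    orderᵀ t u = order (class t) (class u)

    -- A colour per pair of levels x, y: the colours of all four kinds of pairs of vertices over them.
    profiles = r ^ (4 * (size * size))

    open Ramsey profiles (funToFin {4 * (size * size)} (λ _ → c₀)) using (size-needed; mono-triple)
    M = size-needed

    index : Fin 4 → Fin size → Fin size → Fin (4 * (size * size))
    index f u v = combine f (combine u v)

    base : Fin (size * M) → Fin size
    base w = proj₁ (remQuot {size} M w)

    height : Fin (size * M) → Fin M
    height w = proj₂ (remQuot {size} M w)

    base-combine : ∀ u x → base (combine u x) ≡ u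
    base-combine u x = cong proj₁ (remQuot-combine {size} u x)

    height-combine : ∀ u x → height (combine {size} u x) ≡ x
    height-combine u x = cong proj₂ (remQuot-combine {size} u x)

    type′ : Fin (size * M) → T
    type′ = type ∘ base

    adjacent′ : Fin (size * M) → Fin (size * M) → Bool
    adjacent′ w w′ = adjacent (base w) (base w′) ∧ stands (orderᵀ (type′ w) (type′ w′)) (height w) (height w′)

    adjacent′-sym : ∀ w w′ → adjacent′ w w′ ≡ adjacent′ w′ w
    adjacent′-sym w w′ = cong₂ _∧_ (adjacent-sym _ _) (trans (stands-opposite (orderᵀ (type′ w) (type′ w′)) (height w) (height w′))
      (cong (λ o → stands o (height w′) (height w)) (sym (order-opposite (class (type′ w)) (class (type′ w′))))))

    adjacent′⇒ : ∀ w w′ → adjacent′ w w′ ≡ true → adjacent (base w) (base w′) ≡ true × stands (orderᵀ (type′ w) (type′ w′)) (height w) (height w′) ≡ true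
    adjacent′⇒ w w′ = ∧-true (adjacent (base w) (base w′))

    no-bad-s : ∀ u v w → type′ u ≡ i → type′ v ≡ j → type′ w ≡ k → adjacent′ u v ≡ true → adjacent′ v w ≡ true → adjacent′ u w ≡ true → ⊥
    no-bad-s u v w tu tv tw uv vw uw = <-irrefl (cong toℕ (trans xy yz)) xz
      where
      at : ∀ {C C′ t t′ x y} → class t ≡ C → class t′ ≡ C′ → stands {M} (orderᵀ t t′) x y ≡ true → stands (order C C′) x y ≡ true
      at refl refl h = h
      xy : height u ≡ height v
      xy = does≡true⇒ (_ ≟ _) (at (trans (cong class tu) class-i) (trans (cong class tv) class-j) (proj₂ (adjacent′⇒ u v uv)))
      yz : height v ≡ height w
      yz = does≡true⇒ (_ ≟ _) (at (trans (cong class tv) class-j) (trans (cong class tw) class-k) (proj₂ (adjacent′⇒ v w vw)))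
      xz : toℕ (height u) < toℕ (height w)
      xz = does≡true⇒ (_ <? _) (at (trans (cong class tu) class-i) (trans (cong class tw) class-k) (proj₂ (adjacent′⇒ u w uw)))

    no-bad′ : ∀ s′ → s′ ∈ s ∷ bad → ∀ u v w → type′ u ≡ BadTriple.i s′ → type′ v ≡ BadTriple.j s′ → type′ w ≡ BadTriple.k s′ →
              adjacent′ u v ≡ true → adjacent′ v w ≡ true → adjacent′ u w ≡ true → ⊥
    no-bad′ s′ (here refl) u v w tu tv tw uv vw uw = no-bad-s u v w tu tv tw uv vw uw
    no-bad′ s′ (there m)   u v w tu tv tw uv vw uw = no-bad s′ m (base u) (base v) (base w) tu tv tw
      (proj₁ (adjacent′⇒ u v uv)) (proj₁ (adjacent′⇒ v w vw)) (proj₁ (adjacent′⇒ u w uw))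

    module _ (c : Fin (size * M) → Fin (size * M) → Fin r) where

      kinds : Fin M → Fin M → Fin 4 → Fin size → Fin size → Fin r
      kinds x y zero                   u v = c (combine u x) (combine v y)
      kinds x y (suc zero)             u v = c (combine u y) (combine v x)
      kinds x y (suc (suc zero))       u v = c (combine u x) (combine v x)
      kinds x y (suc (suc (suc zero))) u v = c (combine u y) (combine v y)

      at-pair : Fin M → Fin M → Fin 4 → Fin size × Fin size → Fin r
      at-pair x y f (u , v) = kinds x y f u v

      at-code : Fin M → Fin M → Fin 4 × Fin (size * size) → Fin r
      at-code x y (f , a) = at-pair x y f (remQuot {size} size a)

      flat : Fin M → Fin M → Fin (4 * (size * size)) → Fin r
      flat x y a = at-code x y (remQuot {4} (size * size) a)

      flat-index : ∀ x y f u v → flat x y (index f u v) ≡ kinds x y f u v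
      flat-index x y f u v = trans (cong (at-code x y) (remQuot-combine {4} {size * size} f (combine u v)))
                                   (cong (at-pair x y f) (remQuot-combine {size} {size} u v))

      profile : Fin M → Fin M → Fin profiles
      profile x y = funToFin (flat x y)

      profile⇒kinds : ∀ {x y x′ y′} → profile x y ≡ profile x′ y′ → ∀ f u v → kinds x y f u v ≡ kinds x′ y′ f u v
      profile⇒kinds {x} {y} {x′} {y′} e f u v = begin
        kinds x y f u v ≡⟨ flat-index x y f u v ⟨
        flat x y (index f u v) ≡⟨ finToFun-funToFin (flat x y) (index f u v) ⟨
        finToFun (profile x y) (index f u v) ≡⟨ cong (λ z → finToFun z (index f u v)) e ⟩
        finToFun (profile x′ y′) (index f u v) ≡⟨ finToFun-funToFin (flat x′ y′) (index f u v) ⟩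
        flat x′ y′ (index f u v) ≡⟨ flat-index x′ y′ f u v ⟩
        kinds x′ y′ f u v                               ∎
        where open ≡-Reasoning

      homogeneous = mono-triple profile

      rung : Fin 3 → Fin M
      rung zero             = proj₁ homogeneous
      rung (suc zero)       = proj₁ (proj₂ homogeneous)
      rung (suc (suc zero)) = proj₁ (proj₂ (proj₂ homogeneous))

      rising : ∀ x y → toℕ x < toℕ y → toℕ (rung x) < toℕ (rung y)
      rising zero (suc zero) _ = proj₁ (proj₂ (proj₂ (proj₂ homogeneous)))
      rising (suc zero) (suc (suc zero)) _ = proj₁ (proj₂ (proj₂ (proj₂ (proj₂ homogeneous))))
      rising zero (suc (suc zero)) _ = <-trans (rising zero (suc zero) (s≤s z≤n)) (rising (suc zero) (suc (suc zero)) (s≤s (s≤s z≤n)))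
      rising (suc zero) (suc zero) (s≤s ())
      rising (suc (suc zero)) (suc zero) (s≤s ())
      rising (suc (suc zero)) (suc (suc zero)) (s≤s (s≤s ()))

      stands-rung : ∀ o x y → stands o x y ≡ true → stands o (rung x) (rung y) ≡ true
      stands-rung same  x y h = dec-true (rung x ≟ rung y) (cong rung (does≡true⇒ (x ≟ y) h))
      stands-rung below x y h = dec-true (_ <? _) (rising x y (does≡true⇒ (_ <? _) h))
      stands-rung above x y h = dec-true (_ <? _) (rising y x (does≡true⇒ (_ <? _) h))

      ground step : Fin M
      ground = rung zero
      step   = rung (suc zero)

      same-profile : ∀ x y → toℕ x < toℕ y → profile (rung x) (rung y) ≡ profile ground step
      same-profile zero (suc zero) _ = refl
      same-profile (suc zero) (suc (suc zero)) _ = sym (proj₁ (proj₂ (proj₂ (proj₂ (proj₂ (proj₂ homogeneous))))))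
      same-profile zero (suc (suc zero)) _ = sym (proj₂ (proj₂ (proj₂ (proj₂ (proj₂ (proj₂ homogeneous))))))
      same-profile (suc zero) (suc zero) (s≤s ())
      same-profile (suc (suc zero)) (suc zero) (s≤s ())
      same-profile (suc (suc zero)) (suc (suc zero)) (s≤s (s≤s ()))

      -- On homogeneous levels the colour of a pair depends only on its two base vertices and on how
      -- their levels stand to each other.
      projected : Order → Fin size → Fin size → Fin r
      projected same  u v = c (combine u ground) (combine v ground)
      projected below u v = c (combine u ground) (combine v step)
      projected above u v = c (combine u step) (combine v ground)

      -- Levels are compared through pairs of levels: the two lower ones agree as the lower members
      -- of the pairs with the top one, and the top one agrees with the middle one as the upper
      -- member of a pair.
      level-colour : ∀ x u v → c (combine u (rung x)) (combine v (rung x)) ≡ projected same u v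
      level-colour zero u v = refl
      level-colour (suc zero) u v = sym (trans (sym (profile⇒kinds (same-profile zero (suc (suc zero)) (s≤s z≤n)) (suc (suc zero)) u v))
        (trans (profile⇒kinds (trans (same-profile zero (suc (suc zero)) (s≤s z≤n)) (sym (same-profile (suc zero) (suc (suc zero)) (s≤s (s≤s z≤n))))) (suc (suc zero)) u v) refl))
      level-colour (suc (suc zero)) u v = trans
        (profile⇒kinds (same-profile (suc zero) (suc (suc zero)) (s≤s (s≤s z≤n))) (suc (suc (suc zero))) u v) (level-colour (suc zero) u v)

      projected-colour : ∀ o x y u v → stands o x y ≡ true → c (combine u (rung x)) (combine v (rung y)) ≡ projected o u v
      projected-colour same x y u v h with does≡true⇒ (x ≟ y) h
      ... | refl = level-colour x u v
      projected-colour below x y u v h = profile⇒kinds (same-profile x y (does≡true⇒ (_ <? _) h)) zero u v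
      projected-colour above x y u v h = profile⇒kinds (same-profile y x (does≡true⇒ (_ <? _) h)) (suc zero) u v

      -- The two types prescribe the order of the levels, so on these levels the colour of an edge
      -- is a function of its base vertices. This function is a colouring of the smaller graph, to
      -- which the property of `Q` applies.
      lower = sections (λ u v → projected (orderᵀ (type u) (type v)) u v)

      sections′ : ∃[ χ ] (∀ {n} (b : Fin n → T) → (∀ s′ → s′ ∈ s ∷ bad → Avoids b s′) → Section type′ adjacent′ c χ b)
      sections′ = proj₁ lower , λ {n} b avoids → lifted b avoids
        where
        lifted : ∀ {n} (b : Fin n → T) → (∀ s′ → s′ ∈ s ∷ bad → Avoids b s′) → Section type′ adjacent′ c (proj₁ lower) b
        lifted {n} b avoids = σ′ , typed , edges
          where
          inner = proj₂ lower b (λ s′ m → avoids s′ (there m))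
          σ = proj₁ inner
          has-second = does (any? (λ m → b m ≟ᵀ j))
          lev : Fin n → Fin 3
          lev m = level has-second (class (b m))
          σ′ : Fin n → Fin (size * M)
          σ′ m = combine (σ m) (rung (lev m))
          typed : ∀ m → type′ (σ′ m) ≡ b m
          typed m = trans (cong type (base-combine (σ m) (rung (lev m)))) (proj₁ (proj₂ inner) m)
          second⇒ : ∀ m → class (b m) ≡ second → has-second ≡ true
          second⇒ m e = dec-true (any? (λ m → b m ≟ᵀ j)) (m , class-second (b m) e)
          clash : ∀ m m′ → has-second ≡ true → class (b m) ≡ first → class (b m′) ≡ third → ⊥
          clash m m′ h e e′ = avoids s (here refl) (m , class-first (b m) e) (does≡true⇒ (any? (λ m → b m ≟ᵀ j)) h) (m′ , class-third (b m′) e′)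
          ordered : ∀ m m′ → stands (orderᵀ (b m) (b m′)) (lev m) (lev m′) ≡ true
          ordered m m′ = level-order has-second (class (b m)) (class (b m′)) (second⇒ m) (second⇒ m′) (clash m m′) (λ h e e′ → clash m′ m h e′ e)
          edges : ∀ m m′ → E (b m) (b m′) ≡ true → adjacent′ (σ′ m) (σ′ m′) ≡ true × c (σ′ m) (σ′ m′) ≡ proj₁ lower (b m) (b m′)
          edges m m′ e = adjacency , colour
            where
            adj = proj₁ (proj₂ (proj₂ inner) m m′ e)
            matches = proj₂ (proj₂ (proj₂ inner) m m′ e)
            adjacency : adjacent′ (σ′ m) (σ′ m′) ≡ true
            adjacency = ∧-true⁺ (subst₂ (λ u v → adjacent u v ≡ true) (sym (base-combine (σ m) _)) (sym (base-combine (σ m′) _)) adj)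
              (subst₂ (λ x y → stands (orderᵀ (type′ (σ′ m)) (type′ (σ′ m′))) x y ≡ true) (sym (height-combine (σ m) _)) (sym (height-combine (σ m′) _))
                (subst₂ (λ t t′ → stands (orderᵀ t t′) (rung (lev m)) (rung (lev m′)) ≡ true) (sym (typed m)) (sym (typed m′))
                  (stands-rung (orderᵀ (b m) (b m′)) (lev m) (lev m′) (ordered m m′))))
            colour : c (σ′ m) (σ′ m′) ≡ proj₁ lower (b m) (b m′)
            colour = trans (projected-colour (orderᵀ (b m) (b m′)) (lev m) (lev m′) (σ m) (σ m′) (ordered m m′))
              (trans (cong₂ (λ t t′ → projected (orderᵀ t t′) (σ m) (σ m′)) (sym (proj₁ (proj₂ inner) m)) (sym (proj₁ (proj₂ inner) m′))) matches)

    lifted-step : Lifted (s ∷ bad)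
    lifted-step = record
      { size = size * M ; type = type′ ; adjacent = adjacent′ ; adjacent-sym = adjacent′-sym
      ; adjacent⇒E = λ w w′ h → adjacent⇒E (base w) (base w′) (proj₁ (adjacent′⇒ w w′ h))
      ; no-bad = no-bad′ ; sections = sections′ }

  lift : ∀ {τ} (to : T → Fin τ) (from : Fin τ → T) → (∀ t → from (to t) ≡ t) → ∀ bad → Lifted bad
  lift {τ} to from from∘to [] = record
    { size = τ ; type = from ; adjacent = λ u v → E (from u) (from v) ; adjacent-sym = λ u v → E-sym (from u) (from v)
    ; adjacent⇒E = λ u v h → h ; no-bad = λ s () ; sections = λ c → (λ t u → c (to t) (to u)) ,
        λ b _ → to ∘ b , (λ i → from∘to (b i)) , λ i j e → subst₂ (λ t u → E t u ≡ true) (sym (from∘to (b i))) (sym (from∘to (b j))) e , refl }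
  lift to from from∘to (s ∷ bad) = Step.lifted-step s bad (lift to from from∘to bad)

-- Minimal Ramsey graphs

EdgeSet : ℕ → Set
EdgeSet N = Fin N → Fin N → Bool

mono-triangle? : ∀ {r N} (E : EdgeSet N) (c : Colouring r N) → Dec (MonoTriangle E c)
mono-triangle? E c = any? λ a → any? λ b → any? λ d →
  (E a b Bool.≟ true) ×-dec (E b d Bool.≟ true) ×-dec (E a d Bool.≟ true) ×-dec (col c a b ≟ col c b d) ×-dec (col c a b ≟ col c a d)

from-matrix : ∀ {r N} → Matrix (Fin r) N N → Colouring r N
from-matrix M = record { col = pair-colour M ; colSym = pair-colour-sym M }

from-tabulated : ∀ {r N} (c : Colouring r N) x y → pair-colour (tabulated (col c)) x y ≡ col c x y
from-tabulated c x y with toℕ y <ᵇ toℕ x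
... | true  = entry-tabulated (col c) x y
... | false = trans (entry-tabulated (col c) y x) (colSym c y x)

-- `reduce` has to decide whether an edge is critical. Reading a matrix below the diagonal makes it
-- a symmetric colouring, and finitely many matrices represent all colourings pointwise.
ramsey? : ∀ r N (E : EdgeSet N) → Dec (RamseyK3 r N E)
ramsey? r N E = map′ to-all from-all (All.all? (λ M → mono-triangle? E (from-matrix M)) matrices)
  where
  matrices = vecs (vecs (allFin r) N) N
  ∈-matrices : ∀ M → M ∈ matrices
  ∈-matrices M = ∈-vecs _ M (λ x → ∈-vecs _ (lookup M x) (λ y → ∈-allFin _))
  to-all : All (λ M → MonoTriangle E (from-matrix M)) matrices → RamseyK3 r N E
  to-all h c with All.lookup h (∈-matrices (tabulated (col c)))
  ... | a , b , d , ab , bd , ad , e₁ , e₂ = a , b , d , ab , bd , ad ,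
        trans (sym (from-tabulated c a b)) (trans e₁ (from-tabulated c b d)) ,
        trans (sym (from-tabulated c a b)) (trans e₂ (from-tabulated c a d))
  from-all : RamseyK3 r N E → All (λ M → MonoTriangle E (from-matrix M)) matrices
  from-all h = All.tabulate (λ {M} _ → h (from-matrix M))

ramsey-mono : ∀ {r N} {E E′ : EdgeSet N} → (∀ u v → E u v ≡ true → E′ u v ≡ true) → RamseyK3 r N E → RamseyK3 r N E′
ramsey-mono sub h c with h c
... | a , b , d , ab , bd , ad , es = a , b , d , sub a b ab , sub b d bd , sub a d ad , es

joins : ∀ {N} → Fin N → Fin N → Fin N → Fin N → Bool
joins u v x y = (does (x ≟ u) ∧ does (y ≟ v)) ∨ (does (x ≟ v) ∧ does (y ≟ u))

_minus_,_ : ∀ {N} → EdgeSet N → Fin N → Fin N → EdgeSet N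
(E minus u , v) x y = E x y ∧ not (joins u v x y)

joins-sym : ∀ {N} (u v x y : Fin N) → joins u v x y ≡ joins u v y x
joins-sym u v x y = trans (Bool.∨-comm (does (x ≟ u) ∧ does (y ≟ v)) (does (x ≟ v) ∧ does (y ≟ u)))
  (cong₂ _∨_ (Bool.∧-comm (does (x ≟ v)) (does (y ≟ u))) (Bool.∧-comm (does (x ≟ u)) (does (y ≟ v))))

minus-⊆ : ∀ {N} (E : EdgeSet N) u v x y → (E minus u , v) x y ≡ true → E x y ≡ true
minus-⊆ E u v x y h = proj₁ (∧-true (E x y) h)

minus-self : ∀ {N} (E : EdgeSet N) u v → (E minus u , v) u v ≡ false
minus-self E u v rewrite dec-true (u ≟ u) refl | dec-true (v ≟ v) refl = Bool.∧-zeroʳ (E u v)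

minus-other : ∀ {N} (E : EdgeSet N) u v x y → E x y ≡ true → joins u v x y ≡ false → (E minus u , v) x y ≡ true
minus-other E u v x y h j rewrite h | j = refl

edge-count : ∀ {N} → EdgeSet N → ℕ
edge-count {N} E = ∑ (allFin N) (λ u → ∑ (allFin N) (λ v → 𝟙 (E u v)))

edge-count-minus : ∀ {N} (E : EdgeSet N) u v → E u v ≡ true → edge-count (E minus u , v) < edge-count E
edge-count-minus {N} E u v h = ∑-mono-strict (λ x → ∑-mono (allFin N) (λ y → 𝟙-shrinks (E x y) _)) (∈-allFin u)
  (∑-mono-strict (λ y → 𝟙-shrinks (E u y) _) (∈-allFin v) (subst₂ (λ b b′ → 𝟙 b < 𝟙 b′) (sym (minus-self E u v)) (sym h) (s≤s z≤n)))
  where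
  𝟙-shrinks : ∀ b c → 𝟙 (b ∧ c) ≤ 𝟙 b
  𝟙-shrinks true  c = 𝟙≤1 c
  𝟙-shrinks false c = z≤n

-- A Ramsey graph in which the graph on the heavy vertices is not Ramsey and every light vertex has at most X
-- neighbours; these properties pass to Ramsey subgraphs.
record LightRamsey (r X N : ℕ) (E : EdgeSet N) : Set where
  field
    ramsey     : RamseyK3 r N E
    light      : Fin N → Bool
    neighbour  : Fin N → Fin X → Fin N
    covered    : ∀ v w → light v ≡ true → E v w ≡ true → ∃[ i ] neighbour v i ≡ w
    heavy-colouring : Colouring r N
    heavy-good : ∀ a b d → light a ≡ false → light b ≡ false → light d ≡ false → E a b ≡ true → E b d ≡ true → E a d ≡ true →
                 col heavy-colouring a b ≡ col heavy-colouring b d → col heavy-colouring a b ≡ col heavy-colouring a d → ⊥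

module _ {r X : ℕ} where

  delete-edge : ∀ {N} {E : EdgeSet N} u v → LightRamsey r X N E → RamseyK3 r N (E minus u , v) → LightRamsey r X N (E minus u , v)
  delete-edge {E = E} u v L ram = record
    { ramsey = ram ; light = light ; neighbour = neighbour
    ; covered = λ x y l h → covered x y l (sub x y h) ; heavy-colouring = heavy-colouring
    ; heavy-good = λ a b d la lb ld ab bd ad → heavy-good a b d la lb ld (sub a b ab) (sub b d bd) (sub a d ad) }
    where
    open LightRamsey L
    sub = minus-⊆ E u v

  module _ {N} {E : EdgeSet (suc N)} (E-sym : ∀ u v → E u v ≡ E v u) (v : Fin (suc N)) (isolated : ∀ w → E v w ≡ false) (L : LightRamsey r X (suc N) E) where
    open LightRamsey L

    private
      touched⇒≢ : ∀ u w → E u w ≡ true → v ≢ u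
      touched⇒≢ u w h refl = contradiction (trans (sym (isolated w)) h) λ ()

      triangle = ramsey heavy-colouring

      -- The deleted vertex needs some image under π. That a vertex remains follows from the
      -- triangle which the Ramsey property provides: none of its vertices is isolated.
      somewhere : Fin N
      somewhere = punchOut (touched⇒≢ (proj₁ triangle) (proj₁ (proj₂ triangle)) (proj₁ (proj₂ (proj₂ (proj₂ triangle)))))

      π : Fin (suc N) → Fin N
      π u with v ≟ u
      ... | yes _ = somewhere
      ... | no ne = punchOut ne

      punchIn-π : ∀ u → v ≢ u → punchIn v (π u) ≡ u
      punchIn-π u ne with v ≟ u
      ... | yes e  = contradiction e ne
      ... | no ne′ = punchIn-punchOut ne′

      π-punchIn : ∀ u → π (punchIn v u) ≡ u
      π-punchIn u = punchIn-injective v _ _ (punchIn-π (punchIn v u) (λ e → punchInᵢ≢i v u (sym e)))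

    delete-vertex : LightRamsey r X N (λ x y → E (punchIn v x) (punchIn v y))
    delete-vertex = record
      { ramsey = ram ; light = light ∘ punchIn v ; neighbour = λ x i → π (neighbour (punchIn v x) i)
      ; covered = λ x y l h → let i , e = covered (punchIn v x) (punchIn v y) l h in i , trans (cong π e) (π-punchIn y)
      ; heavy-colouring = record { col = λ x y → col heavy-colouring (punchIn v x) (punchIn v y) ; colSym = λ x y → colSym heavy-colouring _ _ }
      ; heavy-good = λ a b d → heavy-good (punchIn v a) (punchIn v b) (punchIn v d) }
      where
      ram : RamseyK3 r N (λ x y → E (punchIn v x) (punchIn v y))
      ram c with ramsey (record { col = λ x y → col c (π x) (π y) ; colSym = λ x y → colSym c _ _ })
      ... | a , b , d , ab , bd , ad , e₁ , e₂ = π a , π b , π d , back a b ab a≢ b≢ , back b d bd b≢ d≢ , back a d ad a≢ d≢ , e₁ , e₂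
        where
        a≢ = touched⇒≢ a b ab
        b≢ = touched⇒≢ b d bd
        d≢ = touched⇒≢ d a (trans (E-sym d a) ad)
        back : ∀ x y → E x y ≡ true → v ≢ x → v ≢ y → E (punchIn v (π x)) (punchIn v (π y)) ≡ true
        back x y h nx ny = subst₂ (λ s t → E s t ≡ true) (sym (punchIn-π x nx)) (sym (punchIn-π y ny)) h

  sum≡∑ : ∀ {A : Set} (xs : List A) (f : A → ℕ) → sum (map f xs) ≡ ∑ xs f
  sum≡∑ []       f = refl
  sum≡∑ (x ∷ xs) f = cong (f x +_) (sum≡∑ xs f)

  light-degree : ∀ {N} {E : EdgeSet N} (L : LightRamsey r X N E) v → LightRamsey.light L v ≡ true →
                 sum (map (λ u → if E v u then 1 else 0) (allFin N)) ≤ X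
  light-degree {N} {E} L v l = begin
    sum (map (λ u → if E v u then 1 else 0) (allFin N)) ≡⟨ sum≡∑ (allFin N) _ ⟩
    ∑ (allFin N) (λ u → if E v u then 1 else 0) ≤⟨ ∑-mono (allFin N) hit ⟩
    ∑ (allFin N) (λ u → ∑ (allFin X) (λ i → 𝟙 (does (u ≟ neighbour v i)))) ≡⟨ ∑-swap (allFin N) (allFin X) _ ⟩
    ∑ (allFin X) (λ i → ∑ (allFin N) (λ u → 𝟙 (does (u ≟ neighbour v i)))) ≡⟨ ∑-cong (allFin X) (λ i → ∑-𝟙≟-one (neighbour v i)) ⟩
    ∑ (allFin X) (λ _ → 1) ≡⟨ trans (length-as-∑ (allFin X)) (length-allFin X) ⟩
    X                                                                             ∎
    where
    open ≤-Reasoning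
    open LightRamsey L
    hit : ∀ u → (if E v u then 1 else 0) ≤ ∑ (allFin X) (λ i → 𝟙 (does (u ≟ neighbour v i)))
    hit u with E v u in e
    ... | false = z≤n
    ... | true with covered v u l e
    ... | i , refl = ≤-trans (≤-reflexive (cong 𝟙 (sym (dec-true (neighbour v i ≟ neighbour v i) refl))))
                       (∑-∈ (∈-allFin i) (λ j → 𝟙 (does (neighbour v i ≟ neighbour v j))))

  some-light : ∀ {N} {E : EdgeSet N} (L : LightRamsey r X N E) → ∃[ v ] LightRamsey.light L v ≡ true
  some-light L with any? (λ v → LightRamsey.light L v Bool.≟ true)
  ... | yes p = p
  ... | no ¬p with LightRamsey.ramsey L (LightRamsey.heavy-colouring L)
  ... | a , b , d , ab , bd , ad , e₁ , e₂ = contradiction (LightRamsey.heavy-good L a b d (heavy a) (heavy b) (heavy d) ab bd ad e₁ e₂) id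
    where
    heavy : ∀ v → LightRamsey.light L v ≡ false
    heavy v with LightRamsey.light L v in e
    ... | false = refl
    ... | true  = contradiction (v , e) ¬p

  -- Isolated vertices must go too, as deleting one also gives a proper subgraph. Afterwards a
  -- subgraph that lacks a vertex lacks an edge, and one that lacks an edge is contained in the
  -- graph minus that edge, which is not Ramsey. The fuel counts edges and is renewed when a vertex
  -- is removed.
  reduce : ∀ N fuel (E : EdgeSet N) (E-sym : ∀ u v → E u v ≡ E v u) (E-irr : ∀ v → E v v ≡ false) →
           edge-count E ≤ fuel → LightRamsey r X N E → s-K3-AtMost r X
  reduce N fuel E E-sym E-irr le L with any? (λ u → any? (λ v → (E u v Bool.≟ true) ×-dec ramsey? r N (E minus u , v)))
  reduce N zero E E-sym E-irr le L | yes (u , v , h , _) = contradiction (≤-trans (edge-count-minus E u v h) le) λ ()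
  reduce N (suc fuel) E E-sym E-irr le L | yes (u , v , h , ram) =
    reduce N fuel (E minus u , v) (λ x y → cong₂ (λ b c → b ∧ not c) (E-sym x y) (joins-sym u v x y)) (λ x → cong (_∧ not (joins u v x x)) (E-irr x))
      (s≤s⁻¹ (≤-trans (edge-count-minus E u v h) le)) (delete-edge u v L ram)
  ... | no critical with any? (λ v → all? (λ w → E v w Bool.≟ false))
  reduce (suc N) fuel E E-sym E-irr le L | no critical | yes (v , isolated) =
    reduce N _ _ (λ x y → E-sym (punchIn v x) (punchIn v y)) (λ x → E-irr (punchIn v x)) ≤-refl (delete-vertex E-sym v isolated L)
  ... | no ¬isolated = G , (LightRamsey.ramsey L , minimal) , proj₁ (some-light L) , light-degree L (proj₁ (some-light L)) (proj₂ (some-light L))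
    where
    G : Graph
    G = record { n = N ; adj = E ; sym = E-sym ; irref = E-irr }
    edge-critical : (H : Subgraph G) → ∀ u v → E u v ≡ true → E' H u v ≡ false → ¬ SubRamseyFor r H
    edge-critical H u v uv missing ram = critical (u , v , uv , ramsey-mono sub ram)
      where
      sub : ∀ x y → E' H x y ≡ true → (E minus u , v) x y ≡ true
      sub x y h = minus-other E u v x y (E'⊆E H x y h) avoid
        where
        avoid : joins u v x y ≡ false
        avoid with x ≟ u | y ≟ v | x ≟ v | y ≟ u
        ... | yes refl | yes refl | _ | _ = contradiction (trans (sym missing) h) λ ()
        ... | _ | _ | yes refl | yes refl = contradiction (trans (sym missing) (trans (E'sym H u v) h)) λ ()
        ... | yes _ | no _  | yes _ | no _ = refl
        ... | yes _ | no _  | no _  | _    = refl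
        ... | no _  | _     | yes _ | no _ = refl
        ... | no _  | _     | no _  | _    = refl
    minimal : (H : Subgraph G) → Proper H → ¬ SubRamseyFor r H
    minimal H (inj₂ (u , v , uv , missing)) = edge-critical H u v uv missing
    minimal H (inj₁ (v , gone)) with any? (λ w → E v w Bool.≟ true)
    ... | no ¬any = contradiction (v , λ w → Bool.¬-not (λ e → ¬any (w , e))) ¬isolated
    ... | yes (w , vw) = edge-critical H v w vw (Bool.¬-not (λ e → contradiction (trans (sym gone) (proj₁ (E'ends H v w e))) λ ()))

-- Forcing equal colours

record Finite (A : Set) : Set where
  field
    card    : ℕ
    to      : A → Fin card
    from    : Fin card → A
    from∘to : ∀ x → from (to x) ≡ x
    _≟ᶠ_    : DecidableEquality A

  elements : List A
  elements = map from (allFin card)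

  ∈-elements : ∀ x → x ∈ elements
  ∈-elements x = subst (_∈ elements) (from∘to x) (∈-map⁺ from (∈-allFin (to x)))

finite-Fin : ∀ n → Finite (Fin n)
finite-Fin n = record { card = n ; to = id ; from = id ; from∘to = λ _ → refl ; _≟ᶠ_ = _≟_ }

finite-⊎ : Finite A → Finite B → Finite (A ⊎ B)
finite-⊎ {A} {B} F G = record { card = F.card + G.card ; to = join F.card G.card ∘ both ; from = back ∘ splitAt F.card
                      ; from∘to = λ x → trans (cong back (splitAt-join F.card G.card (both x))) (back∘both x) ; _≟ᶠ_ = Sum.≡-dec F._≟ᶠ_ G._≟ᶠ_ }
  where
  module F = Finite F
  module G = Finite G
  both : A ⊎ B → Fin F.card ⊎ Fin G.card
  both (inj₁ x) = inj₁ (F.to x)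
  both (inj₂ y) = inj₂ (G.to y)
  back : Fin F.card ⊎ Fin G.card → A ⊎ B
  back (inj₁ i) = inj₁ (F.from i)
  back (inj₂ j) = inj₂ (G.from j)
  back∘both : ∀ x → back (both x) ≡ x
  back∘both (inj₁ x) = cong inj₁ (F.from∘to x)
  back∘both (inj₂ y) = cong inj₂ (G.from∘to y)

finite-× : Finite A → Finite B → Finite (A × B)
finite-× {A} {B} F G = record { card = F.card * G.card ; to = λ (x , y) → combine (F.to x) (G.to y) ; from = back ∘ remQuot {F.card} G.card
                      ; from∘to = λ (x , y) → trans (cong back (remQuot-combine {F.card} (F.to x) (G.to y))) (cong₂ _,_ (F.from∘to x) (G.from∘to y))
                      ; _≟ᶠ_ = Product.≡-dec F._≟ᶠ_ G._≟ᶠ_ }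
  where
  module F = Finite F
  module G = Finite G
  back : Fin F.card × Fin G.card → A × B
  back (i , j) = F.from i , G.from j

record Coloured (r : ℕ) (T : Set) : Set where
  field
    finite : Finite T
    E      : T → T → Bool
    E-sym  : ∀ t u → E t u ≡ E u t
    E-irr  : ∀ t → E t t ≡ false
    χ₀     : T → T → Fin r
    χ₀-sym : ∀ t u → χ₀ t u ≡ χ₀ u t

  Triangle : T → T → T → Set
  Triangle x y z = E x y ≡ true × E y z ≡ true × E x z ≡ true

  MonoIn : (T → T → Fin r) → T → T → T → Set
  MonoIn χ x y z = χ x y ≡ χ y z × χ x y ≡ χ x z

  MonoTri : T × T × T → Set
  MonoTri (x , y , z) = Triangle x y z × MonoIn χ₀ x y z

  mono-tri? : ∀ t → Dec (MonoTri t)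
  mono-tri? (x , y , z) = ((E x y Bool.≟ true) ×-dec (E y z Bool.≟ true) ×-dec (E x z Bool.≟ true)) ×-dec ((χ₀ x y ≟ χ₀ y z) ×-dec (χ₀ x y ≟ χ₀ x z))

  E⇒≢ : ∀ {x y} → E x y ≡ true → x ≢ y
  E⇒≢ {x} h refl = contradiction (trans (sym (E-irr x)) h) λ ()

  swap₁₂ : ∀ {x y z} → MonoTri (x , y , z) → MonoTri (y , x , z)
  swap₁₂ {x} {y} {z} ((xy , yz , xz) , e₁ , e₂) = (trans (E-sym y x) xy , xz , yz) , trans (χ₀-sym y x) e₂ , trans (χ₀-sym y x) e₁

  swap₂₃ : ∀ {x y z} → MonoTri (x , y , z) → MonoTri (x , z , y)
  swap₂₃ {x} {y} {z} ((xy , yz , xz) , e₁ , e₂) = (xz , trans (E-sym z y) yz , xy) , trans (sym e₂) (trans e₁ (χ₀-sym y z)) , sym e₂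

  -- A bad triple is ordered, whereas being monochromatic is not. If the types of such a triangle
  -- occur among three given types, these three form the triangle themselves, since its vertices are
  -- distinct.
  rearrange : ∀ (b : Fin 3 → T) p₁ p₂ p₃ → MonoTri (b p₁ , b p₂ , b p₃) → MonoTri (b zero , b (suc zero) , b (suc (suc zero)))
  rearrange b p₁ p₂ p₃ m with p₁ ≟ p₂ | p₂ ≟ p₃ | p₁ ≟ p₃
  ... | yes refl | _ | _ = contradiction refl (E⇒≢ (proj₁ (proj₁ m)))
  ... | _ | yes refl | _ = contradiction refl (E⇒≢ (proj₁ (proj₂ (proj₁ m))))
  ... | _ | _ | yes refl = contradiction refl (E⇒≢ (proj₂ (proj₂ (proj₁ m))))
  ... | no n₁₂ | no n₂₃ | no n₁₃ = go p₁ p₂ p₃ n₁₂ n₂₃ n₁₃ m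
    where
    go : ∀ p₁ p₂ p₃ → p₁ ≢ p₂ → p₂ ≢ p₃ → p₁ ≢ p₃ → MonoTri (b p₁ , b p₂ , b p₃) → MonoTri (b zero , b (suc zero) , b (suc (suc zero)))
    go zero (suc zero) (suc (suc zero)) _ _ _ m = m
    go zero (suc (suc zero)) (suc zero) _ _ _ m = swap₂₃ m
    go (suc zero) zero (suc (suc zero)) _ _ _ m = swap₁₂ m
    go (suc zero) (suc (suc zero)) zero _ _ _ m = swap₁₂ (swap₂₃ m)
    go (suc (suc zero)) zero (suc zero) _ _ _ m = swap₂₃ (swap₁₂ m)
    go (suc (suc zero)) (suc zero) zero _ _ _ m = swap₁₂ (swap₂₃ (swap₁₂ m))
    go zero zero _ n _ _ m = contradiction refl n
    go (suc zero) (suc zero) _ n _ _ m = contradiction refl n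
    go (suc (suc zero)) (suc (suc zero)) _ n _ _ m = contradiction refl n
    go _ zero zero _ n _ m = contradiction refl n
    go _ (suc zero) (suc zero) _ n _ m = contradiction refl n
    go _ (suc (suc zero)) (suc (suc zero)) _ n _ m = contradiction refl n
    go zero _ zero _ _ n m = contradiction refl n
    go (suc zero) _ (suc zero) _ _ n m = contradiction refl n
    go (suc (suc zero)) _ (suc (suc zero)) _ _ n m = contradiction refl n

-- To every monochromatic triangle of E glue a copy of the rigid colouring along one of its monochromatic
-- triples.  A colouring whose monochromatic triangles are among those of χ₀ then keeps all those of E.
module Gadgets {r : ℕ} (c₀ : Fin r) (rigidity : RigidColouring r) {B : Set} (base : Coloured r B) where

  open Coloured base
  open RigidColouring rigidity
  private module B = Finite finite

  p<q : toℕ p < toℕ q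
  p<q = proj₁ (proj₁ pqs-mono)

  q<s : toℕ q < toℕ s
  q<s = proj₂ (proj₁ pqs-mono)

  point : Fin 3 → Fin N
  point zero             = p
  point (suc zero)       = q
  point (suc (suc zero)) = s

  point-injective : ∀ {i j} → point i ≡ point j → i ≡ j
  point-injective {zero} {zero} _ = refl
  point-injective {suc zero} {suc zero} _ = refl
  point-injective {suc (suc zero)} {suc (suc zero)} _ = refl
  point-injective {zero} {suc zero} eq = contradiction (cong toℕ eq) (<⇒≢ p<q)
  point-injective {suc zero} {zero} eq = contradiction (cong toℕ (sym eq)) (<⇒≢ p<q)
  point-injective {suc zero} {suc (suc zero)} eq = contradiction (cong toℕ eq) (<⇒≢ q<s)
  point-injective {suc (suc zero)} {suc zero} eq = contradiction (cong toℕ (sym eq)) (<⇒≢ q<s)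
  point-injective {zero} {suc (suc zero)} eq = contradiction (cong toℕ eq) (<⇒≢ (<-trans p<q q<s))
  point-injective {suc (suc zero)} {zero} eq = contradiction (cong toℕ (sym eq)) (<⇒≢ (<-trans p<q q<s))

  pair : Fin N → Fin N → Fin r
  pair l l′ = if toℕ l <ᵇ toℕ l′ then g l l′ else g l′ l

  pair-< : ∀ {l l′} → toℕ l < toℕ l′ → pair l l′ ≡ g l l′
  pair-< lt rewrite <ᵇ-true lt = refl

  pair-sym : ∀ l l′ → pair l l′ ≡ pair l′ l
  pair-sym l l′ with <-cmp (toℕ l) (toℕ l′)
  ... | tri< lt _ _ rewrite <ᵇ-true lt | <ᵇ-false (<⇒≤ lt) = refl
  ... | tri> _ _ gt rewrite <ᵇ-true gt | <ᵇ-false (<⇒≤ gt) = refl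
  ... | tri≈ _ eq _ with toℕ-injective eq
  ... | refl = refl

  γ : Fin r
  γ = g p q

  pair-points : ∀ i j → i ≢ j → pair (point i) (point j) ≡ γ
  pair-points zero (suc zero) _ = pair-< p<q
  pair-points zero (suc (suc zero)) _ = trans (pair-< (<-trans p<q q<s)) (sym (proj₂ (proj₂ pqs-mono)))
  pair-points (suc zero) (suc (suc zero)) _ = trans (pair-< q<s) (sym (proj₁ (proj₂ pqs-mono)))
  pair-points (suc zero) zero _ = trans (pair-sym q p) (pair-< p<q)
  pair-points (suc (suc zero)) zero _ = trans (pair-sym s p) (pair-points zero (suc (suc zero)) λ ())
  pair-points (suc (suc zero)) (suc zero) _ = trans (pair-sym s q) (pair-points (suc zero) (suc (suc zero)) λ ())
  pair-points zero zero n = contradiction refl n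
  pair-points (suc zero) (suc zero) n = contradiction refl n
  pair-points (suc (suc zero)) (suc (suc zero)) n = contradiction refl n

  find : ∀ {X : Set} → DecidableEquality X → (Fin 3 → X) → X → Maybe (Fin 3)
  find _≟ˣ_ f x with x ≟ˣ f zero | x ≟ˣ f (suc zero) | x ≟ˣ f (suc (suc zero))
  ... | yes _ | _     | _     = just zero
  ... | no _  | yes _ | _     = just (suc zero)
  ... | no _  | no _  | yes _ = just (suc (suc zero))
  ... | no _  | no _  | no _  = nothing

  find-sound : ∀ {X : Set} (_≟ˣ_ : DecidableEquality X) f x {j} → find _≟ˣ_ f x ≡ just j → x ≡ f j
  find-sound _≟ˣ_ f x e with x ≟ˣ f zero | x ≟ˣ f (suc zero) | x ≟ˣ f (suc (suc zero))
  find-sound _≟ˣ_ f x refl | yes h | _     | _     = h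
  find-sound _≟ˣ_ f x refl | no _  | yes h | _     = h
  find-sound _≟ˣ_ f x refl | no _  | no _  | yes h = h

  find-complete : ∀ {X : Set} (_≟ˣ_ : DecidableEquality X) f → (∀ {i j} → f i ≡ f j → i ≡ j) → ∀ j → find _≟ˣ_ f (f j) ≡ just j
  find-complete _≟ˣ_ f inj j with find _≟ˣ_ f (f j) in e
  ... | just i  = cong just (inj (sym (find-sound _≟ˣ_ f (f j) e)))
  ... | nothing = contradiction e (present j)
    where
    present : ∀ j → find _≟ˣ_ f (f j) ≢ nothing
    present j h with f j ≟ˣ f zero | f j ≟ˣ f (suc zero) | f j ≟ˣ f (suc (suc zero))
    present zero h | no n | _ | _ = n refl
    present (suc zero) h | _ | no n | _ = n refl
    present (suc (suc zero)) h | _ | _ | no n = n refl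
    present j () | yes _ | _ | _
    present j () | no _ | yes _ | _
    present j () | no _ | no _ | yes _

  special : Fin N → Maybe (Fin 3)
  special = find _≟_ point

  Site = B × B × B

  vertex : Site → Fin 3 → B
  vertex (x , y , z) zero             = x
  vertex (x , y , z) (suc zero)       = y
  vertex (x , y , z) (suc (suc zero)) = z

  corner : Site → B → Maybe (Fin 3)
  corner e = find B._≟ᶠ_ (vertex e)

  site-colour : Site → Fin r
  site-colour (x , y , z) = χ₀ x y

  transpose : Fin r → Fin r → Fin r → Fin r
  transpose a b c with c ≟ a | c ≟ b
  ... | yes _ | _     = b
  ... | no _  | yes _ = a
  ... | no _  | no _  = c

  transpose-first : ∀ a b → transpose a b a ≡ b
  transpose-first a b with a ≟ a | a ≟ b
  ... | yes _ | _ = refl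
  ... | no n  | _ = contradiction refl n

  transpose-involutive : ∀ a b c → transpose a b (transpose a b c) ≡ c
  transpose-involutive a b c with c ≟ a | c ≟ b
  ... | yes refl | _ with b ≟ a | b ≟ b
  ...   | yes e | _     = e
  ...   | no _  | yes _ = refl
  ...   | no _  | no n  = contradiction refl n
  transpose-involutive a b c | no _ | yes refl = transpose-first a b
  transpose-involutive a b c | no n | no n′ with c ≟ a | c ≟ b
  ...   | yes e | _     = contradiction e n
  ...   | no _  | yes e = contradiction e n′
  ...   | no _  | no _  = refl

  -- The triple p, q, s has colour γ, the triangle it is glued to has a colour of its own. A
  -- transposition of colours matches them and does not change which triples are monochromatic.
  recolour : Site → Fin r → Fin r
  recolour e = transpose γ (site-colour e)

  recolour-injective : ∀ e {c c′} → recolour e c ≡ recolour e c′ → c ≡ c′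
  recolour-injective e {c} {c′} h = trans (sym (transpose-involutive γ (site-colour e) c)) (trans (cong (recolour e) h) (transpose-involutive γ (site-colour e) c′))

  place : Site → B → Fin N
  place e u = point (fromMaybe zero (corner e u))

  -- Every site carries all of `Fin N`. The vertices of inactive sites and the second copies of p,
  -- q, s are left isolated, which keeps the type a sum of finite products.
  Tᵍ = B ⊎ (Site × Fin N)

  finite-Site : Finite Site
  finite-Site = finite-× finite (finite-× finite finite)

  active : Site → Bool
  active e = does (mono-tri? e)

  _≟ˢ_ = Finite._≟ᶠ_ finite-Site

  spoke : Site → B → Fin N → Bool
  spoke e u l = active e ∧ (is-just (corner e u) ∧ is-nothing (special l))

  Eᵍ : Tᵍ → Tᵍ → Bool
  Eᵍ (inj₁ u)       (inj₁ v)         = E u v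
  Eᵍ (inj₁ u)       (inj₂ (e , l))   = spoke e u l
  Eᵍ (inj₂ (e , l)) (inj₁ u)         = spoke e u l
  Eᵍ (inj₂ (e , l)) (inj₂ (e′ , l′)) = (does (e ≟ˢ e′) ∧ (active e ∧ active e′)) ∧ (not (does (l ≟ l′)) ∧ (is-nothing (special l) ∧ is-nothing (special l′)))

  Eᵍ-sym : ∀ t u → Eᵍ t u ≡ Eᵍ u t
  Eᵍ-sym (inj₁ u)       (inj₁ v)         = E-sym u v
  Eᵍ-sym (inj₁ u)       (inj₂ _)         = refl
  Eᵍ-sym (inj₂ _)       (inj₁ u)         = refl
  Eᵍ-sym (inj₂ (e , l)) (inj₂ (e′ , l′)) = cong₂ _∧_ (cong₂ _∧_ (does-sym _≟ˢ_ e e′) (Bool.∧-comm (active e) (active e′)))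
    (cong₂ _∧_ (cong not (does-sym _≟_ l l′)) (Bool.∧-comm (is-nothing (special l)) (is-nothing (special l′))))

  Eᵍ-irr : ∀ t → Eᵍ t t ≡ false
  Eᵍ-irr (inj₁ u)       = E-irr u
  Eᵍ-irr (inj₂ (e , l)) = trans (cong (λ b → (does (e ≟ˢ e) ∧ (active e ∧ active e)) ∧ (not b ∧ (is-nothing (special l) ∧ is-nothing (special l)))) (dec-true (l ≟ l) refl)) (Bool.∧-zeroʳ _)

  χᵍ : Tᵍ → Tᵍ → Fin r
  χᵍ (inj₁ u)       (inj₁ v)         = χ₀ u v
  χᵍ (inj₁ u)       (inj₂ (e , l))   = recolour e (pair (place e u) l)
  χᵍ (inj₂ (e , l)) (inj₁ u)         = recolour e (pair (place e u) l)
  χᵍ (inj₂ (e , l)) (inj₂ (e′ , l′)) = if does (e ≟ˢ e′) then recolour e (pair l l′) else c₀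

  χᵍ-sym : ∀ t u → χᵍ t u ≡ χᵍ u t
  χᵍ-sym (inj₁ u)       (inj₁ v)         = χ₀-sym u v
  χᵍ-sym (inj₁ u)       (inj₂ _)         = refl
  χᵍ-sym (inj₂ _)       (inj₁ u)         = refl
  χᵍ-sym (inj₂ (e , l)) (inj₂ (e′ , l′)) with e ≟ˢ e′ | e′ ≟ˢ e
  ... | yes refl | yes _ = cong (recolour e) (pair-sym l l′)
  ... | yes eq   | no ne = contradiction (sym eq) ne
  ... | no ne    | yes eq = contradiction (sym eq) ne
  ... | no _     | no _  = refl

  glued : Coloured r Tᵍ
  glued = record { finite = finite-⊎ finite (finite-× finite-Site (finite-Fin N)) ; E = Eᵍ ; E-sym = Eᵍ-sym ; E-irr = Eᵍ-irr ; χ₀ = χᵍ ; χ₀-sym = χᵍ-sym }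

  private module G = Coloured glued

  module _ (e : Site) (mono : MonoTri e) where

    embed : Fin N → Tᵍ
    embed l with special l
    ... | just j  = inj₁ (vertex e j)
    ... | nothing = inj₂ (e , l)

    edges : ∀ i j → i ≢ j → E (vertex e i) (vertex e j) ≡ true × χ₀ (vertex e i) (vertex e j) ≡ site-colour e
    edges zero (suc zero) _ = proj₁ (proj₁ mono) , refl
    edges (suc zero) (suc (suc zero)) _ = proj₁ (proj₂ (proj₁ mono)) , sym (proj₁ (proj₂ mono))
    edges zero (suc (suc zero)) _ = proj₂ (proj₂ (proj₁ mono)) , sym (proj₂ (proj₂ mono))
    edges (suc zero) zero _ = trans (E-sym _ _) (proj₁ (proj₁ mono)) , χ₀-sym _ _
    edges (suc (suc zero)) (suc zero) _ = trans (E-sym _ _) (proj₁ (proj₂ (proj₁ mono))) , trans (χ₀-sym _ _) (sym (proj₁ (proj₂ mono)))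
    edges (suc (suc zero)) zero _ = trans (E-sym _ _) (proj₂ (proj₂ (proj₁ mono))) , trans (χ₀-sym _ _) (sym (proj₂ (proj₂ mono)))
    edges zero zero n = contradiction refl n
    edges (suc zero) (suc zero) n = contradiction refl n
    edges (suc (suc zero)) (suc (suc zero)) n = contradiction refl n

    vertex-injective : ∀ {i j} → vertex e i ≡ vertex e j → i ≡ j
    vertex-injective {i} {j} h with i ≟ j
    ... | yes eq = eq
    ... | no ne  = contradiction h (E⇒≢ (proj₁ (edges i j ne)))

    corner-vertex : ∀ j → corner e (vertex e j) ≡ just j
    corner-vertex = find-complete B._≟ᶠ_ (vertex e) vertex-injective

    is-active : active e ≡ true
    is-active = dec-true (mono-tri? e) mono

    spoke-edge : ∀ j l → special l ≡ nothing → spoke e (vertex e j) l ≡ true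
    spoke-edge j l h rewrite is-active | corner-vertex j | h = refl

    place-vertex : ∀ j → place e (vertex e j) ≡ point j
    place-vertex j = cong (λ m → point (fromMaybe zero m)) (corner-vertex j)

    embed-edge : ∀ l l′ → l ≢ l′ → Eᵍ (embed l) (embed l′) ≡ true × χᵍ (embed l) (embed l′) ≡ recolour e (pair l l′)
    embed-edge l l′ l≢l′ with special l in h | special l′ in h′
    ... | just i  | just j = proj₁ both , trans (proj₂ both) (sym (trans
            (cong (recolour e) (trans (cong₂ pair (find-sound _≟_ point l h) (find-sound _≟_ point l′ h′)) (pair-points i j i≢j))) (transpose-first γ (site-colour e))))
      where
      i≢j : i ≢ j
      i≢j refl = l≢l′ (trans (find-sound _≟_ point l h) (sym (find-sound _≟_ point l′ h′)))
      both = edges i j i≢j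
    ... | just i  | nothing = spoke-edge i l′ h′ , cong (λ m → recolour e (pair m l′)) (trans (place-vertex i) (sym (find-sound _≟_ point l h)))
    ... | nothing | just j  = spoke-edge j l h , cong (recolour e) (trans (cong (λ m → pair m l) (trans (place-vertex j) (sym (find-sound _≟_ point l′ h′)))) (pair-sym l′ l))
    ... | nothing | nothing rewrite dec-true (e ≟ˢ e) refl | is-active | dec-false (l ≟ l′) l≢l′ | h | h′ = refl , refl

    embed-point : ∀ j → embed (point j) ≡ inj₁ (vertex e j)
    embed-point j with special (point j) in h
    ... | just i  = cong (inj₁ ∘ vertex e) (just-injective (trans (sym h) (find-complete _≟_ point point-injective j)))
    ... | nothing = contradiction (trans (sym h) (find-complete _≟_ point point-injective j)) λ ()

    -- Along `embed`, χ becomes a colouring of the pairs of `Fin N` whose monochromatic triples are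
    -- among those of g. By rigidity none is lost, in particular not p, q, s, which is the triangle
    -- of the site.
    forced : ∀ (χ : Tᵍ → Tᵍ → Fin r) → (∀ x y z → G.Triangle x y z → G.MonoIn χ x y z → G.MonoIn χᵍ x y z) →
             G.MonoIn χ (inj₁ (vertex e zero)) (inj₁ (vertex e (suc zero))) (inj₁ (vertex e (suc (suc zero))))
    forced χ sub = transport (proj₂ (rigid h contained (p , q , s) pqs-mono))
      where
      h : Fin N → Fin N → Fin r
      h l l′ = χ (embed l) (embed l′)
      contained : ∀ t → MonoTriple h t → MonoTriple g t
      contained (x , y , z) ((x<y , y<z) , e₁ , e₂) = (x<y , y<z) , back x y y z x<y y<z (proj₁ m) , back x y x z x<y x<z (proj₂ m)
        where
        x<z = <-trans x<y y<z
        ne : ∀ {u v : Fin N} → toℕ u < toℕ v → u ≢ v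
        ne lt refl = <-irrefl refl lt
        m : G.MonoIn χᵍ (embed x) (embed y) (embed z)
        m = sub (embed x) (embed y) (embed z) (proj₁ (embed-edge x y (ne x<y)) , proj₁ (embed-edge y z (ne y<z)) , proj₁ (embed-edge x z (ne x<z))) (e₁ , e₂)
        back : ∀ u v u′ v′ → toℕ u < toℕ v → toℕ u′ < toℕ v′ → χᵍ (embed u) (embed v) ≡ χᵍ (embed u′) (embed v′) → g u v ≡ g u′ v′
        back u v u′ v′ lt lt′ eq = trans (sym (pair-< lt)) (trans (recolour-injective e
          (trans (sym (proj₂ (embed-edge u v (ne lt)))) (trans eq (proj₂ (embed-edge u′ v′ (ne lt′)))))) (pair-< lt′))
      transport : h p q ≡ h q s × h p q ≡ h p s → G.MonoIn χ (inj₁ (vertex e zero)) (inj₁ (vertex e (suc zero))) (inj₁ (vertex e (suc (suc zero))))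
      transport m = subst₂ (λ t u → χ t u ≡ χ u (inj₁ (vertex e (suc (suc zero)))) × χ t u ≡ χ t (inj₁ (vertex e (suc (suc zero))))) (embed-point zero) (embed-point (suc zero))
        (subst (λ v → χ (embed p) (embed q) ≡ χ (embed q) v × χ (embed p) (embed q) ≡ χ (embed p) v) (embed-point (suc (suc zero))) m)

-- From a packing to a minimal Ramsey graph

injective⇒surjective : ∀ {r} (μ : Fin r → Fin r) → (∀ {i j} → μ i ≡ μ j → i ≡ j) → ∀ c → ∃[ i ] μ i ≡ c
injective⇒surjective {suc r} μ inj c with any? (λ i → μ i ≟ c)
... | yes p = p
... | no ¬p = contradiction (cong toℕ (inj (punchOut-injective (avoided i) (avoided j) (proj₂ (proj₂ (proj₂ clash)))))) (<⇒≢ (proj₁ (proj₂ (proj₂ clash))))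
  where
  avoided : ∀ i → c ≢ μ i
  avoided i e = ¬p (i , sym e)
  clash = pigeonhole (n<1+n r) (λ i → punchOut (avoided i))
  i = proj₁ clash
  j = proj₁ (proj₂ clash)

-- The type graph of the construction: the vertices of the packing and, for every colour i, a pair of poles m i 0, m i 1
-- whose edge, as all edges from m i to the packing, has colour i.
module Base {r n : ℕ} (c₀ : Fin r) (S : Packing r n) where
  open Packing S

  Pole = Fin r × Fin 2
  Vertex = Fin n ⊎ Pole

  finite-Vertex : Finite Vertex
  finite-Vertex = finite-⊎ (finite-Fin n) (finite-× (finite-Fin r) (finite-Fin 2))

  _≟ᵖ_ = Finite._≟ᶠ_ (finite-× (finite-Fin r) (finite-Fin 2))

  smaller : Fin r → Fin r → Fin r
  smaller i j = if toℕ i <ᵇ toℕ j then i else j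

  smaller-< : ∀ {i j} → toℕ i < toℕ j → smaller i j ≡ i
  smaller-< {i} {j} lt with toℕ i <ᵇ toℕ j | <⇒<ᵇ lt
  ... | true | _ = refl

  smaller-sym : ∀ i j → smaller i j ≡ smaller j i
  smaller-sym i j with toℕ i <ᵇ toℕ j in e | toℕ j <ᵇ toℕ i in e′
  ... | true  | false = refl
  ... | false | true  = refl
  ... | true  | true  = contradiction (<ᵇ⇒< (toℕ i) (toℕ j) (subst T (sym e) _)) (<⇒≯ (<ᵇ⇒< (toℕ j) (toℕ i) (subst T (sym e′) _)))
  ... | false | false = toℕ-injective (≤-antisym (≮⇒≥ (λ lt → subst T e (<⇒<ᵇ lt))) (≮⇒≥ (λ lt → subst T e′ (<⇒<ᵇ lt))))

  E₀ : Vertex → Vertex → Bool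
  E₀ (inj₁ u) (inj₁ v) = coloured (colour u v)
  E₀ (inj₁ u) (inj₂ x) = true
  E₀ (inj₂ x) (inj₁ u) = true
  E₀ (inj₂ x) (inj₂ y) = not (does (x ≟ᵖ y))

  κ : Vertex → Vertex → Fin r
  κ (inj₁ u)       (inj₁ v)       = fromMaybe c₀ (colour u v)
  κ (inj₁ u)       (inj₂ (i , _)) = i
  κ (inj₂ (i , _)) (inj₁ u)       = i
  κ (inj₂ (i , _)) (inj₂ (j , _)) = smaller i j

  E₀-sym : ∀ t u → E₀ t u ≡ E₀ u t
  E₀-sym (inj₁ u) (inj₁ v) = cong coloured (symmetric u v)
  E₀-sym (inj₁ u) (inj₂ x) = refl
  E₀-sym (inj₂ x) (inj₁ u) = refl
  E₀-sym (inj₂ x) (inj₂ y) = cong not (does-sym _≟ᵖ_ x y)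

  E₀-irr : ∀ t → E₀ t t ≡ false
  E₀-irr (inj₁ u) = cong coloured (loopless u)
  E₀-irr (inj₂ x) = cong not (dec-true (x ≟ᵖ x) refl)

  κ-sym : ∀ t u → κ t u ≡ κ u t
  κ-sym (inj₁ u) (inj₁ v) = cong (fromMaybe c₀) (symmetric u v)
  κ-sym (inj₁ u) (inj₂ x) = refl
  κ-sym (inj₂ x) (inj₁ u) = refl
  κ-sym (inj₂ (i , _)) (inj₂ (j , _)) = smaller-sym i j

  base : Coloured r Vertex
  base = record { finite = finite-Vertex ; E = E₀ ; E-sym = E₀-sym ; E-irr = E₀-irr ; χ₀ = κ ; χ₀-sym = κ-sym }

  open Coloured base using (Triangle; MonoIn; MonoTri)

  module _ (χ : Vertex → Vertex → Fin r)
    (keeps-mono : ∀ x y z → MonoTri (x , y , z) → MonoIn χ x y z)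
    (no-new-mono : ∀ x y z → Triangle x y z → MonoIn χ x y z → MonoIn κ x y z) where

    m : Fin r → Fin 2 → Vertex
    m i b = inj₂ (i , b)

    μ : Fin r → Fin r
    μ i = χ (m i zero) (m i (suc zero))

    poles-differ : ∀ x y → x ≢ y → E₀ (inj₂ x) (inj₂ y) ≡ true
    poles-differ x y ne = cong not (dec-false (x ≟ᵖ y) ne)

    smaller-self : ∀ i → smaller i i ≡ i
    smaller-self i with toℕ i <ᵇ toℕ i
    ... | true  = refl
    ... | false = refl

    χ-spoke : ∀ v i → χ (inj₁ v) (m i zero) ≡ μ i
    χ-spoke v i = proj₁ (keeps-mono (inj₁ v) (m i zero) (m i (suc zero))
      ((refl , poles-differ (i , zero) (i , suc zero) (λ ()) , refl) , sym (smaller-self i) , refl))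

    χ-edge : ∀ u v i → colour u v ≡ just i → χ (inj₁ u) (inj₁ v) ≡ μ i
    χ-edge u v i e = trans (proj₁ (keeps-mono (inj₁ u) (inj₁ v) (m i zero)
      ((cong coloured e , refl , refl) , cong (fromMaybe c₀) e , cong (fromMaybe c₀) e))) (χ-spoke v i)

    χ-poles : ∀ i j → toℕ i < toℕ j → χ (m i zero) (m j zero) ≡ μ i
    χ-poles i j i<j = sym (proj₂ (keeps-mono (m i zero) (m i (suc zero)) (m j zero)
      ((poles-differ (i , zero) (i , suc zero) (λ ()) , poles-differ (i , suc zero) (j , zero) (λ ()) , poles-differ (i , zero) (j , zero) (λ { refl → <-irrefl refl i<j })) ,
        trans (smaller-self i) (sym (smaller-< i<j)) , trans (smaller-self i) (sym (smaller-< i<j)))))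

    -- The triangle v, m i 0, m j 0 has colours i, i, j under κ and μ i, μ i, μ j under χ, so
    -- equality would make it newly monochromatic. The edge between the poles takes the smaller
    -- colour in order to be forced by the triangle m i 0, m i 1, m j 0; this is what the second
    -- pole is for.
    μ-distinct : ∀ (v : Fin n) i j → toℕ i < toℕ j → μ i ≢ μ j
    μ-distinct v i j i<j e = contradiction (cong toℕ (proj₂ new)) (<⇒≢ i<j)
      where
      new : MonoIn κ (inj₁ v) (m i zero) (m j zero)
      new = no-new-mono (inj₁ v) (m i zero) (m j zero) (refl , poles-differ (i , zero) (j , zero) (λ { refl → <-irrefl refl i<j }) , refl)
        (trans (χ-spoke v i) (sym (χ-poles i j i<j)) , trans (χ-spoke v i) (trans e (sym (χ-spoke v j))))

    μ-injective : Fin n → ∀ {i j} → μ i ≡ μ j → i ≡ j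
    μ-injective v {i} {j} e with <-cmp (toℕ i) (toℕ j)
    ... | tri< lt _ _ = contradiction e (μ-distinct v i j lt)
    ... | tri≈ _ eq _ = toℕ-injective eq
    ... | tri> _ _ gt = contradiction (sym e) (μ-distinct v j i gt)

    -- On the packing χ is the given colouring up to the map μ, which is a permutation because it is
    -- injective. So `hitting` is applied to f with μ undone.
    unextendable : ∀ (f : Fin n → Fin r) → ∃[ u ] ∃[ v ] (coloured (colour u v) ≡ true × χ (inj₁ u) (inj₁ v) ≡ f u × f u ≡ f v)
    unextendable f = u , v , cong coloured e , trans (χ-edge u v (f′ u) e) (proj₂ (inverse (f u))) ,
        trans (sym (proj₂ (inverse (f u)))) (trans (cong μ agree) (proj₂ (inverse (f v))))
      where
      v₀ : Fin n
      v₀ = proj₁ (hitting (λ _ → c₀))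
      inverse : ∀ c → ∃[ i ] μ i ≡ c
      inverse = injective⇒surjective μ (μ-injective v₀)
      f′ : Fin n → Fin r
      f′ u = proj₁ (inverse (f u))
      u = proj₁ (hitting f′)
      v = proj₁ (proj₂ (hitting f′))
      e = proj₁ (proj₂ (proj₂ (hitting f′)))
      agree = proj₂ (proj₂ (proj₂ (hitting f′)))

module Construction {r n : ℕ} (c₀ : Fin r) (rigidity : RigidColouring r) (S : Packing r n) where
  open Packing S
  open Base c₀ S using (Vertex; base; κ; E₀; unextendable)
  open Gadgets c₀ rigidity base using (Tᵍ; glued; forced; vertex)
  open Coloured glued
  module Bs = Coloured base
  open Lifting r c₀ (Finite._≟ᶠ_ finite) E E-sym

  to-bad : ∀ t → MonoTri t → BadTriple
  to-bad (x , y , z) ((xy , yz , xz) , _) = bad-triple x y z (E⇒≢ xy) (E⇒≢ yz) (E⇒≢ xz)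

  collect : List (Tᵍ × Tᵍ × Tᵍ) → List BadTriple
  collect []       = []
  collect (t ∷ ts) with mono-tri? t
  ... | yes m = to-bad t m ∷ collect ts
  ... | no _  = collect ts

  Types : BadTriple → Tᵍ × Tᵍ × Tᵍ
  Types s = BadTriple.i s , BadTriple.j s , BadTriple.k s

  collect-mono : ∀ ts {s} → s ∈ collect ts → MonoTri (Types s)
  collect-mono (t ∷ ts) h with mono-tri? t
  collect-mono (t ∷ ts) (here refl) | yes m = m
  collect-mono (t ∷ ts) (there h)   | yes m = collect-mono ts h
  collect-mono (t ∷ ts) h           | no _  = collect-mono ts h

  collect-all : ∀ ts {t} → t ∈ ts → MonoTri t → ∃[ s ] (s ∈ collect ts × Types s ≡ t)
  collect-all (t ∷ ts) (here refl) m with mono-tri? t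
  ... | yes m′ = to-bad t m′ , here refl , refl
  ... | no ¬m  = contradiction m ¬m
  collect-all (t ∷ ts) (there h) m with mono-tri? t | collect-all ts h m
  ... | yes _ | s , p , e = s , there p , e
  ... | no _  | s , p , e = s , p , e

  all-triples : List (Tᵍ × Tᵍ × Tᵍ)
  all-triples = Finite.elements (finite-× finite (finite-× finite finite))

  bads : List BadTriple
  bads = collect all-triples

  lifted : Lifted bads
  lifted = lift (Finite.to finite) (Finite.from finite) (Finite.from∘to finite) bads

  module Completion (Q : Lifted bads) where
    open Lifted Q

    apexes = size ^ n

    N = size + apexes

    sort : Fin N → Fin size ⊎ Fin apexes
    sort = splitAt size

    edge : Fin size ⊎ Fin apexes → Fin size ⊎ Fin apexes → Bool
    edge (inj₁ u) (inj₁ v) = adjacent u v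
    edge (inj₁ u) (inj₂ σ) = does (any? (λ i → finToFun {size} {n} σ i ≟ u))
    edge (inj₂ σ) (inj₁ u) = does (any? (λ i → finToFun {size} {n} σ i ≟ u))
    edge (inj₂ _) (inj₂ _) = false

    edge-sym : ∀ x y → edge x y ≡ edge y x
    edge-sym (inj₁ u) (inj₁ v) = adjacent-sym u v
    edge-sym (inj₁ u) (inj₂ σ) = refl
    edge-sym (inj₂ σ) (inj₁ u) = refl
    edge-sym (inj₂ _) (inj₂ _) = refl

    edge-irr : ∀ x → edge x x ≡ false
    edge-irr (inj₁ u) with adjacent u u in e
    ... | false = refl
    ... | true  = contradiction refl (E⇒≢ {type u} {type u} (adjacent⇒E u u e))
    edge-irr (inj₂ σ) = refl

    F : EdgeSet N
    F x y = edge (sort x) (sort y)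

    low : Fin size → Fin N
    low u = u ↑ˡ apexes

    apex : (Fin n → Fin size) → Fin N
    apex σ = size ↑ʳ funToFin σ

    F-low : ∀ u v → F (low u) (low v) ≡ adjacent u v
    F-low u v = cong₂ edge (splitAt-↑ˡ size u apexes) (splitAt-↑ˡ size v apexes)

    F-apex : ∀ σ i → F (low (σ i)) (apex σ) ≡ true
    F-apex σ i = trans (cong₂ edge (splitAt-↑ˡ size (σ i) apexes) (splitAt-↑ʳ size apexes (funToFin σ)))
      (dec-true (any? (λ j → finToFun (funToFin σ) j ≟ σ i)) (i , finToFun-funToFin σ i))

    module _ (c : Colouring r N) (no-mono-F : ¬ MonoTriangle F c) where

      down = sections (λ u v → col c (low u) (low v))
      χ = proj₁ down

      -- Otherwise the three types would avoid all bad triples, and their section would be a copy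
      -- coloured by χ: a monochromatic triangle in the graph.
      new-mono⇒mono : ∀ x y z → Triangle x y z → MonoIn χ x y z → MonoIn χ₀ x y z
      new-mono⇒mono x y z (xy , yz , xz) (e₁ , e₂) with mono-tri? (x , y , z)
      ... | yes m = proj₂ m
      ... | no ¬m = contradiction (low (σ zero) , low (σ (suc zero)) , low (σ (suc (suc zero))) ,
              trans (F-low _ _) (proj₁ (ed zero (suc zero) xy)) , trans (F-low _ _) (proj₁ (ed (suc zero) (suc (suc zero)) yz)) , trans (F-low _ _) (proj₁ (ed zero (suc (suc zero)) xz)) ,
              trans (proj₂ (ed zero (suc zero) xy)) (trans e₁ (sym (proj₂ (ed (suc zero) (suc (suc zero)) yz)))) ,
              trans (proj₂ (ed zero (suc zero) xy)) (trans e₂ (sym (proj₂ (ed zero (suc (suc zero)) xz))))) no-mono-F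
        where
        b : Fin 3 → Tᵍ
        b zero             = x
        b (suc zero)       = y
        b (suc (suc zero)) = z
        avoids : ∀ s → s ∈ bads → Avoids b s
        avoids s s∈ (p₁ , h₁) (p₂ , h₂) (p₃ , h₃) = ¬m (rearrange b p₁ p₂ p₃
          (subst MonoTri (sym (cong₂ _,_ h₁ (cong₂ _,_ h₂ h₃))) (collect-mono all-triples s∈)))
        section = proj₂ down b avoids
        σ = proj₁ section
        ed = proj₂ (proj₂ section)

      -- The packing contains no monochromatic triangle, so its n types avoid all bad triples and
      -- have a section. The colours from its apex are a map f as in `unextendable`.
      impossible : ⊥
      impossible = no-mono-F (low (σ u) , low (σ v) , apex σ , trans (F-low _ _) (proj₁ (ed u v uv)) , F-apex σ v , F-apex σ u ,
          trans (proj₂ (ed u v uv)) (trans χ≡ agree) , trans (proj₂ (ed u v uv)) χ≡)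
        where
        b : Fin n → Tᵍ
        b u = inj₁ (inj₁ u)
        coloured⇒ : ∀ (c : Colour r) → coloured c ≡ true → ∃[ i ] c ≡ just i
        coloured⇒ (just i) _ = i , refl
        avoids : ∀ s → s ∈ bads → Avoids b s
        avoids s s∈ (u , refl) (v , refl) (w , refl) with collect-mono all-triples s∈
        ... | (uv , vw , uw) , e₁ , e₂ with coloured⇒ _ uv | coloured⇒ _ vw | coloured⇒ _ uw
        ... | i , p | j , q | k , t = no-mono u v w i p (trans q (cong just (sym i≡j))) (trans t (cong just (sym i≡k)))
          where
          i≡j : i ≡ j
          i≡j = trans (sym (cong (fromMaybe c₀) p)) (trans e₁ (cong (fromMaybe c₀) q))
          i≡k : i ≡ k
          i≡k = trans (sym (cong (fromMaybe c₀) p)) (trans e₂ (cong (fromMaybe c₀) t))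
        section = proj₂ down b avoids
        σ = proj₁ section
        ed = proj₂ (proj₂ section)
        f : Fin n → Fin r
        f u = col c (low (σ u)) (apex σ)
        stuck : ∃[ u ] ∃[ v ] (coloured (colour u v) ≡ true × χ (inj₁ (inj₁ u)) (inj₁ (inj₁ v)) ≡ f u × f u ≡ f v)
        stuck = unextendable (λ x y → χ (inj₁ x) (inj₁ y))
          (λ x y z m → forced (x , y , z) m χ new-mono⇒mono)
          (λ x y z → new-mono⇒mono (inj₁ x) (inj₁ y) (inj₁ z)) f
        u = proj₁ stuck
        v = proj₁ (proj₂ stuck)
        uv = proj₁ (proj₂ (proj₂ stuck))
        χ≡ = proj₁ (proj₂ (proj₂ (proj₂ stuck)))
        agree = proj₂ (proj₂ (proj₂ (proj₂ stuck)))

    F-ramsey : RamseyK3 r N F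
    F-ramsey c with mono-triangle? F c
    ... | yes t = t
    ... | no ¬t = ⊥-elim (impossible c ¬t)

    is-apex : Fin size ⊎ Fin apexes → Bool
    is-apex (inj₁ _) = false
    is-apex (inj₂ _) = true

    neighbour-of : Fin N → Fin size ⊎ Fin apexes → Fin n → Fin N
    neighbour-of x (inj₁ _) i = x
    neighbour-of x (inj₂ σ) i = low (finToFun σ i)

    typed-colour : Fin size ⊎ Fin apexes → Fin size ⊎ Fin apexes → Fin r
    typed-colour (inj₁ u) (inj₁ v) = χ₀ (type u) (type v)
    typed-colour (inj₁ _) (inj₂ _) = c₀
    typed-colour (inj₂ _) (inj₁ _) = c₀
    typed-colour (inj₂ _) (inj₂ _) = c₀

    typed-colour-sym : ∀ x y → typed-colour x y ≡ typed-colour y x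
    typed-colour-sym (inj₁ u) (inj₁ v) = χ₀-sym (type u) (type v)
    typed-colour-sym (inj₁ _) (inj₂ _) = refl
    typed-colour-sym (inj₂ _) (inj₁ _) = refl
    typed-colour-sym (inj₂ _) (inj₂ _) = refl

    -- A monochromatic triangle of the colouring by types would have the types of a monochromatic
    -- triangle of χ₀, and all of these are excluded from the lifted graph.
    typed-good : ∀ x y z → is-apex x ≡ false → is-apex y ≡ false → is-apex z ≡ false → edge x y ≡ true → edge y z ≡ true → edge x z ≡ true →
                 typed-colour x y ≡ typed-colour y z → typed-colour x y ≡ typed-colour x z → ⊥
    typed-good (inj₁ u) (inj₁ v) (inj₁ w) _ _ _ uv vw uw e₁ e₂ with collect-all all-triples (Finite.∈-elements (finite-× finite (finite-× finite finite)) (type u , type v , type w))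
      ((adjacent⇒E u v uv , adjacent⇒E v w vw , adjacent⇒E u w uw) , e₁ , e₂)
    ... | s , s∈ , t = no-bad s s∈ u v w (sym (cong proj₁ t)) (sym (cong (proj₁ ∘ proj₂) t)) (sym (cong (proj₂ ∘ proj₂) t)) uv vw uw

    covered-apex : ∀ x y → is-apex (sort x) ≡ true → F x y ≡ true → ∃[ i ] neighbour-of x (sort x) i ≡ y
    covered-apex x y l h = cover (sort x) (sort y) refl l h
      where
      cover : ∀ s t → sort y ≡ t → is-apex s ≡ true → edge s t ≡ true → ∃[ i ] neighbour-of x s i ≡ y
      cover (inj₂ σ) (inj₁ u) e _ h with does≡true⇒ (any? (λ i → finToFun {size} {n} σ i ≟ u)) h
      ... | i , p = i , trans (cong low p) (splitAt⁻¹-↑ˡ e)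

    light-ramsey : LightRamsey r n N F
    light-ramsey = record
      { ramsey = F-ramsey ; light = is-apex ∘ sort ; neighbour = λ x → neighbour-of x (sort x) ; covered = covered-apex
      ; heavy-colouring = record { col = λ x y → typed-colour (sort x) (sort y) ; colSym = λ x y → typed-colour-sym (sort x) (sort y) }
      ; heavy-good = λ a b d → typed-good (sort a) (sort b) (sort d) }

    small-degree : s-K3-AtMost r n
    small-degree = reduce N (edge-count F) F (λ x y → edge-sym (sort x) (sort y)) (λ x → edge-irr (sort x)) ≤-refl light-ramsey

packing⇒s-K3 : ∀ {r n} → Fin r → Packing r n → s-K3-AtMost r n
packing⇒s-K3 {r} c₀ S = Construction.Completion.small-degree c₀ rigidity S (Construction.lifted c₀ rigidity S)
  where rigidity = Rigid.rigid-colouring r c₀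

-- Fewer colours and the final bound

module _ {R r n : ℕ} (r≤R : r ≤ R) (S : Packing R n) where
  open Packing S

  restrict : Colour R → Colour r
  restrict nothing  = nothing
  restrict (just i) with toℕ i <? r
  ... | yes i<r = just (fromℕ< i<r)
  ... | no _    = nothing

  restrict⇒ : ∀ c {i} → restrict c ≡ just i → c ≡ just (inject≤ i r≤R)
  restrict⇒ (just j) e with toℕ j <? r
  restrict⇒ (just j) refl | yes j<r = cong just (toℕ-injective (sym (trans (toℕ-inject≤ (fromℕ< j<r) r≤R) (toℕ-fromℕ< j<r))))

  restrict-inject : ∀ i → restrict (just (inject≤ i r≤R)) ≡ just i
  restrict-inject i with toℕ (inject≤ i r≤R) <? r
  ... | yes lt = cong just (toℕ-injective (trans (toℕ-fromℕ< lt) (toℕ-inject≤ i r≤R)))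
  ... | no ¬lt = contradiction (subst (_< r) (sym (toℕ-inject≤ i r≤R)) (toℕ<n i)) ¬lt

  fewer-colours : Packing r n
  fewer-colours = record
    { colour    = λ u v → restrict (colour u v)
    ; symmetric = λ u v → cong restrict (symmetric u v)
    ; loopless  = λ u → cong restrict (loopless u)
    ; no-mono   = λ u v w i uv vw uw → no-mono u v w (inject≤ i r≤R) (restrict⇒ _ uv) (restrict⇒ _ vw) (restrict⇒ _ uw)
    ; hitting   = λ f → let u , v , e , agree = hitting (λ w → inject≤ (f w) r≤R) in
                    u , v , trans (cong restrict e) (restrict-inject (f u)) , inject≤-injective r≤R r≤R (f u) (f v) agree }

2^log≤ : ∀ n → 1 ≤ n → 2 ^ ⌊log₂ n ⌋ ≤ n
2^log≤ = <-rec _ step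
  where
  step : ∀ n → (∀ {m} → m < n → 1 ≤ m → 2 ^ ⌊log₂ m ⌋ ≤ m) → 1 ≤ n → 2 ^ ⌊log₂ n ⌋ ≤ n
  step (suc zero)        rec _ = ≤-refl
  step n@(suc (suc k)) rec _ = begin
    2 ^ ⌊log₂ n ⌋ ≤⟨ ^-monoʳ-≤ 2 (m≤n+m∸n ⌊log₂ n ⌋ 1) ⟩
    2 * 2 ^ (⌊log₂ n ⌋ ∸ 1) ≡⟨ cong (λ e → 2 * 2 ^ e) (⌊log₂⌊n/2⌋⌋≡⌊log₂n⌋∸1 n) ⟨
    2 * 2 ^ ⌊log₂ ⌊ n /2⌋ ⌋ ≤⟨ *-monoʳ-≤ 2 (rec (⌊n/2⌋<n (suc k)) (s≤s z≤n)) ⟩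
    2 * ⌊ n /2⌋ ≤⟨ ≤-trans (≤-reflexive (cong (⌊ n /2⌋ +_) (+-identityʳ _))) (+-monoʳ-≤ ⌊ n /2⌋ (⌊n/2⌋≤⌈n/2⌉ n)) ⟩
    ⌊ n /2⌋ + ⌈ n /2⌉ ≡⟨ ⌊n/2⌋+⌈n/2⌉≡n n ⟩
    n                                ∎
    where open ≤-Reasoning

<2^suc-log : ∀ n → n < 2 ^ suc ⌊log₂ n ⌋
<2^suc-log n = ≰⇒> λ le → <-irrefl refl (≤-trans (≤-reflexive (sym (⌊log₂[2^n]⌋≡n (suc ⌊log₂ n ⌋)))) (⌊log₂⌋-mono-≤ le))

weaken-degree : ∀ {r X Y} → X ≤ Y → s-K3-AtMost r X → s-K3-AtMost r Y
weaken-degree X≤Y (G , minimal , v , d) = G , minimal , v , ≤-trans d X≤Y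

-- 2²⁰⁴⁸ bounds R²/r², 2³⁶ comes from b, and 129 from t ≤ 129 log₂ r.
C₀ : ℕ
C₀ = P 2084 * 129

theorem1p2 : ∃[ C ] ((1 ≤ C) × ((r : ℕ) → 2 ≤ r → s-K3-AtMost r (C * (r * r) * ⌊log₂ r ⌋)))
theorem1p2 = C₀ , *-mono-≤ {1} {P 2084} {1} {129} (1≤P 2084) (s≤s z≤n) , λ r 2≤r → bound r 2≤r
  where
  bound : ∀ r → 2 ≤ r → s-K3-AtMost r (C₀ * (r * r) * ⌊log₂ r ⌋)
  bound r 2≤r = weaken-degree n≤ (packing⇒s-K3 (fromℕ< (≤-trans (s≤s z≤n) 2≤r)) (fewer-colours r≤R large-packing))
    where
    open ≤-Reasoning
    L = ⌊log₂ r ⌋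
    -- Then 8 s ≤ L < 8 s + 8, so R = 2^(8 s + 1024) lies above r, but by no more than a constant
    -- factor.
    s = L / 8
    open Numbers s using (large-packing) renaming (n to size; r to R)
    1≤L : 1 ≤ L
    1≤L = ≤-trans (≤-reflexive (sym (⌊log₂[2^n]⌋≡n 1))) (⌊log₂⌋-mono-≤ 2≤r)
    8s≤L : 8 * s ≤ L
    8s≤L = ≤-trans (≤-reflexive (*-comm 8 s)) (m/n*n≤m L 8)
    r≤R : r ≤ R
    r≤R = begin
      r ≤⟨ <⇒≤ (<2^suc-log r) ⟩
      2 ^ suc L ≡⟨ P≡2^ (suc L) ⟨
      P (suc L) ≤⟨ P-mono (≤-trans L< (≤-trans (m≤m+n (8 * s + 8) 1016) (≤-reflexive (eq s)))) ⟩
      P (8 * s + 960 + 64)       ∎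
      where
      L< : suc L ≤ 8 * s + 8
      L< = begin
        suc L ≡⟨ cong suc (m≡m%n+[m/n]*n L 8) ⟩
        suc (L % 8) + s * 8 ≤⟨ +-monoˡ-≤ (s * 8) (m%n<n L 8) ⟩
        8 + s * 8 ≡⟨ eq₈ s ⟩
        8 * s + 8                ∎
        where
        eq₈ : ∀ s → 8 + s * 8 ≡ 8 * s + 8
        eq₈ = solve-∀
      eq : ∀ s → 8 * s + 8 + 1016 ≡ 8 * s + 960 + 64
      eq = solve-∀
    n≤ : size ≤ C₀ * (r * r) * L
    n≤ = begin
      P (2 * (8 * s + 960) + 128) * (P 36 * (s + 128)) ≤⟨ *-mono-≤ (P-mono exponent) (*-monoʳ-≤ (P 36) (+-mono-≤ (m/n≤m L 8) (*-monoʳ-≤ 128 1≤L))) ⟩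
      P (2048 + (L + L)) * (P 36 * (L + 128 * L)) ≡⟨ cong₂ _*_ (trans (sym (P-+ 2048 (L + L))) (cong (P 2048 *_) (sym (P-+ L L)))) refl ⟩
      P 2048 * (P L * P L) * (P 36 * (L + 128 * L)) ≡⟨ shuffle (P 2048) (P L) (P 36) L ⟩
      P 2048 * P 36 * 129 * (P L * P L) * L ≡⟨ cong (λ z → z * 129 * (P L * P L) * L) (P-+ 2048 36) ⟩
      C₀ * (P L * P L) * L ≤⟨ *-monoˡ-≤ L (*-monoʳ-≤ C₀ (*-mono-≤ PL≤r PL≤r)) ⟩
      C₀ * (r * r) * L                                    ∎
      where
      PL≤r : P L ≤ r
      PL≤r = ≤-trans (≤-reflexive (P≡2^ L)) (2^log≤ r (≤-trans (s≤s z≤n) 2≤r))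
      exponent : 2 * (8 * s + 960) + 128 ≤ 2048 + (L + L)
      exponent = ≤-trans (≤-reflexive (eq s)) (+-monoʳ-≤ 2048 (+-mono-≤ 8s≤L 8s≤L))
        where
        eq : ∀ s → 2 * (8 * s + 960) + 128 ≡ 2048 + (8 * s + 8 * s)
        eq = solve-∀
      shuffle : ∀ p q u l → p * (q * q) * (u * (l + 128 * l)) ≡ p * u * 129 * (q * q) * l
      shuffle = solve-∀
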